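{- Let $r_0=\lceil 7\ln n\rceil$ and let $T$ be a tree chosen uniformly at random among all trees on the vertex set $[n]$. Then with probability $1-o(1)$ as $n\to\infty$, for every pair of paths $P,P'$ in $T$, each of length $r_0$, which share at most one vertex, the checks of $P$ and $P'$ (each taken from its designated starting vertex) are different.
   Context: For a path $P=(u_0,u_1,\dots,u_r)$ in a tree $T$ with designated starting vertex $u_0$, its check is the binary sequence $b_0b_1\cdots b_r$ where $b_i=0$ if $u_i$ is adjacent to a vertex of degree one in $T$, and $b_i=1$ otherwise. -}

module Defs where

open import Data.Nat using (ℕ; zero; suc; _+_; _*_; _^_; _≤_; _≡ᵇ_; _!)

open import Data.Bool using (Bool; true; false; not; _∧_; if_then_else_)
open import Data.Fin using (Fin; zero; suc; inject₁; fromℕ)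
open import Data.Vec using (Vec; lookup; map)
open import Data.List using (List)
import Data.List as List
open import Data.Bool.ListAction using (any)
open import Data.List.Membership.Propositional using (_∈_)
open import Data.List.Relation.Unary.Unique.Propositional using (Unique)
open import Data.Product using (Σ; _×_; ∃-syntax)
open import Function.Bundles using (_⇔_)
open import Relation.Binary.PropositionalEquality using (_≡_)
open import Relation.Nullary using (¬_)

-- r₀ = ⌈ 7 ln n ⌉
--
-- expNum r k = k! * Σ_{j=0}^{k} r^j / j!   (a natural number), via
--   expNum r 0 = 1,  expNum r (k+1) = (k+1) * expNum r k + r^(k+1).
-- Hence  m * k! ≤ expNum r k  ⇔  Σ_{j≤k} r^j/j! ≥ m.
expNum : ℕ → ℕ → ℕ
expNum r zero    = 1
expNum r (suc k) = suc k * expNum r k + r ^ suc k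

-- e^r ≥ m  (the partial sums of the exponential series increase to e^r;
-- for r ≥ 1, e^r ≠ m since e^r is irrational, and for r = 0 the k = 0 sum
-- is already e^0 = 1, so this is exactly e^r ≥ m).
ExpGe : ℕ → ℕ → Set
ExpGe r m = ∃[ k ] (m * (k !) ≤ expNum r k)

-- r is ⌈ 7 ln n ⌉ : the least natural r with r ≥ 7 ln n, i.e. e^r ≥ n^7.
IsCeil7Ln : ℕ → ℕ → Set
IsCeil7Ln n r = ExpGe r (n ^ 7) × (∀ s → ExpGe s (n ^ 7) → r ≤ s)

Graph : ℕ → Set
Graph n = Vec (Vec Bool n) n

adjB : ∀ {n} → Graph n → Fin n → Fin n → Bool
adjB G u v = lookup (lookup G u) v

Adj : ∀ {n} → Graph n → Fin n → Fin n → Set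
Adj G u v = adjB G u v ≡ true

IsSimple : ∀ {n} → Graph n → Set
IsSimple {n} G = (∀ u v → adjB G u v ≡ adjB G v u) × (∀ u → adjB G u u ≡ false)

data Walk {n} (G : Graph n) : Fin n → Fin n → Set where
  here : ∀ {u} → Walk G u u
  step : ∀ {u v w} → Adj G u v → Walk G v w → Walk G u w

Connected : ∀ {n} → Graph n → Set
Connected {n} G = ∀ (u v : Fin n) → Walk G u v

HasCycle : ∀ {n} → Graph n → Set
HasCycle {n} G =
  ∃[ k ] Σ (Vec (Fin n) (3 + k)) λ c →
    (∀ i j → lookup c i ≡ lookup c j → i ≡ j) ×
    (∀ (i : Fin (2 + k)) → Adj G (lookup c (inject₁ i)) (lookup c (suc i))) ×
    Adj G (lookup c (fromℕ (2 + k))) (lookup c zero)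

IsTree : ∀ {n} → Graph n → Set
IsTree G = IsSimple G × Connected G × ¬ HasCycle G

-- a path of length r (r edges): distinct vertices u₀ … u_r, consecutive adjacent;
-- u₀ is the designated starting vertex.
IsPath : ∀ {n} → Graph n → (r : ℕ) → Vec (Fin n) (suc r) → Set
IsPath {n} G r P =
  (∀ i j → lookup P i ≡ lookup P j → i ≡ j) ×
  (∀ (i : Fin r) → Adj G (lookup P (inject₁ i)) (lookup P (suc i)))

ShareAtMostOne : ∀ {n r s} → Vec (Fin n) r → Vec (Fin n) s → Set
ShareAtMostOne P Q =
  ∀ i j i′ j′ → lookup P i ≡ lookup Q j → lookup P i′ ≡ lookup Q j′ →
    lookup P i ≡ lookup P i′

countTrue : ∀ {m} → Vec Bool m → ℕ
countTrue Vec.[] = 0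
countTrue (b Vec.∷ bs) = (if b then 1 else 0) + countTrue bs

deg : ∀ {n} → Graph n → Fin n → ℕ
deg G v = countTrue (lookup G v)

adjToLeaf : ∀ {n} → Graph n → Fin n → Bool
adjToLeaf {n} G u = any (λ w → adjB G u w ∧ (deg G w ≡ᵇ 1)) (List.allFin n)

check : ∀ {n r} → Graph n → Vec (Fin n) r → Vec Bool r
check G P = map (λ u → not (adjToLeaf G u)) P

BadTree : ∀ {n} → ℕ → Graph n → Set
BadTree {n} r T =
  Σ (Vec (Fin n) (suc r)) λ P → Σ (Vec (Fin n) (suc r)) λ Q →
    IsPath T r P × IsPath T r Q × ShareAtMostOne P Q × check T P ≡ check T Q

-- L is an exact duplicate-free enumeration of the objects satisfying P
-- (so length L is the number of such objects).
Enumerates : ∀ {A : Set} → List A → (A → Set) → Set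
Enumerates {A} L P = Unique L × (∀ x → (x ∈ L) ⇔ P x)

{-# OPTIONS --safe #-}
module Submission where

-- Root every tree at vertex 0 and describe it by its parent map f. A path climbs to its vertex
-- nearest to the root and then descends, so paths P and Q of length r with at most one common vertex
-- prescribe f at 2r vertices besides the root; over all P and Q this leaves about n^(n+1) maps.
-- If the two checks agree then, at every index outside a bounded set, either both vertices have
-- a leaf as a child, which costs a factor e^-1 for each (choose the leaf), or neither has.
-- Let K be the set of vertices of the second kind. Then A = f^-1(K) lies in the image of f; given A
-- this has probability at most (1 - 1/e)^|A| because hits are negatively associated, and
-- summing over A with the binomial theorem gives a factor e^(-1/e) for each vertex of K.
-- As e^-2 + e^(-2/e) < 0.65 and 0.65^7 e^3 < 1, only o(n^(n-2)) maps come from bad trees, while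
-- Prüfer decoding produces n^(n-2) trees.

-- The maps counted are arbitrary: once the parent map of a bad tree is encoded, the absence of
-- cycles is forgotten. Against the n^(n-2) trees this loses a factor n^3, and the 7 in the radius
-- pays for it. As 0.65^7 e^3 is about 0.985, the rational constants have little slack.
--
-- Three degenerate situations shape the encoding: P and Q may meet, an end of a path may itself be
-- a leaf, and the root may be a leaf without being anybody's child. The path vertices concerned are
-- always a top, a second or a penultimate vertex of P or Q, so setting these six vertices aside
-- covers every case and costs only a constant factor.
--
-- All estimates live in ℕ, with fractions cross-multiplied. Here 16/25 stands for 1 - 1/e, so that
-- a vertex of K costs 1 - 16/25 = 9/25 of a possible value of each free coordinate; 15/100 stands
-- for e^-2, 50/100 for e^(-18/25) and 68/25 for e. Powers close to exponentials are cut into about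
-- a hundred blocks, each handled by Bernoulli's inequality, which leaves one comparison of explicit
-- numbers per constant.

open import Defs
open import Data.Nat hiding (_≟_)
open import Data.Nat.Properties hiding (_≟_; suc-injective)
import Data.Nat.Properties as ℕₚ
open import Data.Nat.DivMod using (m≡m%n+[m/n]*n; m%n<n; m/n*n≤m)
open import Data.Nat.Tactic.RingSolver using (solve-∀)
open import Data.Bool using (Bool; true; false; not; _∧_; if_then_else_; T)
open import Data.Bool.ListAction using (any)
import Data.Bool.Properties as Boolₚ
open import Data.Fin using (Fin; zero; suc; inject₁; fromℕ)
open import Data.Fin.Properties using (_≟_; any?; all?; suc-injective; ¬∀⟶∃¬)
open import Data.Fin.Relation.Unary.Top using (view; ‵fromℕ; ‵inject₁)
open import Data.Maybe using (Maybe; just; nothing)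
open import Data.Vec using (Vec; []; _∷_; lookup; tabulate; toList; fromList)
open import Data.Vec.Properties
  using (lookup∘tabulate; tabulate∘lookup; tabulate-cong; toList-injective; length-toList; cast-is-id; ∷-injective)
open import Data.List
  using (List; []; _∷_; _++_; length; map; filter; allFin; upTo; cartesianProduct; cartesianProductWith)
import Data.List as List
open import Data.List.Properties
  using (length-++; length-map; length-tabulate; length-upTo; ++-cancelʳ; map-++; map-∘; map-cong-local)
open import Data.List.Membership.Propositional using (_∈_; _∉_)
open import Data.List.Membership.Propositional.Properties
  using (∈-++⁺ˡ; ∈-++⁺ʳ; ∈-++⁻; ∈-∃++; ∈-map⁺; ∈-map⁻; ∈-filter⁺; ∈-filter⁻; ∈-allFin; ∈-upTo⁺;
         ∈-cartesianProduct⁺; ∈-cartesianProductWith⁺)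
import Data.List.Membership.DecPropositional as DecMem
open import Data.List.Relation.Unary.Any using (here; there)
open import Data.List.Relation.Unary.All as All using (All; []; _∷_)
import Data.List.Relation.Unary.All.Properties as Allₚ
open import Data.List.Relation.Unary.AllPairs as AllPairs using ([]; _∷_)
open import Data.List.Relation.Unary.Unique.Propositional using (Unique)
import Data.List.Relation.Unary.Unique.Propositional.Properties as Uniqueₚ
import Data.List.Relation.Unary.Unique.DecPropositional as DecUnique
open import Data.Product using (Σ; ∃-syntax; _×_; _,_; proj₁; proj₂)
open import Data.Product.Properties using () renaming (≡-dec to ×-≡-dec)
open import Data.Sum using (_⊎_; inj₁; inj₂; swap)
import Data.Sum as Sum
open import Data.Empty using (⊥; ⊥-elim)
open import Data.Unit using (⊤; tt)
open import Function using (_∘_; id)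
open import Function.Bundles using (mk⇔; Equivalence)
open import Relation.Nullary using (Dec; does; yes; no; ¬_; ¬?; _×-dec_; _⊎-dec_; _→-dec_)
open import Relation.Nullary.Decidable using (dec-true; dec-false; does-⇔)
open import Relation.Binary.Construct.Closure.ReflexiveTransitive using (Star; ε; _◅_; _◅◅_; gmap; reverse)
open import Relation.Binary.PropositionalEquality

-- Finite sums and products

∑ : ∀ {A : Set} → List A → (A → ℕ) → ℕ
∑ []       f = 0
∑ (x ∷ xs) f = f x + ∑ xs f

∑-cong : ∀ {A : Set} (xs : List A) {f g : A → ℕ} → (∀ x → f x ≡ g x) → ∑ xs f ≡ ∑ xs g
∑-cong []       eq = refl
∑-cong (x ∷ xs) eq = cong₂ _+_ (eq x) (∑-cong xs eq)

∑-mono : ∀ {A : Set} (xs : List A) {f g : A → ℕ} → (∀ x → f x ≤ g x) → ∑ xs f ≤ ∑ xs g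
∑-mono []       le = z≤n
∑-mono (x ∷ xs) le = +-mono-≤ (le x) (∑-mono xs le)

+-interchange : ∀ a b c d → (a + b) + (c + d) ≡ (a + c) + (b + d)
+-interchange = solve-∀

*-interchange : ∀ a b c d → (a * b) * (c * d) ≡ (a * c) * (b * d)
*-interchange = solve-∀

∑-+ : ∀ {A : Set} (xs : List A) (f g : A → ℕ) → ∑ xs (λ x → f x + g x) ≡ ∑ xs f + ∑ xs g
∑-+ []       f g = refl
∑-+ (x ∷ xs) f g = trans (cong (f x + g x +_) (∑-+ xs f g)) (+-interchange (f x) (g x) (∑ xs f) (∑ xs g))

∑-*ˡ : ∀ {A : Set} (xs : List A) c (f : A → ℕ) → ∑ xs (λ x → c * f x) ≡ c * ∑ xs f
∑-*ˡ []       c f = sym (*-zeroʳ c)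
∑-*ˡ (x ∷ xs) c f = trans (cong (c * f x +_) (∑-*ˡ xs c f)) (sym (*-distribˡ-+ c (f x) (∑ xs f)))

∑-*ʳ : ∀ {A : Set} (xs : List A) c (f : A → ℕ) → ∑ xs (λ x → f x * c) ≡ ∑ xs f * c
∑-*ʳ xs c f = trans (∑-cong xs (λ x → *-comm (f x) c)) (trans (∑-*ˡ xs c f) (*-comm c (∑ xs f)))

∑-const : ∀ {A : Set} (xs : List A) c → ∑ xs (λ _ → c) ≡ length xs * c
∑-const []       c = refl
∑-const (x ∷ xs) c = cong (c +_) (∑-const xs c)

∑-zero : ∀ {A : Set} (xs : List A) → ∑ xs (λ _ → 0) ≡ 0
∑-zero xs = trans (∑-const xs 0) (*-zeroʳ (length xs))

∑-swap : ∀ {A B : Set} (xs : List A) (ys : List B) (f : A → B → ℕ) →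
         ∑ xs (λ x → ∑ ys (f x)) ≡ ∑ ys (λ y → ∑ xs (λ x → f x y))
∑-swap []       ys f = sym (∑-zero ys)
∑-swap (x ∷ xs) ys f = trans (cong (∑ ys (f x) +_) (∑-swap xs ys f)) (sym (∑-+ ys (f x) _))

∑-bound : ∀ {A : Set} (xs : List A) {f : A → ℕ} {c} → (∀ x → f x ≤ c) → ∑ xs f ≤ length xs * c
∑-bound xs le = ≤-trans (∑-mono xs le) (≤-reflexive (∑-const xs _))

∑-++ : ∀ {A : Set} (xs ys : List A) (f : A → ℕ) → ∑ (xs ++ ys) f ≡ ∑ xs f + ∑ ys f
∑-++ []       ys f = refl
∑-++ (x ∷ xs) ys f = trans (cong (f x +_) (∑-++ xs ys f)) (sym (+-assoc (f x) _ _))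

∑-map : ∀ {A B : Set} (g : A → B) (xs : List A) (f : B → ℕ) → ∑ (map g xs) f ≡ ∑ xs (f ∘ g)
∑-map g []       f = refl
∑-map g (x ∷ xs) f = cong (f (g x) +_) (∑-map g xs f)

∑-cartesianProductWith : ∀ {A B C : Set} (g : A → B → C) (xs : List A) (ys : List B) (f : C → ℕ) →
  ∑ (cartesianProductWith g xs ys) f ≡ ∑ xs (λ x → ∑ ys (λ y → f (g x y)))
∑-cartesianProductWith g []       ys f = refl
∑-cartesianProductWith g (x ∷ xs) ys f =
  trans (∑-++ (map (g x) ys) _ f) (cong₂ _+_ (∑-map (g x) ys f) (∑-cartesianProductWith g xs ys f))

∑-member : ∀ {A : Set} {xs : List A} {x} (f : A → ℕ) → x ∈ xs → f x ≤ ∑ xs f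
∑-member f (here refl) = m≤m+n _ _
∑-member f (there x∈)  = ≤-trans (∑-member f x∈) (m≤n+m _ _)

𝟙 : ∀ {ℓ} {P : Set ℓ} → Dec P → ℕ
𝟙 d = if does d then 1 else 0

𝟙-yes : ∀ {ℓ} {P : Set ℓ} (d : Dec P) → P → 𝟙 d ≡ 1
𝟙-yes (yes _) p = refl
𝟙-yes (no ¬p) p = ⊥-elim (¬p p)

𝟙-no : ∀ {ℓ} {P : Set ℓ} (d : Dec P) → ¬ P → 𝟙 d ≡ 0
𝟙-no (yes p) ¬p = ⊥-elim (¬p p)
𝟙-no (no _)  ¬p = refl

𝟙-elim : ∀ {ℓ} {P : Set ℓ} (d : Dec P) {m} → (P → 1 ≤ m) → 𝟙 d ≤ m
𝟙-elim (yes p) h = h p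
𝟙-elim (no _)  h = z≤n

length-filter-∑ : ∀ {A : Set} {P : A → Set} (P? : ∀ x → Dec (P x)) (xs : List A) →
                  length (filter P? xs) ≡ ∑ xs (λ x → 𝟙 (P? x))
length-filter-∑ P? []       = refl
length-filter-∑ P? (x ∷ xs) with P? x
... | yes _ = cong suc (length-filter-∑ P? xs)
... | no _  = length-filter-∑ P? xs

unique-⊆⇒length≤ : ∀ {A : Set} {xs ys : List A} → Unique xs → (∀ {x} → x ∈ xs → x ∈ ys) →
                   length xs ≤ length ys
unique-⊆⇒length≤ [] sub = z≤n
unique-⊆⇒length≤ {A} {x ∷ xs} {ys} (x∉ ∷ u) sub with ∈-∃++ (sub (here refl))
... | as , bs , refl = begin
  suc (length xs)              ≤⟨ s≤s (unique-⊆⇒length≤ u sub′) ⟩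
  suc (length (as ++ bs))      ≡⟨ cong suc (length-++ as) ⟩
  suc (length as + length bs)  ≡⟨ sym (+-suc (length as) (length bs)) ⟩
  length as + suc (length bs)  ≡⟨ sym (length-++ as) ⟩
  length (as ++ x ∷ bs)        ∎
  where
  open ≤-Reasoning
  sub′ : ∀ {y} → y ∈ xs → y ∈ as ++ bs
  sub′ {y} y∈ with ∈-++⁻ as (sub (there y∈))
  ... | inj₁ y∈as         = ∈-++⁺ˡ y∈as
  ... | inj₂ (here refl)  = ⊥-elim (All.lookup x∉ y∈ refl)
  ... | inj₂ (there y∈bs) = ∈-++⁺ʳ as y∈bs

-- The union bound: an object may have many codes, so `decode` only has to reach every listed object
-- from some code that satisfies `P`.
cover : ∀ {A B : Set} {P : A → Set} (P? : ∀ a → Dec (P a)) (decode : A → B) (as : List A) {xs : List B} →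
        Unique xs → (∀ {x} → x ∈ xs → ∃[ a ] (a ∈ as × P a × decode a ≡ x)) →
        length xs ≤ ∑ as (λ a → 𝟙 (P? a))
cover P? decode as {xs} u h = begin
  length xs                               ≤⟨ unique-⊆⇒length≤ u sub ⟩
  length (map decode (filter P? as))      ≡⟨ length-map decode (filter P? as) ⟩
  length (filter P? as)                   ≡⟨ length-filter-∑ P? as ⟩
  ∑ as (λ a → 𝟙 (P? a))                   ∎
  where
  open ≤-Reasoning
  sub : ∀ {x} → x ∈ xs → x ∈ map decode (filter P? as)
  sub x∈ with h x∈
  ... | a , a∈ , pa , refl = ∈-map⁺ decode (∈-filter⁺ P? a∈ pa)

allVec : ∀ {A : Set} → List A → ∀ m → List (Vec A m)
allVec xs zero    = [] ∷ []
allVec xs (suc m) = cartesianProductWith _∷_ xs (allVec xs m)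

∈-allVec : ∀ {A : Set} {xs : List A} → (∀ x → x ∈ xs) → ∀ {m} (v : Vec A m) → v ∈ allVec xs m
∈-allVec h []      = here refl
∈-allVec h (x ∷ v) = ∈-cartesianProductWith⁺ _∷_ (h x) (∈-allVec h v)

allVec-unique : ∀ {A : Set} {xs : List A} → Unique xs → ∀ m → Unique (allVec xs m)
allVec-unique u zero    = All.[] ∷ []
allVec-unique u (suc m) = Uniqueₚ.cartesianProductWith⁺ _∷_ (λ { refl → refl , refl }) u (allVec-unique u m)

∑-allVec-suc : ∀ {A : Set} (xs : List A) m (f : Vec A (suc m) → ℕ) →
  ∑ (allVec xs (suc m)) f ≡ ∑ xs (λ x → ∑ (allVec xs m) (λ v → f (x ∷ v)))
∑-allVec-suc xs m f = ∑-cartesianProductWith _∷_ xs (allVec xs m) f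

length-∑ : ∀ {A : Set} (xs : List A) → length xs ≡ ∑ xs (λ _ → 1)
length-∑ xs = sym (trans (∑-const xs 1) (*-identityʳ _))

length-allVec : ∀ {A : Set} (xs : List A) m → length (allVec xs m) ≡ length xs ^ m
length-allVec xs zero    = refl
length-allVec xs (suc m) = begin
  length (allVec xs (suc m))                     ≡⟨ length-∑ (allVec xs (suc m)) ⟩
  ∑ (allVec xs (suc m)) (λ _ → 1)                ≡⟨ ∑-allVec-suc xs m (λ _ → 1) ⟩
  ∑ xs (λ _ → ∑ (allVec xs m) (λ _ → 1))         ≡⟨ ∑-cong xs (λ _ → trans (sym (length-∑ (allVec xs m))) (length-allVec xs m)) ⟩
  ∑ xs (λ _ → length xs ^ m)                     ≡⟨ ∑-const xs _ ⟩
  length xs * length xs ^ m                      ∎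
  where open ≡-Reasoning

∏ : ∀ {m} → (Fin m → ℕ) → ℕ
∏ {zero}  a = 1
∏ {suc m} a = a zero * ∏ (a ∘ suc)

∏-cong : ∀ {m} {a b : Fin m → ℕ} → (∀ i → a i ≡ b i) → ∏ a ≡ ∏ b
∏-cong {zero}  h = refl
∏-cong {suc m} h = cong₂ _*_ (h zero) (∏-cong (h ∘ suc))

∏-mono : ∀ {m} {a b : Fin m → ℕ} → (∀ i → a i ≤ b i) → ∏ a ≤ ∏ b
∏-mono {zero}  h = ≤-refl
∏-mono {suc m} h = *-mono-≤ (h zero) (∏-mono (h ∘ suc))

∏-* : ∀ {m} (a b : Fin m → ℕ) → ∏ (λ i → a i * b i) ≡ ∏ a * ∏ b
∏-* {zero}  a b = refl
∏-* {suc m} a b = trans (cong (a zero * b zero *_) (∏-* (a ∘ suc) (b ∘ suc)))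
                        (*-interchange (a zero) (b zero) (∏ (a ∘ suc)) (∏ (b ∘ suc)))

∏-const : ∀ m c → ∏ {m} (λ _ → c) ≡ c ^ m
∏-const zero    c = refl
∏-const (suc m) c = cong (c *_) (∏-const m c)

-- Independence of coordinates. It sums out the set A one vertex at a time, and later the
-- certificate one index at a time.
∏-∑ : ∀ {A : Set} (xs : List A) m (a : Fin m → A → ℕ) →
      ∑ (allVec xs m) (λ v → ∏ (λ i → a i (lookup v i))) ≡ ∏ (λ i → ∑ xs (a i))
∏-∑ xs zero    a = refl
∏-∑ xs (suc m) a = begin
  ∑ (allVec xs (suc m)) (λ v → ∏ (λ i → a i (lookup v i)))
    ≡⟨ ∑-allVec-suc xs m _ ⟩
  ∑ xs (λ x → ∑ (allVec xs m) (λ v → a zero x * ∏ (λ i → a (suc i) (lookup v i))))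
    ≡⟨ ∑-cong xs (λ x → trans (∑-*ˡ (allVec xs m) (a zero x) _) (cong (a zero x *_) (∏-∑ xs m (a ∘ suc)))) ⟩
  ∑ xs (λ x → a zero x * ∏ (λ i → ∑ xs (a (suc i))))
    ≡⟨ ∑-*ʳ xs _ (a zero) ⟩
  ∑ xs (a zero) * ∏ (λ i → ∑ xs (a (suc i))) ∎
  where open ≡-Reasoning

1≤∏ : ∀ {m} (a : Fin m → ℕ) → (∀ i → 1 ≤ a i) → 1 ≤ ∏ a
1≤∏ {zero}  a h = ≤-refl
1≤∏ {suc m} a h = *-mono-≤ (h zero) (1≤∏ (a ∘ suc) (h ∘ suc))

^-distribʳ-* : ∀ k a b → (a * b) ^ k ≡ a ^ k * b ^ k
^-distribʳ-* zero    a b = refl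
^-distribʳ-* (suc k) a b = trans (cong (a * b *_) (^-distribʳ-* k a b)) (*-interchange a b (a ^ k) (b ^ k))

-- Hitting prescribed values

𝟚 : Bool → ℕ
𝟚 b = if b then 1 else 0

card : ∀ {n} → (Fin n → Bool) → ℕ
card {n} B = ∑ (allFin n) (𝟚 ∘ B)

_∖_ : ∀ {n} → (Fin n → Bool) → Fin n → Fin n → Bool
(B ∖ v) u = if does (u ≟ v) then false else B u

∑-point : ∀ {n} (xs : List (Fin n)) → Unique xs → ∀ {v} → v ∈ xs → (c : Fin n → ℕ) →
          ∑ xs (λ u → if does (u ≟ v) then c u else 0) ≡ c v
∑-point (x ∷ xs) (x∉ ∷ u) {v} v∈ c with x ≟ v
... | yes refl = trans (cong (c x +_) (rest xs x∉)) (+-identityʳ _)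
  where
  rest : ∀ ys → All.All (λ y → ¬ x ≡ y) ys → ∑ ys (λ u → if does (u ≟ x) then c u else 0) ≡ 0
  rest []       _          = refl
  rest (y ∷ ys) (p All.∷ ps) with y ≟ x
  ... | yes refl = ⊥-elim (p refl)
  ... | no _     = rest ys ps
∑-point (x ∷ xs) (x∉ ∷ u) (here refl) c | no x≢v = ⊥-elim (x≢v refl)
∑-point (x ∷ xs) (x∉ ∷ u) (there v∈)  c | no x≢v = ∑-point xs u v∈ c

∑-allFin-point : ∀ {n} (v : Fin n) (c : Fin n → ℕ) →
                 ∑ (allFin n) (λ u → if does (u ≟ v) then c u else 0) ≡ c v
∑-allFin-point {n} v c = ∑-point (allFin n) (Uniqueₚ.allFin⁺ n) (∈-allFin v) c

card-∖ : ∀ {n} (B : Fin n → Bool) v → card B ≡ 𝟚 (B v) + card (B ∖ v)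
card-∖ {n} B v = begin
  card B
    ≡⟨ ∑-cong (allFin n) split ⟩
  ∑ (allFin n) (λ u → (if does (u ≟ v) then 𝟚 (B u) else 0) + 𝟚 ((B ∖ v) u))
    ≡⟨ ∑-+ (allFin n) _ _ ⟩
  ∑ (allFin n) (λ u → if does (u ≟ v) then 𝟚 (B u) else 0) + card (B ∖ v)
    ≡⟨ cong (_+ card (B ∖ v)) (∑-allFin-point v (𝟚 ∘ B)) ⟩
  𝟚 (B v) + card (B ∖ v) ∎
  where
  open ≡-Reasoning
  split : ∀ u → 𝟚 (B u) ≡ (if does (u ≟ v) then 𝟚 (B u) else 0) + 𝟚 ((B ∖ v) u)
  split u with u ≟ v
  ... | yes _ = sym (+-identityʳ _)
  ... | no _  = refl

-- The indicator that every point of `B` is a value of `f`: each value crosses off its point, and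
-- `0 ^ card` is 1 exactly when nothing is left.
hits : ∀ {n m} → (Fin n → Bool) → Vec (Fin n) m → ℕ
hits B []      = 0 ^ card B
hits B (v ∷ f) = hits (B ∖ v) f

1≤hits : ∀ {n m} (B : Fin n → Bool) (f : Vec (Fin n) m) →
         (∀ v → B v ≡ true → ∃[ i ] lookup f i ≡ v) → 1 ≤ hits B f
1≤hits {n} B [] h = ≤-reflexive (sym (cong (0 ^_) card≡0))
  where
  empty : ∀ v → 𝟚 (B v) ≡ 0
  empty v with B v in eq
  ... | false = refl
  ... | true with h v eq
  ...   | () , _
  card≡0 : card B ≡ 0
  card≡0 = trans (∑-cong (allFin n) empty) (∑-zero (allFin n))
1≤hits B (v ∷ f) h = 1≤hits (B ∖ v) f h′
  where
  h′ : ∀ u → (B ∖ v) u ≡ true → ∃[ i ] lookup f i ≡ u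
  h′ u eq with u ≟ v
  ... | no u≢v with h u eq
  ...   | zero  , refl = ⊥-elim (u≢v refl)
  ...   | suc i , p    = i , p

bernoulli-+ : ∀ x c k → x ^ suc k + suc k * (x ^ k * c) ≤ (x + c) ^ suc k
bernoulli-+ x c zero    = ≤-reflexive (lemma x c)
  where
  lemma : ∀ x c → x * 1 + ((c + 0) + 0) ≡ (x + c) * 1
  lemma = solve-∀
bernoulli-+ x c (suc k) = begin
  x * p + suc (suc k) * (p * c)                      ≤⟨ m≤m+n _ _ ⟩
  x * p + suc (suc k) * (p * c) + suc k * ((x ^ k * c) * c) ≡⟨ lemma x c (x ^ k) (suc k) ⟩
  (x + c) * (p + suc k * (x ^ k * c))                ≤⟨ *-monoʳ-≤ (x + c) (bernoulli-+ x c k) ⟩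
  (x + c) * (x + c) ^ suc k                          ∎
  where
  open ≤-Reasoning
  p = x ^ suc k
  lemma : ∀ x c q s → x * (x * q) + (1 + s) * ((x * q) * c) + s * ((q * c) * c)
                    ≡ (x + c) * (x * q + s * (q * c))
  lemma = solve-∀

-- The numbers of words of length m over d + 1 letters that avoid, respectively contain, one given
-- letter. A word containing it either contains it after the first position, or starts with it and
-- avoids it afterwards.
missed covered : ℕ → ℕ → ℕ
missed  d m = d ^ m
covered d zero    = 0
covered d (suc m) = suc d * covered d m + missed d m

covered+missed : ∀ d m → covered d m + missed d m ≡ suc d ^ m
covered+missed d zero    = refl
covered+missed d (suc m) = trans (lemma d (covered d m) (d ^ m)) (cong (suc d *_) (covered+missed d m))
  where
  lemma : ∀ d e c → (suc d * e + c) + d * c ≡ suc d * (e + c)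
  lemma = solve-∀

-- Negative association of the hits: the bound on the probability is π^|B| with
-- π = 1 - (d/(d+1))^m, as if the points of B were hit independently.
hits-bound : ∀ {n} d m (a : Fin m → Fin n → ℕ) (B : Fin n → Bool) →
  (∀ i v → B v ≡ true → a i v * suc d ≤ ∑ (allFin n) (a i)) →
  ∑ (allVec (allFin n) m) (λ f → ∏ (λ i → a i (lookup f i)) * hits B f) * (suc d ^ m) ^ card B
    ≤ ∏ (λ i → ∑ (allFin n) (a i)) * covered d m ^ card B
hits-bound {n} d zero a B h = ≤-reflexive (trans (cong₂ _*_ (lemma (0 ^ card B)) (^-zeroˡ (card B))) (*-comm (0 ^ card B) 1))
  where
  lemma : ∀ x → (x + 0) + 0 ≡ x
  lemma = solve-∀
hits-bound {n} d (suc m) a B h = go (card B) refl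
  where
  open ≤-Reasoning
  V = allFin n
  a′ : Fin m → Fin n → ℕ
  a′ = a ∘ suc
  S : (Fin n → Bool) → ℕ
  S C = ∑ (allVec V m) (λ f → ∏ (λ i → a′ i (lookup f i)) * hits C f)
  W′ W₀ q e c : ℕ
  W′ = ∏ (λ i → ∑ V (a′ i))
  W₀ = ∑ V (a zero)
  q = suc d ^ m
  e = covered d m
  c = missed d m
  unfold : ∑ (allVec V (suc m)) (λ f → ∏ (λ i → a i (lookup f i)) * hits B f)
         ≡ ∑ V (λ v → a zero v * S (B ∖ v))
  unfold = trans (∑-allVec-suc V m _) (∑-cong V (λ v →
    trans (∑-cong (allVec V m) (λ f → *-assoc (a zero v) _ _)) (∑-*ˡ (allVec V m) (a zero v) _)))
  IH : ∀ v → S (B ∖ v) * q ^ card (B ∖ v) ≤ W′ * e ^ card (B ∖ v)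
  IH v = hits-bound d m a′ (B ∖ v) h′
    where
    h′ : ∀ i u → (B ∖ v) u ≡ true → a′ i u * suc d ≤ ∑ V (a′ i)
    h′ i u eq with u ≟ v
    ... | no _ = h (suc i) u eq
  goal : ℕ → Set
  goal y = ∑ (allVec V (suc m)) (λ f → ∏ (λ i → a i (lookup f i)) * hits B f) * (suc d * q) ^ y
           ≤ (W₀ * W′) * (suc d * e + c) ^ y
  go : ∀ y → card B ≡ y → goal y
  go zero eq = begin
    ∑ (allVec V (suc m)) _ * 1        ≡⟨ trans (*-identityʳ _) unfold ⟩
    ∑ V (λ v → a zero v * S (B ∖ v))  ≤⟨ ∑-mono V (λ v → *-monoʳ-≤ (a zero v) (perv v)) ⟩
    ∑ V (λ v → a zero v * W′)         ≡⟨ ∑-*ʳ V W′ (a zero) ⟩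
    W₀ * W′                           ≡⟨ sym (*-identityʳ _) ⟩
    (W₀ * W′) * 1                     ∎
    where
    perv : ∀ v → S (B ∖ v) ≤ W′
    perv v with card (B ∖ v) | m+n≡0⇒n≡0 (𝟚 (B v)) (trans (sym (card-∖ B v)) eq) | IH v
    ... | .0 | refl | ih = subst₂ _≤_ (*-identityʳ _) (*-identityʳ _) ih
  go (suc y) eq = begin
    ∑ (allVec V (suc m)) _ * (suc d * q) ^ suc y
      ≡⟨ cong₂ _*_ unfold (^-distribʳ-* (suc y) (suc d) q) ⟩
    ∑ V (λ v → a zero v * S (B ∖ v)) * (suc d ^ suc y * q ^ suc y)
      ≡⟨ lem₁ (∑ V (λ v → a zero v * S (B ∖ v))) (suc d ^ suc y) (q ^ suc y) ⟩
    suc d ^ suc y * (∑ V (λ v → a zero v * S (B ∖ v)) * q ^ suc y)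
      ≡⟨ cong (suc d ^ suc y *_) (sym (∑-*ʳ V (q ^ suc y) _)) ⟩
    suc d ^ suc y * ∑ V (λ v → (a zero v * S (B ∖ v)) * q ^ suc y)
      -- Condition on the first value v. Outside `B` it leaves y + 1 points to hit. Inside it leaves
      -- only y, and the factor q = e + c released in this way splits into the same main term and a
      -- surplus c e^y.
      ≤⟨ *-monoʳ-≤ (suc d ^ suc y) (∑-mono V perv) ⟩
    suc d ^ suc y * ∑ V (λ v → a zero v * (W′ * e ^ suc y) + (𝟚 (B v) * a zero v) * (W′ * (c * e ^ y)))
      ≡⟨ cong (suc d ^ suc y *_) (trans (∑-+ V _ _) (cong₂ _+_ (∑-*ʳ V _ _) (∑-*ʳ V _ _))) ⟩
    suc d ^ suc y * (W₀ * (W′ * e ^ suc y) + ∑ V (λ v → 𝟚 (B v) * a zero v) * (W′ * (c * e ^ y)))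
      ≡⟨ lem₂ (suc d) (suc d ^ y) W₀ W′ (e ^ y) e c (∑ V (λ v → 𝟚 (B v) * a zero v)) ⟩
    (W₀ * W′) * ((suc d * e) * (suc d ^ y * e ^ y)) + (∑ V (λ v → 𝟚 (B v) * a zero v) * suc d) * (W′ * ((suc d ^ y * e ^ y) * c))
      -- Each point of `B` carries at most the fraction 1/(d+1) of the first weight, so all of `B`
      -- carries at most (y+1)/(d+1).
      ≤⟨ +-monoʳ-≤ ((W₀ * W′) * ((suc d * e) * (suc d ^ y * e ^ y))) (*-monoˡ-≤ (W′ * ((suc d ^ y * e ^ y) * c)) light) ⟩
    (W₀ * W′) * ((suc d * e) * (suc d ^ y * e ^ y)) + (suc y * W₀) * (W′ * ((suc d ^ y * e ^ y) * c))
      ≡⟨ lem₃ W₀ W′ ((suc d * e) * (suc d ^ y * e ^ y)) (suc y) ((suc d ^ y * e ^ y) * c) ⟩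
    (W₀ * W′) * ((suc d * e) * (suc d ^ y * e ^ y) + suc y * ((suc d ^ y * e ^ y) * c))
      ≡⟨ cong (λ t → (W₀ * W′) * ((suc d * e) * t + suc y * (t * c))) (sym (^-distribʳ-* y (suc d) e)) ⟩
    (W₀ * W′) * ((suc d * e) ^ suc y + suc y * ((suc d * e) ^ y * c))
      -- What remains are the first two terms of the binomial expansion whose base is
      -- `covered d (suc m)`.
      ≤⟨ *-monoʳ-≤ (W₀ * W′) (bernoulli-+ (suc d * e) c y) ⟩
    (W₀ * W′) * (suc d * e + c) ^ suc y ∎
    where
    lem₁ : ∀ s a b → s * (a * b) ≡ a * (s * b)
    lem₁ = solve-∀
    lem₂ : ∀ D Dy w w′ ey e c s → (D * Dy) * (w * (w′ * (e * ey)) + s * (w′ * (c * ey)))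
         ≡ (w * w′) * ((D * e) * (Dy * ey)) + (s * D) * (w′ * ((Dy * ey) * c))
    lem₂ = solve-∀
    lem₃ : ∀ w w′ x y z → (w * w′) * x + (y * w) * (w′ * z) ≡ (w * w′) * (x + y * z)
    lem₃ = solve-∀
    lem₄ : ∀ s q r e c → (e + c) * (s * q) ≡ s * ((e + c) * q)
    lem₄ = solve-∀
    light : ∑ V (λ v → 𝟚 (B v) * a zero v) * suc d ≤ suc y * W₀
    light = begin
      ∑ V (λ v → 𝟚 (B v) * a zero v) * suc d    ≡⟨ sym (∑-*ʳ V (suc d) _) ⟩
      ∑ V (λ v → (𝟚 (B v) * a zero v) * suc d)  ≤⟨ ∑-mono V pt ⟩
      ∑ V (λ v → 𝟚 (B v) * W₀)                  ≡⟨ ∑-*ʳ V W₀ (𝟚 ∘ B) ⟩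
      card B * W₀                               ≡⟨ cong (_* W₀) eq ⟩
      suc y * W₀                                ∎
      where
      pt : ∀ v → (𝟚 (B v) * a zero v) * suc d ≤ 𝟚 (B v) * W₀
      pt v with B v in Bv
      ... | false = z≤n
      ... | true  = subst₂ _≤_ (cong (_* suc d) (sym (+-identityʳ (a zero v)))) (sym (+-identityʳ W₀)) (h zero v Bv)
    perv : ∀ v → (a zero v * S (B ∖ v)) * q ^ suc y
             ≤ a zero v * (W′ * e ^ suc y) + (𝟚 (B v) * a zero v) * (W′ * (c * e ^ y))
    perv v with B v | card-∖ B v
    ... | false | ceq = begin
      (a zero v * S (B ∖ v)) * q ^ suc y  ≡⟨ *-assoc (a zero v) _ _ ⟩
      a zero v * (S (B ∖ v) * q ^ suc y)  ≤⟨ *-monoʳ-≤ (a zero v) (subst (λ k → S (B ∖ v) * q ^ k ≤ W′ * e ^ k) (trans (sym ceq) eq) (IH v)) ⟩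
      a zero v * (W′ * e ^ suc y)         ≡⟨ sym (+-identityʳ _) ⟩
      a zero v * (W′ * e ^ suc y) + 0     ∎
    ... | true | ceq = begin
      (a zero v * S (B ∖ v)) * (q * q ^ y)                ≡⟨ lem₅ (a zero v) (S (B ∖ v)) q (q ^ y) ⟩
      (a zero v * q) * (S (B ∖ v) * q ^ y)                ≤⟨ *-monoʳ-≤ (a zero v * q) (subst (λ k → S (B ∖ v) * q ^ k ≤ W′ * e ^ k) (ℕₚ.suc-injective (trans (sym ceq) eq)) (IH v)) ⟩
      (a zero v * q) * (W′ * e ^ y)                       ≡⟨ cong (λ t → (a zero v * t) * (W′ * e ^ y)) (sym (covered+missed d m)) ⟩
      (a zero v * (e + c)) * (W′ * e ^ y)                 ≡⟨ lem₆ (a zero v) e c W′ (e ^ y) ⟩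
      a zero v * (W′ * (e * e ^ y)) + (a zero v + 0) * (W′ * (c * e ^ y)) ∎
      where
      lem₅ : ∀ a s q r → (a * s) * (q * r) ≡ (a * q) * (s * r)
      lem₅ = solve-∀
      lem₆ : ∀ a e c w y → (a * (e + c)) * (w * y) ≡ a * (w * (e * y)) + (a + 0) * (w * (c * y))
      lem₆ = solve-∀

hits-bound-ratio : ∀ {n} d m (a : Fin m → Fin n → ℕ) (B : Fin n → Bool) (p r : ℕ) →
  (∀ i v → B v ≡ true → a i v * suc d ≤ ∑ (allFin n) (a i)) →
  covered d m * r ≤ p * suc d ^ m →
  ∑ (allVec (allFin n) m) (λ f → ∏ (λ i → a i (lookup f i)) * hits B f) * r ^ card B
    ≤ ∏ (λ i → ∑ (allFin n) (a i)) * p ^ card B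
hits-bound-ratio {n} d m a B p r h ratio =
  *-cancelʳ-≤ _ _ (D ^ y) {{>-nonZero (≤-trans (≤-reflexive (sym (^-zeroˡ y))) (^-monoˡ-≤ y 1≤D))}} (begin
  S * r ^ y * D ^ y               ≡⟨ lem S (r ^ y) (D ^ y) ⟩
  S * D ^ y * r ^ y               ≤⟨ *-monoˡ-≤ (r ^ y) (hits-bound d m a B h) ⟩
  W * covered d m ^ y * r ^ y     ≡⟨ trans (*-assoc W _ _) (cong (W *_) (sym (^-distribʳ-* y (covered d m) r))) ⟩
  W * (covered d m * r) ^ y       ≤⟨ *-monoʳ-≤ W (^-monoˡ-≤ y ratio) ⟩
  W * (p * D) ^ y                 ≡⟨ trans (cong (W *_) (^-distribʳ-* y p D)) (sym (*-assoc W _ _)) ⟩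
  W * p ^ y * D ^ y               ∎)
  where
  open ≤-Reasoning
  y = card B
  D = suc d ^ m
  W = ∏ (λ i → ∑ (allFin n) (a i))
  S = ∑ (allVec (allFin n) m) (λ f → ∏ (λ i → a i (lookup f i)) * hits B f)
  1≤D : 1 ≤ D
  1≤D = ≤-trans (≤-reflexive (sym (^-zeroˡ m))) (^-monoˡ-≤ m (s≤s z≤n))
  lem : ∀ a b c → a * b * c ≡ a * c * b
  lem = solve-∀

-- Counting parent maps with prescribed, exempt and regular coordinates

^∑-tabulate : ∀ {n m} c (g : Fin m → Fin n) (B : Fin n → Bool) →
              c ^ ∑ (List.tabulate g) (𝟚 ∘ B) ≡ ∏ (λ i → if B (g i) then c else 1)
^∑-tabulate {m = zero}  c g B = refl
^∑-tabulate {m = suc m} c g B = trans (^-distribˡ-+-* c (𝟚 (B (g zero))) _)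
  (cong₂ _*_ (head (B (g zero))) (^∑-tabulate c (g ∘ suc) B))
  where
  head : ∀ b → c ^ 𝟚 b ≡ (if b then c else 1)
  head true  = *-identityʳ c
  head false = refl

^card : ∀ {n} c (B : Fin n → Bool) → c ^ card B ≡ ∏ (λ i → if B i then c else 1)
^card c B = ^∑-tabulate c id B

length-allFin : ∀ n → length (allFin n) ≡ n
length-allFin n = length-tabulate id

card-not : ∀ {n} (B : Fin n → Bool) → card B + card (not ∘ B) ≡ n
card-not {n} B = trans (sym (∑-+ (allFin n) (𝟚 ∘ B) (𝟚 ∘ not ∘ B)))
  (trans (∑-cong (allFin n) (λ v → lem (B v))) (trans (sym (length-∑ (allFin n))) (length-allFin n)))
  where
  lem : ∀ b → 𝟚 b + 𝟚 (not b) ≡ 1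
  lem true  = refl
  lem false = refl

-- The treatment of a coordinate w of the parent function f: a prescribed value, a free value
-- with no constraint on w, or a free value with w in the image of f as soon as f w ∈ K.
data Class (n : ℕ) : Set where
  forced  : Fin n → Class n
  exempt  : Class n
  regular : Class n

isRegular : ∀ {n} → Class n → Bool
isRegular (forced _) = false
isRegular exempt     = false
isRegular regular    = true

record Admissible {n} (cls : Fin n → Class n) (K X : Fin n → Bool) (f : Vec (Fin n) n) : Set where
  field
    obeys  : ∀ w v → cls w ≡ forced v → lookup f w ≡ v
    avoids : ∀ w → X (lookup f w) ≡ false
    closed : ∀ w → cls w ≡ regular → K (lookup f w) ≡ true → ∃[ y ] lookup f y ≡ w

-- `num / den` is the contribution of one coordinate after its membership in A is summed out. A
-- regular coordinate has D values outside `K` and `X`, and k values in `K`; the latter are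
-- discounted by 16/25 because the coordinate itself must then be hit.
num den : ∀ {n} → ℕ → ℕ → Class n → ℕ
num D k (forced _) = 1
num D k exempt     = 25 * (D + k)
num D k regular    = 16 * k + 25 * D
den D k (forced _) = 1
den D k exempt     = 25
den D k regular    = 25

-- Negative association needs every vertex that must be hit to carry at most 1/D of the weight of
-- each coordinate. A prescribed value carries all of it, and a vertex of `K` up to 1/k once f w is
-- known to lie in `K`. Both kinds are therefore kept irregular, so that they are never among the
-- vertices to be hit.
module Count {n} (d : ℕ) (cls : Fin n → Class n) (K X : Fin n → Bool)
  (disjoint : ∀ v → K v ≡ true → X v ≡ true → ⊥)
  (K-irregular : ∀ v → K v ≡ true → isRegular (cls v) ≡ false)
  (values-irregular : ∀ w v → cls w ≡ forced v → isRegular (cls v) ≡ false)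
  (size : card X + (card K + suc d) ≡ n)
  (ratio : covered d n * 25 ≤ 16 * suc d ^ n) where

  private
    V = allFin n
    D = suc d
    k = card K

  -- The bit stands for membership in A, that is, "regular with value in `K`". Every `f` that avoids
  -- `X` and obeys the prescriptions thus has nonzero weight for a single bit vector, and for a
  -- fixed bit vector the coordinates are independent.
  wt : Class n → Bool → Fin n → ℕ
  wt (forced u) true  v = 0
  wt (forced u) false v = if does (v ≟ u) then 1 else 0
  wt exempt     true  v = 0
  wt exempt     false v = 𝟚 (not (X v))
  wt regular    true  v = 𝟚 (K v)
  wt regular    false v = 𝟚 (not (K v) ∧ not (X v))

  total : Class n → Bool → ℕ
  total (forced _) b = if b then 0 else 1
  total exempt     b = if b then 0 else D + k
  total regular    b = if b then k else D

  card-notX : card (not ∘ X) ≡ D + k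
  card-notX = +-cancelˡ-≡ (card X) _ _ (trans (card-not X) (trans (sym size) (cong (card X +_) (+-comm k D))))

  card-neither : card (λ v → not (K v) ∧ not (X v)) ≡ D
  card-neither = +-cancelˡ-≡ k _ _ (trans (trans (sym (∑-+ V _ _)) (∑-cong V split)) (trans card-notX (+-comm D k)))
    where
    split : ∀ v → 𝟚 (K v) + 𝟚 (not (K v) ∧ not (X v)) ≡ 𝟚 (not (X v))
    split v with K v in Kv | X v in Xv
    ... | true  | true  = ⊥-elim (disjoint v Kv Xv)
    ... | true  | false = refl
    ... | false | _     = refl

  ∑-wt : ∀ c b → ∑ V (wt c b) ≡ total c b
  ∑-wt (forced u) true  = ∑-zero V
  ∑-wt (forced u) false = ∑-allFin-point u (λ _ → 1)
  ∑-wt exempt     true  = ∑-zero V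
  ∑-wt exempt     false = card-notX
  ∑-wt regular    true  = refl
  ∑-wt regular    false = card-neither

  needy : Vec Bool n → Fin n → Bool
  needy A v = lookup A v ∧ isRegular (cls v)

  S : Vec Bool n → ℕ
  S A = ∑ (allVec V n) (λ f → ∏ (λ w → wt (cls w) (lookup A w) (lookup f w)) * hits (needy A) f)

  private
    𝟚≤1 : ∀ b → 𝟚 b ≤ 1
    𝟚≤1 true  = ≤-refl
    𝟚≤1 false = z≤n

  light : ∀ v → isRegular (cls v) ≡ true → ∀ w b → wt (cls w) b v * D ≤ total (cls w) b
  light v reg w b = go (cls w) b refl
    where
    K≡false : K v ≡ false
    K≡false with K v in Kv
    ... | false = refl
    ... | true with trans (sym reg) (K-irregular v Kv)
    ...   | ()
    go : ∀ c b → cls w ≡ c → wt c b v * D ≤ total c b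
    go (forced u) true  eq = z≤n
    go (forced u) false eq with v ≟ u
    ... | no _ = z≤n
    ... | yes refl with trans (sym reg) (values-irregular w v eq)
    ...   | ()
    go exempt     true  eq = z≤n
    go exempt     false eq = ≤-trans (*-monoˡ-≤ D (𝟚≤1 (not (X v)))) (≤-trans (≤-reflexive (*-identityˡ D)) (m≤m+n D k))
    go regular    true  eq rewrite K≡false = z≤n
    go regular    false eq = ≤-trans (*-monoˡ-≤ D (𝟚≤1 (not (K v) ∧ not (X v)))) (≤-reflexive (*-identityˡ D))

  S-bound : ∀ A → S A * 25 ^ card (needy A) ≤ ∏ (λ w → total (cls w) (lookup A w)) * 16 ^ card (needy A)
  S-bound A = subst (λ t → S A * 25 ^ card (needy A) ≤ t * 16 ^ card (needy A))
    (∏-cong (λ w → ∑-wt (cls w) (lookup A w)))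
    (hits-bound-ratio d n (λ w → wt (cls w) (lookup A w)) (needy A) 16 25 hyp ratio)
    where
    hyp : ∀ w v → needy A v ≡ true → wt (cls w) (lookup A w) v * D ≤ ∑ V (wt (cls w) (lookup A w))
    hyp w v eq = ≤-trans (light v (∧-true (lookup A v) eq) w (lookup A w)) (≤-reflexive (sym (∑-wt (cls w) (lookup A w))))
      where
      ∧-true : ∀ a {b} → (a ∧ b) ≡ true → b ≡ true
      ∧-true true  eq = eq

  -- Supplements the powers of 25 already spent on the vertices that must be hit, so that the
  -- denominator no longer depends on A.
  co : Class n → Bool → ℕ
  co (forced _) b = 1
  co exempt     b = 25
  co regular    b = if b then 1 else 25

  num′ : Class n → Bool → ℕ
  num′ c b = total c b * (if b ∧ isRegular c then 16 else 1) * co c b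

  S-bound′ : ∀ A → S A * ∏ (λ w → den D k (cls w)) ≤ ∏ (λ w → num′ (cls w) (lookup A w))
  S-bound′ A = begin
    S A * ∏ (λ w → den D k (cls w))
      ≡⟨ cong (S A *_) (trans (∏-cong (λ w → den-split (cls w) (lookup A w))) (∏-* (pow 25) c)) ⟩
    S A * (∏ (λ w → if needy A w then 25 else 1) * C)
      ≡⟨ cong (λ s → S A * (s * C)) (sym (^card 25 (needy A))) ⟩
    S A * (25 ^ card (needy A) * C)
      ≡⟨ sym (*-assoc (S A) _ C) ⟩
    S A * 25 ^ card (needy A) * C
      ≤⟨ *-monoˡ-≤ C (S-bound A) ⟩
    ∏ (λ w → total (cls w) (lookup A w)) * 16 ^ card (needy A) * C
      ≡⟨ cong (λ s → ∏ t * s * C) (^card 16 (needy A)) ⟩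
    ∏ (λ w → total (cls w) (lookup A w)) * ∏ (λ w → if needy A w then 16 else 1) * C
      ≡⟨ cong (_* C) (sym (∏-* t (pow 16))) ⟩
    ∏ (λ w → total (cls w) (lookup A w) * (if needy A w then 16 else 1)) * C
      ≡⟨ sym (∏-* (λ w → t w * pow 16 w) c) ⟩
    ∏ (λ w → num′ (cls w) (lookup A w)) ∎
    where
    open ≤-Reasoning
    t c : Fin n → ℕ
    t w = total (cls w) (lookup A w)
    c w = co (cls w) (lookup A w)
    pow : ℕ → Fin n → ℕ
    pow x w = if needy A w then x else 1
    C = ∏ c
    den-split : ∀ c b → den D k c ≡ (if b ∧ isRegular c then 25 else 1) * co c b
    den-split (forced _) true  = refl
    den-split (forced _) false = refl
    den-split exempt     true  = refl
    den-split exempt     false = refl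
    den-split regular    true  = refl
    den-split regular    false = refl

  num-split : ∀ c → ∑ (true ∷ false ∷ []) (num′ c) ≡ num D k c
  num-split (forced _) = refl
  num-split exempt     = lem (D + k)
    where
    lem : ∀ x → 0 * 25 + (x * 1 * 25 + 0) ≡ 25 * x
    lem = solve-∀
  num-split regular    = lem k D
    where
    lem : ∀ k D → k * 16 * 1 + (D * 1 * 25 + 0) ≡ 16 * k + 25 * D
    lem = solve-∀

  allBool : List Bool
  allBool = true ∷ false ∷ []

  attached : Vec (Fin n) n → Vec Bool n
  attached f = tabulate (λ w → isRegular (cls w) ∧ K (lookup f w))

  -- The witness is the true set A of `f`, namely `attached f`; its term alone is at least 1, which
  -- is enough for an upper bound on the count.
  admissible⇒1≤ : ∀ f → Admissible cls K X f →
    1 ≤ ∑ (allVec allBool n) (λ A → ∏ (λ w → wt (cls w) (lookup A w) (lookup f w)) * hits (needy A) f)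
  admissible⇒1≤ f adm = ≤-trans (*-mono-≤ (1≤∏ _ pt) (1≤hits (needy A) f hit))
    (∑-member (λ A → ∏ (λ w → wt (cls w) (lookup A w) (lookup f w)) * hits (needy A) f) (∈-allVec all-in A))
    where
    open Admissible adm
    A = attached f
    all-in : ∀ b → b ∈ allBool
    all-in true  = here refl
    all-in false = there (here refl)
    look : ∀ w → lookup A w ≡ isRegular (cls w) ∧ K (lookup f w)
    look w = lookup∘tabulate _ w
    pt : ∀ w → 1 ≤ wt (cls w) (lookup A w) (lookup f w)
    pt w rewrite look w with cls w in eq
    ... | forced u rewrite obeys w u eq with u ≟ u
    ...   | yes _  = ≤-refl
    ...   | no u≢u = ⊥-elim (u≢u refl)
    pt w | exempt rewrite avoids w = ≤-refl
    pt w | regular with K (lookup f w) in Kf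
    ... | true rewrite Kf = ≤-refl
    ... | false rewrite Kf | avoids w = ≤-refl
    hit : ∀ v → needy A v ≡ true → ∃[ y ] lookup f y ≡ v
    hit v eq rewrite look v with cls v in ceq
    ... | regular with K (lookup f v) in Kf
    ...   | true = closed v ceq Kf

  count-bound : ∀ {P : Vec (Fin n) n → Set} (P? : ∀ f → Dec (P f)) →
    (∀ f → P f → Admissible cls K X f) →
    ∑ (allVec V n) (λ f → 𝟙 (P? f)) * ∏ (λ w → den D k (cls w)) ≤ ∏ (λ w → num D k (cls w))
  count-bound P? adm = begin
    ∑ (allVec V n) (λ f → 𝟙 (P? f)) * Δ
      ≤⟨ *-monoˡ-≤ Δ (∑-mono (allVec V n) (λ f → 𝟙-elim (P? f) (λ p → admissible⇒1≤ f (adm f p)))) ⟩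
    ∑ (allVec V n) (λ f → ∑ (allVec allBool n) (λ A → ∏ (λ w → wt (cls w) (lookup A w) (lookup f w)) * hits (needy A) f)) * Δ
      ≡⟨ cong (_* Δ) (∑-swap (allVec V n) (allVec allBool n) _) ⟩
    ∑ (allVec allBool n) S * Δ
      ≡⟨ sym (∑-*ʳ (allVec allBool n) Δ S) ⟩
    ∑ (allVec allBool n) (λ A → S A * Δ)
      ≤⟨ ∑-mono (allVec allBool n) S-bound′ ⟩
    ∑ (allVec allBool n) (λ A → ∏ (λ w → num′ (cls w) (lookup A w)))
      ≡⟨ ∏-∑ allBool n (λ w → num′ (cls w)) ⟩
    ∏ (λ w → ∑ allBool (num′ (cls w)))
      ≡⟨ ∏-cong (λ w → num-split (cls w)) ⟩
    ∏ (λ w → num D k (cls w)) ∎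
    where
    open ≤-Reasoning
    Δ = ∏ (λ w → den D k (cls w))

-- Prüfer codes and the number of trees

does-true : ∀ {ℓ} {P : Set ℓ} (d : Dec P) → does d ≡ true → P
does-true (yes p) _ = p

Star⇒Walk : ∀ {n} {G : Graph n} {u v} → Star (Adj G) u v → Walk G u v
Star⇒Walk ε       = here
Star⇒Walk (e ◅ w) = step e (Star⇒Walk w)

HasTwoNeighbours : ∀ {n} → Graph n → (Fin n → Set) → Fin n → Set
HasTwoNeighbours G C v = ∃[ a ] ∃[ b ] (a ≢ b × C a × C b × Adj G v a × Adj G v b)

OnCycle : ∀ {n m} → Vec (Fin n) m → Fin n → Set
OnCycle c v = ∃[ i ] lookup c i ≡ v

-- Puts cycles into the form that leaf removal contradicts: a set of vertices each having two
-- neighbours inside it. The two are distinct because a cycle has at least three vertices.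
cycle-two-neighbours : ∀ {n} {G : Graph n} → IsSimple G → (cyc : HasCycle G) →
  ∀ v → OnCycle (proj₁ (proj₂ cyc)) v → HasTwoNeighbours G (OnCycle (proj₁ (proj₂ cyc))) v
cycle-two-neighbours {G = G} (symm , _) (k , c , inj , adj , closing) v (i , refl) = go i
  where
  symAdj : ∀ {x y} → Adj G x y → Adj G y x
  symAdj {x} {y} e = trans (symm y x) e
  go : ∀ i → HasTwoNeighbours G (OnCycle c) (lookup c i)
  go zero = lookup c (suc zero) , lookup c (fromℕ (2 + k)) , (λ eq → 1≢last (inj _ _ eq)) ,
            (_ , refl) , (_ , refl) , adj zero , symAdj closing
    where
    1≢last : ¬ (Fin.suc zero ≡ fromℕ (2 + k))
    1≢last ()
  go (suc j) with view j
  ... | ‵fromℕ = lookup c (inject₁ (fromℕ (1 + k))) , lookup c zero , (λ eq → pre≢0 (inj _ _ eq)) ,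
            (_ , refl) , (_ , refl) , symAdj (adj (fromℕ (1 + k))) , closing
    where
    pre≢0 : ¬ (inject₁ (fromℕ (1 + k)) ≡ zero)
    pre≢0 ()
  ... | ‵inject₁ j′ = lookup c (inject₁ (inject₁ j′)) , lookup c (suc (suc j′)) , (λ eq → ne j′ (inj _ _ eq)) ,
            (_ , refl) , (_ , refl) , symAdj (adj (inject₁ j′)) , adj (suc j′)
    where
    ne : ∀ {m} (j : Fin m) → ¬ (inject₁ (inject₁ j) ≡ suc (suc j))
    ne zero ()
    ne (suc j) eq = ne j (suc-injective eq)

module _ {n : ℕ} where
  private
    V = Fin n

  open DecMem (_≟_ {n}) using (_∈?_)
  open DecMem (×-≡-dec (_≟_ {n}) (_≟_ {n})) using () renaming (_∈?_ to _∈ᴱ?_)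

  Nb : List (V × V) → V → V → Set
  Nb Es u v = (u , v) ∈ Es ⊎ (v , u) ∈ Es

  Nb? : ∀ Es u v → Dec (Nb Es u v)
  Nb? Es u v = ((u , v) ∈ᴱ? Es) ⊎-dec ((v , u) ∈ᴱ? Es)

  Nb-∷ : ∀ {e Es u v} → Nb Es u v → Nb (e ∷ Es) u v
  Nb-∷ (inj₁ p) = inj₁ (there p)
  Nb-∷ (inj₂ p) = inj₂ (there p)

  edgeGraph : List (V × V) → Graph n
  edgeGraph Es = tabulate (λ u → tabulate (λ v → does (Nb? Es u v)))

  adjB-edgeGraph : ∀ Es u v → adjB (edgeGraph Es) u v ≡ does (Nb? Es u v)
  adjB-edgeGraph Es u v = trans (cong (λ r → lookup r v) (lookup∘tabulate _ u)) (lookup∘tabulate _ v)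

  Adj⇒Nb : ∀ Es {u v} → Adj (edgeGraph Es) u v → Nb Es u v
  Adj⇒Nb Es {u} {v} e = does-true (Nb? Es u v) (trans (sym (adjB-edgeGraph Es u v)) e)

  Nb⇒Adj : ∀ Es {u v} → Nb Es u v → Adj (edgeGraph Es) u v
  Nb⇒Adj Es {u} {v} p = trans (adjB-edgeGraph Es u v) (dec-true (Nb? Es u v) p)

module Prüfer {n : ℕ} (root : Fin n) where
  private
    V = Fin n

  open DecMem (_≟_ {n}) using (_∈?_)

  first : (V → Bool) → List V → V
  first p []       = root
  first p (x ∷ xs) = if p x then x else first p xs

  first-satisfies : ∀ (p : V → Bool) {xs : List V} {v} → v ∈ xs → p v ≡ true → p (first p xs) ≡ true
  first-satisfies p {x ∷ xs} v∈ pv with p x in px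
  ... | true = px
  first-satisfies p (here refl) pv | false with trans (sym px) pv
  ... | ()
  first-satisfies p (there v∈) pv | false = first-satisfies p v∈ pv

  first-cong : ∀ {p q : V → Bool} → (∀ v → p v ≡ q v) → ∀ xs → first p xs ≡ first q xs
  first-cong h []       = refl
  first-cong h (x ∷ xs) rewrite h x | first-cong h xs = refl

  fresh : List V → V
  fresh L = first (λ v → not (does (v ∈? L))) (allFin n)

  fresh-∉ : ∀ L → length L < n → fresh L ∉ L
  fresh-∉ L lt ∈L with ¬∀⟶∃¬ n (_∈ L) (_∈? L) (λ all → <⇒≱ lt (≤-trans (≤-reflexive (sym (length-allFin n))) (unique-⊆⇒length≤ (Uniqueₚ.allFin⁺ n) (λ {x} _ → all x))))
  ... | v , v∉ with trans (sym (first-satisfies (λ v → not (does (v ∈? L))) (∈-allFin v) (cong not (dec-false (v ∈? L) v∉)))) (cong not (dec-true (fresh L ∈? L) ∈L))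
  ...   | ()

  fresh-cong : ∀ {L M} → (∀ {v} → v ∈ L → v ∈ M) → (∀ {v} → v ∈ M → v ∈ L) → fresh L ≡ fresh M
  fresh-cong {L} {M} f g = first-cong pt (allFin n)
    where
    pt : ∀ v → not (does (v ∈? L)) ≡ not (does (v ∈? M))
    pt v with v ∈? L
    ... | yes p = cong not (sym (dec-true (v ∈? M) (f p)))
    ... | no ¬p = cong not (sym (dec-false (v ∈? M) (¬p ∘ g)))

  -- Prüfer decoding with the leaves in u already removed: attach the least vertex that is
  -- neither removed nor still to come in the code to the next letter of the code.
  decode : List V → List V → List (V × V)
  decode u []       = []
  decode u (b ∷ bs) = (fresh (u ++ b ∷ bs) , b) ∷ decode (fresh (u ++ b ∷ bs) ∷ u) bs

  -- A code is padded with the root as its last letter. The root then always is a letter still to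
  -- come, so it is never removed, and the last edge of the tree is produced like all others.
  EndsAtRoot : List V → Set
  EndsAtRoot []            = ⊤
  EndsAtRoot (b ∷ [])      = b ≡ root
  EndsAtRoot (_ ∷ b ∷ bs)  = EndsAtRoot (b ∷ bs)

  root∈ : ∀ b bs → EndsAtRoot (b ∷ bs) → root ∈ b ∷ bs
  root∈ b []        refl = here refl
  root∈ b (c ∷ bs)  e    = there (root∈ c bs e)

  endsAtRoot-tail : ∀ b bs → EndsAtRoot (b ∷ bs) → EndsAtRoot bs
  endsAtRoot-tail b []       e = tt
  endsAtRoot-tail b (c ∷ bs) e = e

  endsAtRoot-snoc : ∀ bs → EndsAtRoot (bs ++ root ∷ [])
  endsAtRoot-snoc []           = refl
  endsAtRoot-snoc (b ∷ [])     = refl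
  endsAtRoot-snoc (b ∷ c ∷ bs) = endsAtRoot-snoc (c ∷ bs)

  -- `size` says that one more vertex than letters is left. Hence some vertex is neither removed nor
  -- still to come, and only the root is left when the code is used up.
  record Inv (u bs : List V) : Set where
    constructor inv
    field
      unique   : Unique u
      size     : suc (length u + length bs) ≡ n
      disjoint : ∀ {v} → v ∈ u → v ∉ bs
      root∉u   : root ∉ u
      ends     : EndsAtRoot bs

  open Inv

  fresh-∉-Inv : ∀ {u b bs} → Inv u (b ∷ bs) → fresh (u ++ b ∷ bs) ∉ u ++ b ∷ bs
  fresh-∉-Inv {u} i = fresh-∉ _ (≤-reflexive (trans (cong suc (length-++ u)) (size i)))

  fresh∉u : ∀ {u b bs} → Inv u (b ∷ bs) → fresh (u ++ b ∷ bs) ∉ u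
  fresh∉u i = fresh-∉-Inv i ∘ ∈-++⁺ˡ

  fresh∉bs : ∀ {u b bs} → Inv u (b ∷ bs) → fresh (u ++ b ∷ bs) ∉ b ∷ bs
  fresh∉bs {u} i = fresh-∉-Inv i ∘ ∈-++⁺ʳ u

  Inv-tail : ∀ {u b bs} → Inv u (b ∷ bs) → Inv (fresh (u ++ b ∷ bs) ∷ u) bs
  Inv-tail {u} {b} {bs} i = inv
    (Allₚ.¬Any⇒All¬ u (fresh∉u i) ∷ unique i)
    (trans (cong suc (sym (+-suc (length u) (length bs)))) (size i))
    (λ { (here refl) v∈ → fresh∉bs i (there v∈) ; (there v∈u) v∈ → disjoint i v∈u (there v∈) })
    (λ { (here eq) → fresh∉bs i (subst (_∈ b ∷ bs) eq (root∈ b bs (ends i))) ; (there r∈) → root∉u i r∈ })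
    (endsAtRoot-tail b bs (ends i))

  head∉ : ∀ {u b bs} → Inv u (b ∷ bs) → b ∉ fresh (u ++ b ∷ bs) ∷ u
  head∉ i (here eq)    = fresh∉bs i (here (sym eq))
  head∉ i (there b∈u)  = disjoint i b∈u (here refl)

  key∉ : ∀ {u bs x y} → Inv u bs → (x , y) ∈ decode u bs → x ∉ u
  key∉ {bs = b ∷ bs} i (here refl) = fresh∉u i
  key∉ {bs = b ∷ bs} i (there e)   = key∉ (Inv-tail i) e ∘ there

  value∈ : ∀ {u bs x y} → (x , y) ∈ decode u bs → y ∈ bs
  value∈ {bs = b ∷ bs} (here refl) = here refl
  value∈ {bs = b ∷ bs} (there e)   = there (value∈ e)

  Nb∉ : ∀ {u bs x y} → Inv u bs → Nb (decode u bs) x y → x ∉ u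
  Nb∉ i (inj₁ e) = key∉ i e
  Nb∉ i (inj₂ e) = λ x∈u → disjoint i x∈u (value∈ e)

  key-functional : ∀ {u bs x y z} → Inv u bs → (x , y) ∈ decode u bs → (x , z) ∈ decode u bs → y ≡ z
  key-functional {bs = b ∷ bs} i (here refl) (here refl) = refl
  key-functional {bs = b ∷ bs} i (here refl) (there e)   = ⊥-elim (key∉ (Inv-tail i) e (here refl))
  key-functional {bs = b ∷ bs} i (there e) (here refl)   = ⊥-elim (key∉ (Inv-tail i) e (here refl))
  key-functional {bs = b ∷ bs} i (there e) (there e′)    = key-functional (Inv-tail i) e e′

  -- A vertex that is no longer a letter can only be the first component of an edge, and each vertex
  -- is removed at most once.
  leaf-neighbour : ∀ {u bs w x y} → Inv u bs → w ∉ bs → Nb (decode u bs) w x → Nb (decode u bs) w y → x ≡ y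
  leaf-neighbour i w∉ (inj₁ e) (inj₁ e′) = key-functional i e e′
  leaf-neighbour i w∉ (inj₂ e) _         = ⊥-elim (w∉ (value∈ e))
  leaf-neighbour i w∉ (inj₁ e) (inj₂ e′) = ⊥-elim (w∉ (value∈ e′))

  to-root : ∀ {u bs} → Inv u bs → ∀ {w} → w ∉ u → Star (Nb (decode u bs)) w root
  to-root {u} {[]} i {w} w∉ with w ≟ root
  ... | yes refl = ε
  -- Otherwise `w`, the root and the n - 1 removed vertices would be n + 1 distinct vertices.
  ... | no w≢r   = ⊥-elim (1+n≰n (≤-trans (unique-⊆⇒length≤ uniq (λ {x} _ → ∈-allFin x))
                     (≤-reflexive (trans (length-allFin n) (trans (sym (size i)) (cong suc (+-identityʳ _)))))))
    where
    uniq : Unique (w ∷ root ∷ u)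
    uniq = (w≢r ∷ Allₚ.¬Any⇒All¬ u w∉) ∷ Allₚ.¬Any⇒All¬ u (root∉u i) ∷ unique i
  to-root {u} {b ∷ bs} i {w} w∉ with w ≟ fresh (u ++ b ∷ bs)
  ... | yes refl = inj₁ (here refl) ◅ gmap id Nb-∷ (to-root (Inv-tail i) (head∉ i))
  ... | no w≢ℓ   = gmap id Nb-∷ (to-root (Inv-tail i) λ { (here eq) → w≢ℓ eq ; (there w∈u) → w∉ w∈u })

  -- One neighbour is the leaf that this letter attaches to `w`; the other is the first step from
  -- `w` towards the root in the rest of the tree, where that leaf no longer occurs.
  two-neighbours : ∀ {u bs w} → Inv u bs → w ∈ bs → w ≢ root →
    ∃[ x ] ∃[ y ] (x ≢ y × Nb (decode u bs) w x × Nb (decode u bs) w y)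
  two-neighbours {u} {b ∷ bs} {w} i (there w∈) w≢r with two-neighbours (Inv-tail i) w∈ w≢r
  ... | x , y , x≢y , p , q = x , y , x≢y , Nb-∷ p , Nb-∷ q
  two-neighbours {u} {b ∷ bs} {w} i (here refl) w≢r
    with to-root (Inv-tail i) {w} (head∉ i)
  ... | ε = ⊥-elim (w≢r refl)
  ... | _◅_ {j = y} e _ = fresh (u ++ b ∷ bs) , y ,
        (λ eq → Nb∉ (Inv-tail i) (swap e) (here (sym eq))) , inj₂ (here refl) , Nb-∷ e

  -- The graph determines which vertices are still letters: the root, and those with two neighbours.
  -- Codes of the same graph therefore remove the same leaf first.
  ∈-transfer : ∀ {u b bs b′ bs′} → Inv u (b ∷ bs) → Inv u (b′ ∷ bs′) →
    (∀ {x y} → Nb (decode u (b ∷ bs)) x y → Nb (decode u (b′ ∷ bs′)) x y) →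
    ∀ {v} → v ∈ u ++ b ∷ bs → v ∈ u ++ b′ ∷ bs′
  ∈-transfer {u} {b} {bs} {b′} {bs′} i i′ h {v} v∈ with ∈-++⁻ u v∈
  ... | inj₁ v∈u = ∈-++⁺ˡ v∈u
  ... | inj₂ v∈bs with v ∈? (b′ ∷ bs′) | v ≟ root
  ...   | yes v∈bs′ | _        = ∈-++⁺ʳ u v∈bs′
  ...   | no _      | yes refl = ∈-++⁺ʳ u (root∈ b′ bs′ (ends i′))
  ...   | no v∉     | no v≢r with two-neighbours i v∈bs v≢r
  ...     | x , y , x≢y , p , q = ⊥-elim (x≢y (leaf-neighbour i′ v∉ (h p) (h q)))

  decode-injective : ∀ {u bs bs′} → Inv u bs → Inv u bs′ →
    (∀ {x y} → Nb (decode u bs) x y → Nb (decode u bs′) x y) →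
    (∀ {x y} → Nb (decode u bs′) x y → Nb (decode u bs) x y) → bs ≡ bs′
  decode-injective {u} {[]}     {[]}       i i′ f g = refl
  decode-injective {u} {[]}     {b′ ∷ bs′} i i′ f g with g (inj₁ (here refl))
  ... | inj₁ ()
  ... | inj₂ ()
  decode-injective {u} {b ∷ bs} {[]}       i i′ f g with f (inj₁ (here refl))
  ... | inj₁ ()
  ... | inj₂ ()
  decode-injective {u} {b ∷ bs} {b′ ∷ bs′} i i′ f g = cong₂ _∷_ b≡b′
    (decode-injective t (subst (λ l → Inv (l ∷ u) bs′) (sym ℓ≡ℓ′) t′) f′ g′)
    where
    ℓ ℓ′ : V
    ℓ  = fresh (u ++ b ∷ bs)
    ℓ′ = fresh (u ++ b′ ∷ bs′)
    ℓ≡ℓ′ : ℓ ≡ ℓ′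
    ℓ≡ℓ′ = fresh-cong (∈-transfer i i′ f) (∈-transfer i′ i g)
    t : Inv (ℓ ∷ u) bs
    t = Inv-tail i
    t′ : Inv (ℓ′ ∷ u) bs′
    t′ = Inv-tail i′
    b≡b′ : b ≡ b′
    b≡b′ = leaf-neighbour i′ (fresh∉bs i′)
      (subst (λ l → Nb (decode u (b′ ∷ bs′)) l b) ℓ≡ℓ′ (f (inj₁ (here refl)))) (inj₁ (here refl))
    strip : ∀ {e Es x y} → proj₁ e ≢ x → proj₁ e ≢ y → Nb (e ∷ Es) x y → Nb Es x y
    strip p q (inj₁ (here refl)) = ⊥-elim (p refl)
    strip p q (inj₁ (there e))   = inj₁ e
    strip p q (inj₂ (here refl)) = ⊥-elim (q refl)
    strip p q (inj₂ (there e))   = inj₂ e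
    f′ : ∀ {x y} → Nb (decode (ℓ ∷ u) bs) x y → Nb (decode (ℓ ∷ u) bs′) x y
    f′ {x} {y} e = subst (λ l → Nb (decode (l ∷ u) bs′) x y) (sym ℓ≡ℓ′)
      (strip (λ eq → Nb∉ t e (here (trans (sym eq) (sym ℓ≡ℓ′)))) (λ eq → Nb∉ t (swap e) (here (trans (sym eq) (sym ℓ≡ℓ′)))) (f (Nb-∷ e)))
    g′ : ∀ {x y} → Nb (decode (ℓ ∷ u) bs′) x y → Nb (decode (ℓ ∷ u) bs) x y
    g′ {x} {y} e₀ = strip (λ eq → Nb∉ t′ e (here (trans (sym eq) ℓ≡ℓ′))) (λ eq → Nb∉ t′ (swap e) (here (trans (sym eq) ℓ≡ℓ′))) (g (Nb-∷ e))
      where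
      e : Nb (decode (ℓ′ ∷ u) bs′) x y
      e = subst (λ l → Nb (decode (l ∷ u) bs′) x y) ℓ≡ℓ′ e₀

  -- Every subgraph of minimum degree two avoids the leaf removed first.
  no-core : ∀ {u bs} → Inv u bs → (C : V → Set) →
    (∀ v → C v → ∃[ a ] ∃[ b ] (a ≢ b × C a × C b × Nb (decode u bs) v a × Nb (decode u bs) v b)) →
    ∀ v → ¬ C v
  no-core {u} {[]} i C two v cv with two v cv
  ... | a , b , _ , _ , _ , inj₁ () , _
  ... | a , b , _ , _ , _ , inj₂ () , _
  no-core {u} {b ∷ bs} i C two = no-core (Inv-tail i) C two′
    where
    ℓ = fresh (u ++ b ∷ bs)
    ℓ∉C : ¬ C ℓ
    ℓ∉C cℓ with two ℓ cℓ
    ... | x , y , x≢y , _ , _ , p , q = x≢y (leaf-neighbour i (fresh∉bs i) p q)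
    strip : ∀ {x y} → C x → C y → Nb (decode u (b ∷ bs)) x y → Nb (decode (ℓ ∷ u) bs) x y
    strip cx cy (inj₁ (here refl)) = ⊥-elim (ℓ∉C cx)
    strip cx cy (inj₁ (there e))   = inj₁ e
    strip cx cy (inj₂ (here refl)) = ⊥-elim (ℓ∉C cy)
    strip cx cy (inj₂ (there e))   = inj₂ e
    two′ : ∀ v → C v → ∃[ x ] ∃[ y ] (x ≢ y × C x × C y × Nb (decode (ℓ ∷ u) bs) v x × Nb (decode (ℓ ∷ u) bs) v y)
    two′ v cv with two v cv
    ... | x , y , x≢y , cx , cy , p , q = x , y , x≢y , cx , cy , strip cv cx p , strip cv cy q

  irreflexive : ∀ {u bs x} → Inv u bs → (x , x) ∉ decode u bs
  irreflexive {bs = b ∷ bs} i (here eq) = fresh∉bs i (here (trans (sym (cong proj₁ eq)) (cong proj₂ eq)))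
  irreflexive {bs = b ∷ bs} i (there e) = irreflexive (Inv-tail i) e

  decode-tree : ∀ {bs} → Inv [] bs → IsTree (edgeGraph (decode [] bs))
  decode-tree {bs} i = simple , connected , acyclic
    where
    Es = decode [] bs
    simple : IsSimple (edgeGraph Es)
    simple = symm , irr
      where
      symm : ∀ u v → adjB (edgeGraph Es) u v ≡ adjB (edgeGraph Es) v u
      symm u v = trans (adjB-edgeGraph Es u v) (trans (does-⇔ (mk⇔ swap swap) (Nb? Es u v) (Nb? Es v u)) (sym (adjB-edgeGraph Es v u)))
      irr : ∀ u → adjB (edgeGraph Es) u u ≡ false
      irr u = trans (adjB-edgeGraph Es u u) (dec-false (Nb? Es u u) λ { (inj₁ e) → irreflexive i e ; (inj₂ e) → irreflexive i e })
    connected : Connected (edgeGraph Es)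
    connected u v = Star⇒Walk (gmap id (Nb⇒Adj Es) (to-root i {u} (λ ()) ◅◅ reverse swap (to-root i {v} (λ ()))))
    acyclic : ¬ HasCycle (edgeGraph Es)
    acyclic cyc = no-core i (OnCycle (proj₁ (proj₂ cyc)))
      (λ v cv → let a , b , a≢b , ca , cb , p , q = cycle-two-neighbours {G = edgeGraph Es} simple cyc v cv
                in a , b , a≢b , ca , cb , Adj⇒Nb Es p , Adj⇒Nb Es q)
      _ (zero , refl)

-- The lower half of Cayley's formula, from the injectivity of decoding: the number of trees is the
-- denominator of the probability.
cayley-≤ : ∀ p {trees : List (Graph (2 + p))} → Enumerates trees IsTree → (2 + p) ^ p ≤ length trees
cayley-≤ p {trees} (_ , complete) = begin
  (2 + p) ^ p                                   ≡⟨ cong (_^ p) (sym (length-allFin (2 + p))) ⟩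
  length (allFin (2 + p)) ^ p                   ≡⟨ sym (length-allVec (allFin (2 + p)) p) ⟩
  length codes                                  ≡⟨ sym (length-map tree codes) ⟩
  length (map tree codes)                       ≤⟨ unique-⊆⇒length≤ (Uniqueₚ.map⁺ tree-injective (allVec-unique (Uniqueₚ.allFin⁺ (2 + p)) p)) sub ⟩
  length trees                                  ∎
  where
  open ≤-Reasoning
  V = Fin (2 + p)
  open Prüfer {2 + p} zero
  codes : List (Vec V p)
  codes = allVec (allFin (2 + p)) p
  code : Vec V p → List V
  code c = toList c ++ zero ∷ []
  tree : Vec V p → Graph (2 + p)
  tree c = edgeGraph (decode [] (code c))
  initial : ∀ c → Inv [] (code c)
  initial c = inv [] (cong suc (trans (length-++ (toList c)) (trans (cong (_+ 1) (length-toList c)) (+-comm p 1))))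
    (λ ()) (λ ()) (endsAtRoot-snoc (toList c))
  tree-injective : ∀ {c c′} → tree c ≡ tree c′ → c ≡ c′
  tree-injective {c} {c′} eq = trans (sym (cast-is-id refl c)) (toList-injective refl c c′ (++-cancelʳ (zero ∷ []) (toList c) (toList c′)
    (decode-injective (initial c) (initial c′)
      (λ {x} {y} e → Adj⇒Nb (decode [] (code c′)) (subst (λ G → Adj G x y) eq (Nb⇒Adj (decode [] (code c)) e)))
      (λ {x} {y} e → Adj⇒Nb (decode [] (code c)) (subst (λ G → Adj G x y) (sym eq) (Nb⇒Adj (decode [] (code c′)) e))))))
  sub : ∀ {G} → G ∈ map tree codes → G ∈ trees
  sub {G} G∈ with ∈-map⁻ tree G∈
  ... | c , _ , refl = Equivalence.from (complete (tree c)) (decode-tree (initial c))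

-- Rooting a tree

least : ∀ {P : ℕ → Set} → (∀ k → Dec (P k)) → ∀ k → P k → ∃[ m ] (P m × (∀ j → P j → m ≤ j))
least P? k p with P? 0
... | yes p₀ = 0 , p₀ , λ _ _ → z≤n
least P? zero    p | no ¬p₀ = ⊥-elim (¬p₀ p)
least {P} P? (suc k) p | no ¬p₀ with least (P? ∘ suc) k p
... | m , pm , min = suc m , pm , min′
  where
  min′ : ∀ j → P j → suc m ≤ j
  min′ zero    p₀ = ⊥-elim (¬p₀ p₀)
  min′ (suc j) pj = s≤s (min j pj)

data Chain {V : Set} (R : V → V → Set) : V → List V → V → Set where
  []  : ∀ {u} → Chain R u [] u
  _∷_ : ∀ {u v w xs} → R u v → Chain R v xs w → Chain R u (v ∷ xs) w

module _ {n : ℕ} {R : Fin n → Fin n → Set} where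
  open DecMem (_≟_ {n}) using (_∈?_)

  suffix : ∀ {u v xs w} → Chain R v xs w → Unique (v ∷ xs) → u ∈ v ∷ xs →
           ∃[ ys ] (Chain R u ys w × Unique (u ∷ ys))
  suffix c       un         (here refl) = _ , c , un
  suffix (r ∷ c) (_ ∷ un)   (there u∈)  = suffix c un u∈

  loop-erase : ∀ {u w} → Star R u w → ∃[ xs ] (Chain R u xs w × Unique (u ∷ xs))
  loop-erase ε = [] , [] , [] ∷ []
  loop-erase {u} (_◅_ {j = v} r s) with loop-erase s
  ... | xs , c , un with u ∈? (v ∷ xs)
  ...   | yes u∈ = suffix c un u∈
  ...   | no u∉  = v ∷ xs , r ∷ c , Allₚ.¬Any⇒All¬ (v ∷ xs) u∉ ∷ un

unique⇒lookup-injective : ∀ {A : Set} {xs : List A} → Unique xs → ∀ i j →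
                          lookup (fromList xs) i ≡ lookup (fromList xs) j → i ≡ j
unique⇒lookup-injective {A} (x∉ ∷ un) = go
  where
  avoid : ∀ {y} {ys : List A} → All.All (λ z → ¬ y ≡ z) ys → ∀ i → ¬ y ≡ lookup (fromList ys) i
  avoid (p ∷ ps) zero    = p
  avoid (p ∷ ps) (suc i) = avoid ps i
  go : ∀ i j → _
  go zero    zero    eq = refl
  go zero    (suc j) eq = ⊥-elim (avoid x∉ j eq)
  go (suc i) zero    eq = ⊥-elim (avoid x∉ i (sym eq))
  go (suc i) (suc j) eq = cong suc (unique⇒lookup-injective un i j eq)

chain-consecutive : ∀ {V : Set} {R : V → V → Set} {u xs w} → Chain R u xs w → ∀ (i : Fin (length xs)) →
                    R (lookup (fromList (u ∷ xs)) (inject₁ i)) (lookup (fromList (u ∷ xs)) (suc i))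
chain-consecutive (r ∷ c) zero    = r
chain-consecutive (r ∷ c) (suc i) = chain-consecutive c i

chain-last : ∀ {V : Set} {R : V → V → Set} {u xs w} → Chain R u xs w →
             lookup (fromList (u ∷ xs)) (fromℕ (length xs)) ≡ w
chain-last []      = refl
chain-last (r ∷ c) = chain-last c

module _ {n : ℕ} (G : Graph n) (root : Fin n) where

  -- The local facts through which the encoding sees the rooting. `no-two-cycle` shows that the only
  -- neighbour of a leaf, its parent, is not also its child.
  record Rooted (f : Fin n → Fin n) : Set where
    field
      root-fixed    : f root ≡ root
      parent-adj    : ∀ {v} → v ≢ root → Adj G v (f v)
      no-two-cycle  : ∀ {v} → v ≢ root → f (f v) ≢ v
      edges         : ∀ {u w} → Adj G u w → f u ≡ w ⊎ f w ≡ u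

  Reach : ℕ → Fin n → Set
  Reach zero    v = v ≡ root
  Reach (suc k) v = ∃[ w ] (Adj G v w × Reach k w)

  reach? : ∀ k v → Dec (Reach k v)
  reach? zero    v = v ≟ root
  reach? (suc k) v = any? (λ w → (adjB G v w Boolₚ.≟ true) ×-dec reach? k w)

  walk⇒reach : ∀ {v} → Walk G v root → ∃[ k ] Reach k v
  walk⇒reach here       = 0 , refl
  walk⇒reach (step e w) with walk⇒reach w
  ... | k , r = suc k , _ , e , r

module Rooting {n : ℕ} (G : Graph n) (root : Fin n) (tree : IsTree G) where
  private
    simple = proj₁ tree
    connected = proj₁ (proj₂ tree)
    acyclic = proj₂ (proj₂ tree)

  adj-sym : ∀ {u v} → Adj G u v → Adj G v u
  adj-sym {u} {v} e = trans (proj₁ simple v u) e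

  adj-irrefl : ∀ {u v} → Adj G u v → u ≢ v
  adj-irrefl {u} e refl with trans (sym e) (proj₂ simple u)
  ... | ()

  abstract
    nearest : ∀ v → ∃[ m ] (Reach G root m v × (∀ j → Reach G root j v → m ≤ j))
    nearest v with walk⇒reach G root (connected v root)
    ... | k , r = least (λ k → reach? G root k v) k r

  dist : Fin n → ℕ
  dist v = proj₁ (nearest v)

  descend : ∀ v → v ≢ root → ∃[ w ] (Adj G v w × dist w < dist v)
  descend v v≢r = go (dist v) refl (proj₁ (proj₂ (nearest v)))
    where
    go : ∀ m → m ≡ dist v → Reach G root m v → ∃[ w ] (Adj G v w × dist w < dist v)
    go zero    _  v≡r         = ⊥-elim (v≢r v≡r)
    go (suc m) eq (w , e , r) = w , e , subst (dist w <_) eq (s≤s (proj₂ (proj₂ (nearest w)) m r))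

  abstract
    toParent : ∀ v → Σ (Fin n) λ w → (v ≡ root → w ≡ root) × (v ≢ root → Adj G v w × dist w < dist v)
    toParent v = choose (v ≟ root)
      where
      choose : Dec (v ≡ root) → Σ (Fin n) λ w → (v ≡ root → w ≡ root) × (v ≢ root → Adj G v w × dist w < dist v)
      choose (yes v≡r) = root , (λ _ → refl) , λ v≢r → ⊥-elim (v≢r v≡r)
      choose (no v≢r)  = let w , props = descend v v≢r in w , (λ v≡r → ⊥-elim (v≢r v≡r)) , λ _ → props

  parent : Fin n → Fin n
  parent v = proj₁ (toParent v)

  parent-root : parent root ≡ root
  parent-root = proj₁ (proj₂ (toParent root)) refl

  parent-adj : ∀ {v} → v ≢ root → Adj G v (parent v)
  parent-adj {v} v≢r = proj₁ (proj₂ (proj₂ (toParent v)) v≢r)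

  dist-parent : ∀ {v} → v ≢ root → dist (parent v) < dist v
  dist-parent {v} v≢r = proj₂ (proj₂ (proj₂ (toParent v)) v≢r)

  IsParentEdge : Fin n → Fin n → Set
  IsParentEdge u w = Adj G u w × (parent u ≡ w ⊎ parent w ≡ u)

  parentEdge-sym : ∀ {u w} → IsParentEdge u w → IsParentEdge w u
  parentEdge-sym (e , inj₁ p) = adj-sym e , inj₂ p
  parentEdge-sym (e , inj₂ p) = adj-sym e , inj₁ p

  climb : ∀ k v → dist v ≤ k → Star IsParentEdge v root
  climb k v le with v ≟ root
  ... | yes refl = ε
  climb zero    v le | no v≢r = ⊥-elim (n≮0 (<-≤-trans (dist-parent v≢r) le))
  climb (suc k) v le | no v≢r = (parent-adj v≢r , inj₁ refl) ◅ climb k (parent v) (≤-pred (≤-trans (dist-parent v≢r) le))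

  parentEdge-connected : ∀ u w → Star IsParentEdge u w
  parentEdge-connected u w = climb (dist u) u ≤-refl ◅◅ reverse parentEdge-sym (climb (dist w) w ≤-refl)

  chain-map : ∀ {V : Set} {R S : V → V → Set} → (∀ {x y} → R x y → S x y) → ∀ {u xs w} → Chain R u xs w → Chain S u xs w
  chain-map h []      = []
  chain-map h (r ∷ c) = h r ∷ chain-map h c

  -- An edge outside the parent map would close a cycle with the path through parents between its ends.
  edge⇒parent : ∀ {u w} → Adj G u w → parent u ≡ w ⊎ parent w ≡ u
  edge⇒parent {u} {w} e with loop-erase (parentEdge-connected u w)
  ... | [] , [] , _ = ⊥-elim (adj-irrefl e refl)
  ... | _ ∷ [] , (_ , p) ∷ [] , _ = p
  ... | a ∷ b ∷ ys , c , un = ⊥-elim (acyclic (length ys , fromList (u ∷ a ∷ b ∷ ys) ,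
        unique⇒lookup-injective un , chain-consecutive (chain-map proj₁ c) ,
        adj-sym (subst (Adj G u) (sym (chain-last c)) e)))

  rooted : Rooted G root parent
  rooted = record
    { root-fixed   = parent-root
    ; parent-adj   = parent-adj
    ; no-two-cycle = two
    ; edges        = edge⇒parent
    }
    where
    two : ∀ {v} → v ≢ root → parent (parent v) ≢ v
    two {v} v≢r eq with parent v ≟ root
    ... | yes p≡r = v≢r (trans (sym eq) (trans (cong parent p≡r) parent-root))
    ... | no p≢r  = <-asym (dist-parent v≢r) (subst (λ x → dist x < dist (parent v)) eq (dist-parent p≢r))

-- Paths in a rooted tree

∈-toList⇒lookup : ∀ {A : Set} {m} (xs : Vec A m) {v} → v ∈ toList xs → ∃[ i ] lookup xs i ≡ v
∈-toList⇒lookup (x ∷ xs) (here refl) = zero , refl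
∈-toList⇒lookup (x ∷ xs) (there v∈) with ∈-toList⇒lookup xs v∈
... | i , eq = suc i , eq

lookup-injective⇒unique : ∀ {A : Set} {m} (xs : Vec A m) → (∀ i j → lookup xs i ≡ lookup xs j → i ≡ j) → Unique (toList xs)
lookup-injective⇒unique []       inj = []
lookup-injective⇒unique (x ∷ xs) inj = All.tabulate new ∷ lookup-injective⇒unique xs (λ i j eq → suc-injective (inj (suc i) (suc j) eq))
  where
  new : ∀ {y} → y ∈ toList xs → x ≢ y
  new y∈ refl with ∈-toList⇒lookup xs y∈
  ... | i , eq with inj zero (suc i) (sym eq)
  ...   | ()

module _ {V : Set} where

  descending : ∀ {m} → V → Vec V m → List (V × V)
  descending x []       = []
  descending x (y ∷ ys) = (y , x) ∷ descending y ys

  -- The values that a parent map must take on a path whose vertex number s is the one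
  -- closest to the root.
  forcedPath : ∀ {m} → ℕ → Vec V (suc m) → List (V × V)
  forcedPath s       (x ∷ [])     = []
  forcedPath zero    (x ∷ y ∷ ys) = descending x (y ∷ ys)
  forcedPath (suc s) (x ∷ y ∷ ys) = (x , y) ∷ forcedPath s (y ∷ ys)

  topOf : ∀ {m} → ℕ → Vec V (suc m) → V
  topOf s       (x ∷ [])     = x
  topOf zero    (x ∷ y ∷ ys) = x
  topOf (suc s) (x ∷ y ∷ ys) = topOf s (y ∷ ys)

  second penult : ∀ {m} → Vec V (suc m) → V
  second (x ∷ [])     = x
  second (x ∷ y ∷ ys) = y
  penult (x ∷ [])         = x
  penult (x ∷ y ∷ [])     = x
  penult (x ∷ y ∷ z ∷ zs) = penult (y ∷ z ∷ zs)

  length-descending : ∀ {m} x (ys : Vec V m) → length (descending x ys) ≡ m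
  length-descending x []       = refl
  length-descending x (y ∷ ys) = cong suc (length-descending y ys)

  length-forcedPath : ∀ {m} s (P : Vec V (suc m)) → length (forcedPath s P) ≡ m
  length-forcedPath s       (x ∷ [])     = refl
  length-forcedPath zero    (x ∷ y ∷ ys) = length-descending x (y ∷ ys)
  length-forcedPath (suc s) (x ∷ y ∷ ys) = cong suc (length-forcedPath s (y ∷ ys))

  keys-descending : ∀ {m} x (ys : Vec V m) → map proj₁ (descending x ys) ≡ toList ys
  keys-descending x []       = refl
  keys-descending x (y ∷ ys) = cong (y ∷_) (keys-descending y ys)

  value-descending : ∀ {m} x (ys : Vec V m) {a b} → (a , b) ∈ descending x ys → b ∈ toList (x ∷ ys)
  value-descending x (y ∷ ys) (here refl) = here refl
  value-descending x (y ∷ ys) (there e)   = there (value-descending y ys e)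

  value-forcedPath : ∀ {m} s (P : Vec V (suc m)) {a b} → (a , b) ∈ forcedPath s P → b ∈ toList P
  value-forcedPath zero    (x ∷ y ∷ ys) e           = value-descending x (y ∷ ys) e
  value-forcedPath (suc s) (x ∷ y ∷ ys) (here refl) = there (here refl)
  value-forcedPath (suc s) (x ∷ y ∷ ys) (there e)   = there (value-forcedPath s (y ∷ ys) e)

  keys-forcedPath : ∀ {m} s (P : Vec V (suc m)) {a} → a ∈ map proj₁ (forcedPath s P) → a ∈ toList P
  keys-forcedPath zero    (x ∷ y ∷ ys) {a} a∈      = there (subst (a ∈_) (keys-descending x (y ∷ ys)) a∈)
  keys-forcedPath (suc s) (x ∷ y ∷ ys) (here refl) = here refl
  keys-forcedPath (suc s) (x ∷ y ∷ ys) (there a∈)  = there (keys-forcedPath s (y ∷ ys) a∈)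

  key-or-top : ∀ {m} s (P : Vec V (suc m)) {a} → a ∈ toList P → a ∈ map proj₁ (forcedPath s P) ⊎ a ≡ topOf s P
  key-or-top s       (x ∷ [])     (here refl) = inj₂ refl
  key-or-top zero    (x ∷ y ∷ ys) (here refl) = inj₂ refl
  key-or-top zero    (x ∷ y ∷ ys) {a} (there a∈)  = inj₁ (subst (a ∈_) (sym (keys-descending x (y ∷ ys))) a∈)
  key-or-top (suc s) (x ∷ y ∷ ys) (here refl) = inj₁ (here refl)
  key-or-top (suc s) (x ∷ y ∷ ys) (there a∈) with key-or-top s (y ∷ ys) a∈
  ... | inj₁ a∈k = inj₁ (there a∈k)
  ... | inj₂ eq  = inj₂ eq

  unique-keys : ∀ {m} s (P : Vec V (suc m)) → Unique (toList P) → Unique (map proj₁ (forcedPath s P))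
  unique-keys s       (x ∷ [])     u        = []
  unique-keys zero    (x ∷ y ∷ ys) (_ ∷ u)  = subst Unique (sym (keys-descending x (y ∷ ys))) u
  unique-keys (suc s) (x ∷ y ∷ ys) (x∉ ∷ u) =
    All.tabulate (λ a∈ → All.lookup x∉ (keys-forcedPath s (y ∷ ys) a∈)) ∷ unique-keys s (y ∷ ys) u

  descending-ends : ∀ {m} x y (ys : Vec V m) {z} → z ∈ toList (x ∷ y ∷ ys) →
    (∃[ a ] (a , z) ∈ descending x (y ∷ ys)) ⊎ (z , penult (x ∷ y ∷ ys)) ∈ descending x (y ∷ ys)
  descending-ends x y ys       (here refl)         = inj₁ (y , here refl)
  descending-ends x y []       (there (here refl)) = inj₂ (here refl)
  descending-ends x y (w ∷ ws) (there z∈) with descending-ends y w ws z∈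
  ... | inj₁ (a , e) = inj₁ (a , there e)
  ... | inj₂ e       = inj₂ (there e)

  -- A vertex without a child on the path is one of its ends, hence has the second or the
  -- penultimate vertex as parent.
  forcedPath-ends : ∀ {m} s x y (ys : Vec V m) {z} → z ∈ toList (x ∷ y ∷ ys) →
    (∃[ a ] (a , z) ∈ forcedPath s (x ∷ y ∷ ys)) ⊎
    (z ≡ x × (z , y) ∈ forcedPath s (x ∷ y ∷ ys)) ⊎
    (z , penult (x ∷ y ∷ ys)) ∈ forcedPath s (x ∷ y ∷ ys)
  forcedPath-ends zero x y ys z∈ with descending-ends x y ys z∈
  ... | inj₁ v = inj₁ v
  ... | inj₂ e = inj₂ (inj₂ e)
  forcedPath-ends (suc s) x y ys       (here refl)         = inj₂ (inj₁ (refl , here refl))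
  forcedPath-ends (suc s) x y ys       (there (here refl)) = inj₁ (x , here refl)
  forcedPath-ends (suc s) x y (w ∷ ws) (there z∈) with forcedPath-ends s y w ws z∈
  ... | inj₁ (a , e)            = inj₁ (a , there e)
  ... | inj₂ (inj₁ (refl , e))  = inj₁ (x , here refl)
  ... | inj₂ (inj₂ e)           = inj₂ (inj₂ (there e))

module Orient {n : ℕ} {G : Graph n} {root : Fin n} {f : Fin n → Fin n} (R : Rooted G root f) where
  open Rooted R

  IsArc : Fin n × Fin n → Set
  IsArc (w , v) = f w ≡ v × w ≢ v

  -- After a step from parent to child the path cannot climb again: the next vertex would be the
  -- parent of the current one, which is the vertex just left.
  orient-descending : ∀ {m} x y (ys : Vec (Fin n) m) → IsPath G (suc m) (x ∷ y ∷ ys) → f y ≡ x →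
                      All IsArc (descending x (y ∷ ys))
  orient-descending x y ys (inj , adj) fy = (fy , λ eq → 0≢1 (inj zero (suc zero) (sym eq))) ∷ go ys inj adj
    where
    0≢1 : ∀ {m} → ¬ (Fin.zero {suc m} ≡ suc zero)
    0≢1 ()
    go : ∀ {m} (ys : Vec (Fin n) m) →
         (∀ i j → lookup (x ∷ y ∷ ys) i ≡ lookup (x ∷ y ∷ ys) j → i ≡ j) →
         (∀ i → Adj G (lookup (x ∷ y ∷ ys) (inject₁ i)) (lookup (x ∷ y ∷ ys) (suc i))) →
         All IsArc (descending y ys)
    go []       inj adj = []
    go (z ∷ zs) inj adj with edges (adj (suc zero))
    ... | inj₂ fz = orient-descending y z zs ((λ i j eq → suc-injective (inj (suc i) (suc j) eq)) , adj ∘ suc) fz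
    ... | inj₁ fy′ with inj zero (suc (suc zero)) (trans (sym fy) fy′)
    ...   | ()

  orient : ∀ {m} (P : Vec (Fin n) (suc m)) → IsPath G m P → ∃[ s ] (s ≤ m × All IsArc (forcedPath s P))
  orient (x ∷ [])     p = 0 , z≤n , []
  orient (x ∷ y ∷ ys) p@(inj , adj) with edges (adj zero)
  ... | inj₂ fy = 0 , z≤n , orient-descending x y ys p fy
  ... | inj₁ fx with orient (y ∷ ys) ((λ i j eq → suc-injective (inj (suc i) (suc j) eq)) , adj ∘ suc)
  ...   | s , s≤m , arcs = suc s , s≤s s≤m , (fx , ne) ∷ arcs
    where
    ne : x ≢ y
    ne eq with inj zero (suc zero) eq
    ... | ()

-- Certificates of equal checks

any⁻ : ∀ {A : Set} (p : A → Bool) xs → any p xs ≡ true → ∃[ x ] (x ∈ xs × p x ≡ true)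
any⁻ p (x ∷ xs) eq with p x in px
... | true = x , here refl , px
... | false with any⁻ p xs eq
...   | y , y∈ , py = y , there y∈ , py

any⁺ : ∀ {A : Set} (p : A → Bool) {xs x} → x ∈ xs → p x ≡ true → any p xs ≡ true
any⁺ p (here refl) px rewrite px = refl
any⁺ p {y ∷ xs} (there x∈) px with p y
... | true  = refl
... | false = any⁺ p x∈ px

∧-split : ∀ a b → a ∧ b ≡ true → a ≡ true × b ≡ true
∧-split true b eq = refl , eq

countTrue≡0 : ∀ {m} (bs : Vec Bool m) → countTrue bs ≡ 0 → ∀ i → lookup bs i ≢ true
countTrue≡0 (false ∷ bs) eq (suc i) = countTrue≡0 bs eq i

all-false⇒countTrue≡0 : ∀ {m} (bs : Vec Bool m) → (∀ i → lookup bs i ≢ true) → countTrue bs ≡ 0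
all-false⇒countTrue≡0 []           h = refl
all-false⇒countTrue≡0 (true ∷ bs)  h = ⊥-elim (h zero refl)
all-false⇒countTrue≡0 (false ∷ bs) h = all-false⇒countTrue≡0 bs (h ∘ suc)

countTrue≡1⇒unique : ∀ {m} (bs : Vec Bool m) → countTrue bs ≡ 1 →
                     ∀ i j → lookup bs i ≡ true → lookup bs j ≡ true → i ≡ j
countTrue≡1⇒unique (b ∷ bs)     eq zero    zero    p q = refl
countTrue≡1⇒unique (true ∷ bs)  eq zero    (suc j) p q = ⊥-elim (countTrue≡0 bs (ℕₚ.suc-injective eq) j q)
countTrue≡1⇒unique (true ∷ bs)  eq (suc i) j       p q = ⊥-elim (countTrue≡0 bs (ℕₚ.suc-injective eq) i p)
countTrue≡1⇒unique (false ∷ bs) eq (suc i) (suc j) p q = cong suc (countTrue≡1⇒unique bs eq i j p q)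

unique⇒countTrue≡1 : ∀ {m} (bs : Vec Bool m) i → lookup bs i ≡ true →
                     (∀ j → lookup bs j ≡ true → j ≡ i) → countTrue bs ≡ 1
unique⇒countTrue≡1 (true ∷ bs)  zero    p h = cong suc (all-false⇒countTrue≡0 bs λ j q → suc≢zero (h (suc j) q))
  where
  suc≢zero : ∀ {m} {j : Fin m} → Fin.suc j ≢ zero
  suc≢zero ()
unique⇒countTrue≡1 (true ∷ bs)  (suc i) p h with h zero refl
... | ()
unique⇒countTrue≡1 (false ∷ bs) (suc i) p h = unique⇒countTrue≡1 bs i p (λ j q → suc-injective (h (suc j) q))

rooted-resp : ∀ {n} {G : Graph n} {root} {f g : Fin n → Fin n} → (∀ v → f v ≡ g v) → Rooted G root f → Rooted G root g
rooted-resp {G = G} {root} {f} {g} eq R = record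
  { root-fixed   = trans (sym (eq root)) root-fixed
  ; parent-adj   = λ {v} v≢r → subst (Adj G v) (eq v) (parent-adj v≢r)
  ; no-two-cycle = λ {v} v≢r p → no-two-cycle v≢r (trans (trans (eq (f v)) (cong g (eq v))) p)
  ; edges        = λ {u} {w} e → Sum.map (trans (sym (eq u))) (trans (sym (eq w))) (edges e)
  }
  where open Rooted R

module _ {n : ℕ} where

  -- `u ≢ v` removes the loop that the root, being its own parent, would otherwise get.
  parentGraph? : (f : Fin n → Fin n) (u v : Fin n) → Dec (u ≢ v × (f u ≡ v ⊎ f v ≡ u))
  parentGraph? f u v = ¬? (u ≟ v) ×-dec ((f u ≟ v) ⊎-dec (f v ≟ u))

  parentGraph : Vec (Fin n) n → Graph n
  parentGraph f = tabulate (λ u → tabulate (λ v → does (parentGraph? (lookup f) u v)))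

  parentGraph-rooted : ∀ {G : Graph n} {root} (f : Vec (Fin n) n) → IsSimple G → Rooted G root (lookup f) → parentGraph f ≡ G
  parentGraph-rooted {G} {root} f (symm , irr) R =
    trans (tabulate-cong (λ u → trans (tabulate-cong (pt u)) (tabulate∘lookup (lookup G u)))) (tabulate∘lookup G)
    where
    open Rooted R
    pt : ∀ u v → does (parentGraph? (lookup f) u v) ≡ adjB G u v
    pt u v with adjB G u v in eq
    ... | true  = dec-true (parentGraph? (lookup f) u v) ((λ { refl → true≢false (trans (sym eq) (irr u)) }) , edges eq)
      where
      true≢false : true ≢ false
      true≢false ()
    ... | false = dec-false (parentGraph? (lookup f) u v) λ
      { (u≢v , inj₁ fu) → true≢false (trans (sym (subst (Adj G u) fu (parent-adj λ { refl → u≢v (trans (sym root-fixed) fu) }))) eq)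
      ; (u≢v , inj₂ fv) → true≢false (trans (sym (subst (Adj G v) fv (parent-adj λ { refl → u≢v (trans (sym fv) root-fixed) }))) (trans (symm v u) eq)) }
      where
      true≢false : true ≢ false
      true≢false ()

  open DecMem (_≟_ {n}) using (_∈?_)
  open DecUnique (_≟_ {n}) using (unique?)

  private
    V = Fin n

  -- Outside these vertices P and Q are disjoint, and no leaf child of a path vertex lies on a path.
  excluded : ∀ {m} → ℕ → ℕ → Vec V (suc m) → Vec V (suc m) → List V
  excluded s t P Q = topOf s P ∷ topOf t Q ∷ second P ∷ second Q ∷ penult P ∷ penult Q ∷ []

  used? : (E : List V) (p q : V) → Dec (p ∉ E × q ∉ E)
  used? E p q = ¬? (p ∈? E) ×-dec ¬? (q ∈? E)

  -- A certificate C for two equal checks says at each index whether both vertices have no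
  -- leaf below them (nothing) or which leaves hang there (just (x , y)).
  leaves : ∀ {m} → Vec V m → Vec V m → Vec (Maybe (V × V)) m → List (V × V)
  leaves []       []       []                   = []
  leaves (p ∷ ps) (q ∷ qs) (nothing ∷ C)        = leaves ps qs C
  leaves (p ∷ ps) (q ∷ qs) (just (x , y) ∷ C)   = (x , p) ∷ (y , q) ∷ leaves ps qs C

  -- At an index where a vertex is excluded, `nothing` records no information and contributes
  -- nothing to K.
  leafless : ∀ {m} → List V → Vec V m → Vec V m → Vec (Maybe (V × V)) m → List V
  leafless E []       []       []             = []
  leafless E (p ∷ ps) (q ∷ qs) (just _ ∷ C)   = leafless E ps qs C
  leafless E (p ∷ ps) (q ∷ qs) (nothing ∷ C)  = if does (used? E p q) then p ∷ q ∷ leafless E ps qs C else leafless E ps qs C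

  -- The conditions on a code that do not mention the map. The last two make the vertices of K and
  -- all prescribed values irregular, as the count requires.
  ValidSpec : List (V × V) → List V → List V → List V → Set
  ValidSpec Γ tops X K =
    Unique (map proj₁ Γ) × Unique X × Unique K × All (_∉ X) K ×
    All (λ v → v ∈ map proj₁ Γ ⊎ v ∈ tops) K × All (λ e → proj₂ e ∈ map proj₁ Γ ⊎ proj₂ e ∈ tops) Γ

  Meets : List (V × V) → List V → List V → List V → Vec V n → Set
  Meets Γ tops X K f =
    All (λ e → lookup f (proj₁ e) ≡ proj₂ e) Γ × (∀ w → lookup f w ∉ X) ×
    (∀ w → w ∉ map proj₁ Γ → w ∉ tops → lookup f w ∈ K → ∃[ y ] lookup f y ≡ w)

  validSpec? : ∀ Γ tops X K → Dec (ValidSpec Γ tops X K)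
  validSpec? Γ tops X K =
    unique? (map proj₁ Γ) ×-dec unique? X ×-dec unique? K ×-dec All.all? (λ v → ¬? (v ∈? X)) K ×-dec
    All.all? (λ v → (v ∈? map proj₁ Γ) ⊎-dec (v ∈? tops)) K ×-dec
    All.all? (λ e → (proj₂ e ∈? map proj₁ Γ) ⊎-dec (proj₂ e ∈? tops)) Γ

  meets? : ∀ Γ tops X K f → Dec (Meets Γ tops X K f)
  meets? Γ tops X K f =
    All.all? (λ e → lookup f (proj₁ e) ≟ proj₂ e) Γ ×-dec all? (λ w → ¬? (lookup f w ∈? X)) ×-dec
    all? (λ w → ¬? (w ∈? map proj₁ Γ) →-dec (¬? (w ∈? tops) →-dec ((lookup f w ∈? K) →-dec any? (λ y → lookup f y ≟ w))))

  module Code {m : ℕ} (root : V) (s t : ℕ) (P Q : Vec V (suc m)) (C : Vec (Maybe (V × V)) (suc m)) where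
    E tops X K : List V
    Γ : List (V × V)
    E    = excluded s t P Q
    tops = topOf s P ∷ topOf t Q ∷ []
    X    = map proj₁ (leaves P Q C)
    K    = leafless E P Q C
    Γ    = (root , root) ∷ forcedPath s P ++ forcedPath t Q ++ leaves P Q C

    Encodes : Vec V n → Set
    Encodes f = (Unique (toList P) × Unique (toList Q) × ValidSpec Γ tops X K) × Meets Γ tops X K f

    valid? : Dec (Unique (toList P) × Unique (toList Q) × ValidSpec Γ tops X K)
    valid? = unique? (toList P) ×-dec unique? (toList Q) ×-dec validSpec? Γ tops X K

    encodes? : ∀ f → Dec (Encodes f)
    encodes? f = valid? ×-dec meets? Γ tops X K f

    keys-split : map proj₁ Γ ≡ root ∷ map proj₁ (forcedPath s P) ++ map proj₁ (forcedPath t Q) ++ X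
    keys-split = cong (root ∷_) (trans (map-++ proj₁ (forcedPath s P) _)
                   (cong (map proj₁ (forcedPath s P) ++_) (map-++ proj₁ (forcedPath t Q) _)))

module Leaves {n : ℕ} {G : Graph n} {root : Fin n} {f : Fin n → Fin n}
              (simple : IsSimple G) (R : Rooted G root f) where
  open Rooted R
  private
    V = Fin n

  Childless : V → Set
  Childless w = ∀ y → f y ≢ w

  adj-sym : ∀ {u v} → Adj G u v → Adj G v u
  adj-sym {u} {v} e = trans (proj₁ simple v u) e

  childless⇒≢root : ∀ {w} → Childless w → w ≢ root
  childless⇒≢root c refl = c root root-fixed

  leaf⇒unique-neighbour : ∀ {w a b} → deg G w ≡ 1 → Adj G w a → Adj G w b → a ≡ b
  leaf⇒unique-neighbour {w} {a} {b} d = countTrue≡1⇒unique (lookup G w) d a b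

  childless⇒leaf : ∀ {w} → Childless w → deg G w ≡ 1
  childless⇒leaf {w} c = unique⇒countTrue≡1 (lookup G w) (f w) (parent-adj (childless⇒≢root c)) only
    where
    only : ∀ j → lookup (lookup G w) j ≡ true → j ≡ f w
    only j e with edges {w} {j} e
    ... | inj₁ eq = sym eq
    ... | inj₂ eq = ⊥-elim (c j eq)

  -- A leaf other than the root has its parent as its only neighbour, so it hangs below `u`; a child
  -- of it would be that same neighbour and give a two-cycle. `noroot` excludes the remaining case,
  -- in which the leaf is the root.
  leaf-below : ∀ {u} → adjToLeaf G u ≡ true → (deg G root ≡ 1 → ¬ (Adj G u root)) →
               ∃[ w ] (f w ≡ u × Childless w)
  leaf-below {u} eq noroot with any⁻ (λ w → adjB G u w ∧ (deg G w ≡ᵇ 1)) (allFin n) eq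
  ... | w , _ , both with ∧-split (adjB G u w) _ both
  ...   | e , d with ≡ᵇ⇒≡ (deg G w) 1 (subst T (sym d) _) | w ≟ root
  ...     | d1 | yes refl = ⊥-elim (noroot d1 e)
  ...     | d1 | no w≢r   = w , sym (leaf⇒unique-neighbour d1 (adj-sym e) (parent-adj w≢r)) , childless
    where
    childless : Childless w
    childless y fy with y ≟ root
    ... | yes refl = w≢r (trans (sym fy) root-fixed)
    ... | no y≢r   = no-two-cycle w≢r (trans (cong f (leaf⇒unique-neighbour d1 (parent-adj w≢r) (adj-sym (subst (Adj G y) fy (parent-adj y≢r))))) fy)

  -- Translates a check bit into the closure condition of the count: a child of `u` outside the
  -- image of `f` would be a leaf next to `u`.
  no-leaf-below : ∀ {u} → adjToLeaf G u ≡ false → ∀ w → f w ≡ u → ∃[ y ] f y ≡ w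
  no-leaf-below {u} eq w fw with any? (λ y → f y ≟ w)
  ... | yes found = found
  ... | no none with trans (sym eq) (any⁺ (λ w → adjB G u w ∧ (deg G w ≡ᵇ 1)) (∈-allFin w) leafy)
    where
    childless : Childless w
    childless y fy = none (y , fy)
    leafy : adjB G u w ∧ (deg G w ≡ᵇ 1) ≡ true
    leafy rewrite adj-sym (subst (Adj G w) fw (parent-adj (childless⇒≢root childless))) | childless⇒leaf childless = refl
  ...   | ()

-- The root may be a leaf hanging from a vertex of the path; that vertex is then excluded.
lone-child-of-top : ∀ {V : Set} {m} s (P : Vec V (suc m)) {u} → Unique (toList P) →
  (∀ {a b} → (a , topOf s P) ∈ forcedPath s P → (b , topOf s P) ∈ forcedPath s P → a ≡ b) →
  (u , topOf s P) ∈ forcedPath s P → (s ≡ 0 × u ≡ second P) ⊎ u ≡ penult P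
lone-child-of-top zero (x ∷ y ∷ ys) un H (here refl) = inj₁ (refl , refl)
lone-child-of-top zero (x ∷ y ∷ ys) (x∉ ∷ _) H (there e) = ⊥-elim (All.lookup x∉ (value-descending y ys e) refl)
lone-child-of-top (suc s) (x ∷ y ∷ []) un H (here refl) = inj₂ refl
lone-child-of-top {V} (suc s) (x ∷ y ∷ w ∷ ws) {u} (x∉ ∷ un) H e = go s H e
  where
  P′ = y ∷ w ∷ ws
  topOf∈ : ∀ {m} s (P : Vec V (suc m)) → topOf s P ∈ toList P
  topOf∈ s       (x ∷ [])     = here refl
  topOf∈ zero    (x ∷ y ∷ ys) = here refl
  topOf∈ (suc s) (x ∷ y ∷ ys) = there (topOf∈ s (y ∷ ys))
  y∉ : ∀ {z} → z ∈ toList (w ∷ ws) → y ≢ z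
  y∉ = All.lookup (AllPairs.head un)
  rest : ∀ s → (∀ {a b} → (a , topOf s P′) ∈ (x , y) ∷ forcedPath s P′ → (b , topOf s P′) ∈ (x , y) ∷ forcedPath s P′ → a ≡ b) →
         (u , topOf s P′) ∈ forcedPath s P′ → (suc s ≡ 0 × u ≡ y) ⊎ u ≡ penult P′
  rest s H e with lone-child-of-top s P′ un (λ p q → H (there p) (there q)) e
  ... | inj₁ (refl , refl) = ⊥-elim (All.lookup x∉ (there (here refl)) (H (here refl) (there e)))
  ... | inj₂ eq = inj₂ eq
  go : ∀ s → (∀ {a b} → (a , topOf s P′) ∈ (x , y) ∷ forcedPath s P′ → (b , topOf s P′) ∈ (x , y) ∷ forcedPath s P′ → a ≡ b) →
       (u , topOf s P′) ∈ (x , y) ∷ forcedPath s P′ → (suc s ≡ 0 × u ≡ y) ⊎ u ≡ penult P′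
  go zero    H (here refl) = ⊥-elim (All.lookup x∉ (there (here refl)) (H (here refl) (there (here refl))))
  go (suc s) H (here eq)   = ⊥-elim (y∉ (topOf∈ s (w ∷ ws)) (sym (cong proj₂ eq)))
  go s       H (there e)   = rest s H e

if-no : ∀ {A B : Set} {x y : B} (d : Dec A) (F : B → Set) → ¬ A → F y → F (if does d then x else y)
if-no (yes a) F ¬a fy = ⊥-elim (¬a a)
if-no (no _)  F ¬a fy = fy

∈-map-proj₁⁻ : ∀ {A B : Set} {a : A} {es : List (A × B)} → a ∈ map proj₁ es → ∃[ b ] (a , b) ∈ es
∈-map-proj₁⁻ a∈ with ∈-map⁻ proj₁ a∈
... | (a , b) , e , refl = b , e

module PathFacts {n : ℕ} {G : Graph n} {root : Fin n} {f : Fin n → Fin n}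
                 (simple : IsSimple G) (R : Rooted G root f) where
  open Rooted R
  open Orient R using (IsArc)
  open Leaves simple R

  key≢root : ∀ {w v} → IsArc (w , v) → w ≢ root
  key≢root (fw , w≢v) refl = w≢v (trans (sym root-fixed) fw)

  -- If the root is the parent of a path vertex `u` that is not the top, it lies on the path; it is
  -- no key, hence it is the top. Having degree one, it has a single child on the path, so `u` is
  -- next to an end.
  far-from-root : ∀ {m} s (P : Vec (Fin n) (suc m)) {u} → Unique (toList P) → All IsArc (forcedPath s P) →
    u ∈ toList P → u ≢ topOf s P → u ≢ second P → u ≢ penult P → deg G root ≡ 1 → ¬ Adj G u root
  far-from-root s P {u} un arcs u∈ ≢top ≢sec ≢pen d e with edges e
  ... | inj₂ fr = true≢false (trans (sym e) (subst (λ x → adjB G x root ≡ false) (trans (sym root-fixed) fr) (proj₂ simple root)))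
    where
    true≢false : true ≢ false
    true≢false ()
  ... | inj₁ fu with key-or-top s P u∈
  ...   | inj₂ eq = ≢top eq
  ...   | inj₁ k with ∈-map-proj₁⁻ k
  ...     | a , ua∈ with trans (sym fu) (proj₁ (All.lookup arcs ua∈))
  ...       | refl with key-or-top s P (value-forcedPath s P ua∈)
  ...         | inj₁ rk = key≢root (All.lookup arcs (proj₂ (∈-map-proj₁⁻ rk))) refl
  ...         | inj₂ eq with lone-child-of-top s P un lone (subst (λ x → (u , x) ∈ forcedPath s P) eq ua∈)
    where
    child : ∀ {a} → (a , topOf s P) ∈ forcedPath s P → Adj G root a
    child {a} a∈ with All.lookup arcs a∈
    ... | fa , a≢ = adj-sym (subst (Adj G a) (trans fa (sym eq)) (parent-adj (λ a≡r → a≢ (trans a≡r eq))))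
    lone : ∀ {a b} → (a , topOf s P) ∈ forcedPath s P → (b , topOf s P) ∈ forcedPath s P → a ≡ b
    lone a∈ b∈ = leaf⇒unique-neighbour d (child a∈) (child b∈)
  ...           | inj₁ (_ , ≡sec) = ≢sec ≡sec
  ...           | inj₂ ≡pen       = ≢pen ≡pen

  childless∉path : ∀ {m} s (P : Vec (Fin n) (suc (suc m))) {x} → All IsArc (forcedPath s P) →
    Childless x → f x ≢ second P → f x ≢ penult P → x ∉ toList P
  childless∉path s (p ∷ q ∷ ps) arcs c ≢sec ≢pen x∈ with forcedPath-ends s p q ps x∈
  ... | inj₁ (a , e)       = c a (proj₁ (All.lookup arcs e))
  ... | inj₂ (inj₁ (_ , e)) = ≢sec (proj₁ (All.lookup arcs e))
  ... | inj₂ (inj₂ e)       = ≢pen (proj₁ (All.lookup arcs e))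

module Encoding {n m : ℕ} {G : Graph n} {root : Fin n} (f : Vec (Fin n) n)
  (simple : IsSimple G) (R : Rooted G root (lookup f))
  (P Q : Vec (Fin n) (suc (suc m))) (pathP : IsPath G (suc m) P) (pathQ : IsPath G (suc m) Q)
  (share : ShareAtMostOne P Q) (same : check G P ≡ check G Q)
  (s t : ℕ) (arcsP : All (Orient.IsArc R) (forcedPath s P)) (arcsQ : All (Orient.IsArc R) (forcedPath t Q)) where

  open Rooted R
  open Orient R using (IsArc)
  open Leaves simple R
  open PathFacts simple R

  private
    V = Fin n
    E = excluded s t P Q

  uniqueP : Unique (toList P)
  uniqueP = lookup-injective⇒unique P (proj₁ pathP)

  uniqueQ : Unique (toList Q)
  uniqueQ = lookup-injective⇒unique Q (proj₁ pathQ)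

  -- A key has its parent on its path. A key common to both paths would bring its parent along as a
  -- second common vertex.
  keys-disjoint : ∀ {v} → v ∈ map proj₁ (forcedPath s P) → v ∈ map proj₁ (forcedPath t Q) → ⊥
  keys-disjoint {v} kP kQ with ∈-map-proj₁⁻ kP | ∈-map-proj₁⁻ kQ
  ... | a , va∈ | b , vb∈ with All.lookup arcsP va∈ | All.lookup arcsQ vb∈
  ...   | fa , v≢a | fb , _ with trans (sym fa) fb
  ...     | refl with ∈-toList⇒lookup P (keys-forcedPath s P kP) | ∈-toList⇒lookup Q (keys-forcedPath t Q kQ)
                    | ∈-toList⇒lookup P (value-forcedPath s P va∈) | ∈-toList⇒lookup Q (value-forcedPath t Q vb∈)
  ...       | i , pi | j , qj | i′ , pi′ | j′ , qj′ =
              v≢a (trans (sym pi) (trans (share i j i′ j′ (trans pi (sym qj)) (trans pi′ (sym qj′))) pi′))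

  common∈excluded : ∀ {v} → v ∈ toList P → v ∈ toList Q → v ∈ E
  common∈excluded v∈P v∈Q with key-or-top s P v∈P | key-or-top t Q v∈Q
  ... | inj₂ eq | _       = here eq
  ... | inj₁ _  | inj₂ eq = there (here eq)
  ... | inj₁ k  | inj₁ k′ = ⊥-elim (keys-disjoint k k′)

  leaf-below-path : ∀ {u} → u ∈ toList P ⊎ u ∈ toList Q → u ∉ E → adjToLeaf G u ≡ true → ∃[ w ] (lookup f w ≡ u × Childless w)
  leaf-below-path {u} (inj₁ u∈) u∉E eq = leaf-below eq (far-from-root s P uniqueP arcsP u∈
    (u∉E ∘ here) (u∉E ∘ there ∘ there ∘ here) (u∉E ∘ there ∘ there ∘ there ∘ there ∘ here))
  leaf-below-path {u} (inj₂ u∈) u∉E eq = leaf-below eq (far-from-root t Q uniqueQ arcsQ u∈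
    (u∉E ∘ there ∘ here) (u∉E ∘ there ∘ there ∘ there ∘ here) (u∉E ∘ there ∘ there ∘ there ∘ there ∘ there ∘ here))

  leaf∉paths : ∀ {x} → Childless x → lookup f x ∉ E → x ∉ toList P × x ∉ toList Q
  leaf∉paths c fx∉ =
    childless∉path s P arcsP c (fx∉ ∘ there ∘ there ∘ here) (fx∉ ∘ there ∘ there ∘ there ∘ there ∘ here) ,
    childless∉path t Q arcsQ c (fx∉ ∘ there ∘ there ∘ there ∘ here) (fx∉ ∘ there ∘ there ∘ there ∘ there ∘ there ∘ here)

  IsLeafEntry : ∀ {k} → Vec V k → Vec V k → V × V → Set
  IsLeafEntry ps qs (x , u) = lookup f x ≡ u × Childless x × u ∉ E × (u ∈ toList ps ⊎ u ∈ toList qs)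

  IsLeafless : ∀ {k} → Vec V k → Vec V k → V → Set
  IsLeafless ps qs u = u ∉ E × (u ∈ toList ps ⊎ u ∈ toList qs) × adjToLeaf G u ≡ false

  record Certificate {k} (ps qs : Vec V k) : Set where
    constructor certificate
    field
      C           : Vec (Maybe (V × V)) k
      leaf-spec   : All (IsLeafEntry ps qs) (leaves ps qs C)
      leaf-unique : Unique (map proj₂ (leaves ps qs C))
      rest-spec   : All (IsLeafless ps qs) (leafless E ps qs C)
      rest-unique : Unique (leafless E ps qs C)

  certify : ∀ {k} (ps qs : Vec V k) → (∀ {v} → v ∈ toList ps → v ∈ toList P) → (∀ {v} → v ∈ toList qs → v ∈ toList Q) →
            Unique (toList ps) → Unique (toList qs) → check G ps ≡ check G qs → Certificate ps qs
  certify [] [] _ _ _ _ _ = certificate [] [] [] [] []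
  certify (p ∷ ps) (q ∷ qs) inP inQ (p∉ ∷ ups) (q∉ ∷ uqs) eq
    with certify ps qs (inP ∘ there) (inQ ∘ there) ups uqs (proj₂ (∷-injective eq))
  ... | certificate C ls lu rs ru = extend (used? E p q) (adjToLeaf G p) refl
    where
    same-bit : adjToLeaf G p ≡ adjToLeaf G q
    same-bit = Boolₚ.not-injective (proj₁ (∷-injective eq))
    widen : ∀ {u} → u ∈ toList ps ⊎ u ∈ toList qs → u ∈ toList (p ∷ ps) ⊎ u ∈ toList (q ∷ qs)
    widen = Sum.map there there
    ls′ : All (IsLeafEntry (p ∷ ps) (q ∷ qs)) (leaves ps qs C)
    ls′ = All.map (λ { (a , b , c , d) → a , b , c , widen d }) ls
    rs′ : All (IsLeafless (p ∷ ps) (q ∷ qs)) (leafless E ps qs C)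
    rs′ = All.map (λ { (a , b , c) → a , widen b , c }) rs
    p≢ : p ∉ E → ∀ {u} → u ∈ toList ps ⊎ u ∈ toList qs → p ≢ u
    p≢ p∉E (inj₁ u∈) refl = All.lookup p∉ u∈ refl
    p≢ p∉E (inj₂ u∈) refl = p∉E (common∈excluded (inP (here refl)) (inQ (there u∈)))
    q≢ : q ∉ E → ∀ {u} → u ∈ toList ps ⊎ u ∈ toList qs → q ≢ u
    q≢ q∉E (inj₂ u∈) refl = All.lookup q∉ u∈ refl
    q≢ q∉E (inj₁ u∈) refl = q∉E (common∈excluded (inP (there u∈)) (inQ (here refl)))
    p≢q : p ∉ E → p ≢ q
    p≢q p∉E refl = p∉E (common∈excluded (inP (here refl)) (inQ (here refl)))
    extend : (d : Dec (p ∉ E × q ∉ E)) (b : Bool) → adjToLeaf G p ≡ b → Certificate (p ∷ ps) (q ∷ qs)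
    extend (yes (p∉E , q∉E)) true bit
      with leaf-below-path (inj₁ (inP (here refl))) p∉E bit
         | leaf-below-path (inj₂ (inQ (here refl))) q∉E (trans (sym same-bit) bit)
    ... | x , fx , cx | y , fy , cy = certificate (just (x , y) ∷ C)
      ((fx , cx , p∉E , inj₁ (here refl)) ∷ (fy , cy , q∉E , inj₂ (here refl)) ∷ ls′)
      ((p≢q p∉E ∷ Allₚ.map⁺ (All.map (λ { (_ , _ , _ , d) → p≢ p∉E d }) ls)) ∷
       Allₚ.map⁺ (All.map (λ { (_ , _ , _ , d) → q≢ q∉E d }) ls) ∷ lu)
      rs′ ru
    extend (yes (p∉E , q∉E)) false bit = certificate (nothing ∷ C) ls′ lu
      (cond (λ l → All (IsLeafless (p ∷ ps) (q ∷ qs)) l)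
        ((p∉E , inj₁ (here refl) , bit) ∷ (q∉E , inj₂ (here refl) , trans (sym same-bit) bit) ∷ rs′) rs′)
      (cond Unique
        ((p≢q p∉E ∷ All.map (λ { (_ , d , _) → p≢ p∉E d }) rs) ∷ All.map (λ { (_ , d , _) → q≢ q∉E d }) rs ∷ ru) ru)
      where
      cond : ∀ {A : Set} {xs ys : A} {b} (F : A → Set) → F xs → F ys → F (if b then xs else ys)
      cond {b = true}  F x y = x
      cond {b = false} F x y = y
    -- At an excluded index the bit is ignored, since a leaf recorded here could be the root or lie
    -- on a path.
    extend (no unused) b _ = certificate (nothing ∷ C) ls′ lu
      (if-no (used? E p q) (All (IsLeafless (p ∷ ps) (q ∷ qs))) unused rs′) (if-no (used? E p q) Unique unused ru)

  private
    cert : Certificate P Q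
    cert = certify P Q id id uniqueP uniqueQ same

  open Certificate cert
  open Code root s t P Q C using (tops; X; K; Γ; Encodes; keys-split)

  X-spec : ∀ {x} → x ∈ X → Childless x × x ∉ toList P × x ∉ toList Q
  X-spec {x} x∈ with ∈-map-proj₁⁻ x∈
  ... | u , xu∈ with All.lookup leaf-spec xu∈
  ...   | refl , c , u∉E , _ = c , leaf∉paths c u∉E

  -- The map `f` sends each recorded leaf to its path vertex, so leaves of distinct path vertices
  -- are distinct.
  X-unique : Unique X
  X-unique = Uniqueₚ.map⁻ {f = lookup f} (subst Unique eq leaf-unique)
    where
    eq : map proj₂ (leaves P Q C) ≡ map (lookup f) X
    eq = trans (map-cong-local (All.map (λ { (fx , _) → sym fx }) leaf-spec)) (map-∘ (leaves P Q C))

  keysP = map proj₁ (forcedPath s P)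
  keysQ = map proj₁ (forcedPath t Q)

  keys⁺ : ∀ {v} → v ∈ root ∷ keysP ++ keysQ ++ X → v ∈ map proj₁ Γ
  keys⁺ {v} = subst (v ∈_) (sym keys-split)

  keys-unique : Unique (map proj₁ Γ)
  keys-unique = subst Unique (sym keys-split)
    (All.tabulate root-new ∷ Uniqueₚ.++⁺ (unique-keys s P uniqueP)
      (Uniqueₚ.++⁺ (unique-keys t Q uniqueQ) X-unique (λ { (k , x∈) → proj₂ (proj₂ (X-spec x∈)) (keys-forcedPath t Q k) }))
      disjointP)
    where
    disjointP : ∀ {v} → ¬ (v ∈ keysP × v ∈ keysQ ++ X)
    disjointP (k , rest) with ∈-++⁻ keysQ rest
    ... | inj₁ k′ = keys-disjoint k k′
    ... | inj₂ x∈ = proj₁ (proj₂ (X-spec x∈)) (keys-forcedPath s P k)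
    root-new : ∀ {v} → v ∈ keysP ++ keysQ ++ X → root ≢ v
    root-new v∈ eq with ∈-++⁻ keysP v∈
    ... | inj₁ k = key≢root (All.lookup arcsP (proj₂ (∈-map-proj₁⁻ k))) (sym eq)
    ... | inj₂ rest with ∈-++⁻ keysQ rest
    ...   | inj₁ k  = key≢root (All.lookup arcsQ (proj₂ (∈-map-proj₁⁻ k))) (sym eq)
    ...   | inj₂ x∈ = childless⇒≢root (proj₁ (X-spec x∈)) (sym eq)

  on-path : ∀ {v} → v ∈ toList P ⊎ v ∈ toList Q → v ∈ map proj₁ Γ ⊎ v ∈ tops
  on-path (inj₁ v∈) with key-or-top s P v∈
  ... | inj₁ k  = inj₁ (keys⁺ (there (∈-++⁺ˡ k)))
  ... | inj₂ eq = inj₂ (here eq)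
  on-path (inj₂ v∈) with key-or-top t Q v∈
  ... | inj₁ k  = inj₁ (keys⁺ (there (∈-++⁺ʳ keysP (∈-++⁺ˡ k))))
  ... | inj₂ eq = inj₂ (there (here eq))

  encodes : Encodes f
  encodes = (uniqueP , uniqueQ , keys-unique , X-unique , rest-unique ,
             All.map (λ { (_ , on , _) x∈ → K∉X on x∈ }) rest-spec ,
             All.map (λ { (_ , on , _) → on-path on }) rest-spec ,
             inj₁ (here refl) ∷ Allₚ.++⁺ (All.tabulate (λ e → on-path (inj₁ (value-forcedPath s P e))))
               (Allₚ.++⁺ (All.tabulate (λ e → on-path (inj₂ (value-forcedPath t Q e))))
                 (All.map (λ { (_ , _ , _ , on) → on-path on }) leaf-spec))) ,
            (root-fixed ∷ Allₚ.++⁺ (All.map proj₁ arcsP) (Allₚ.++⁺ (All.map proj₁ arcsQ) (All.map proj₁ leaf-spec))) ,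
            (λ w fw∈X → proj₁ (X-spec fw∈X) w refl) ,
            (λ w _ _ fw∈K → no-leaf-below (proj₂ (proj₂ (All.lookup rest-spec fw∈K))) w refl)
    where
    K∉X : ∀ {v} → v ∈ toList P ⊎ v ∈ toList Q → v ∉ X
    K∉X (inj₁ v∈) x∈ = proj₁ (proj₂ (X-spec x∈)) v∈
    K∉X (inj₂ v∈) x∈ = proj₂ (proj₂ (X-spec x∈)) v∈

badTree-encoding : ∀ {n m} (root : Fin n) {G : Graph n} → IsTree G → BadTree (suc m) G →
  ∃[ s ] ∃[ t ] ∃[ P ] ∃[ Q ] ∃[ C ] ∃[ f ]
    (s ≤ suc m × t ≤ suc m × Code.Encodes {m = suc m} root s t P Q C f × parentGraph f ≡ G)
badTree-encoding root {G} tree (P , Q , pathP , pathQ , share , same) =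
  let s , s≤ , arcsP = Orient.orient R P pathP
      t , t≤ , arcsQ = Orient.orient R Q pathQ
  in s , t , P , Q , _ , f , s≤ , t≤ ,
     Encoding.encodes f (proj₁ tree) R P Q pathP pathQ share same s t arcsP arcsQ ,
     parentGraph-rooted f (proj₁ tree) R
  where
  open Rooting G root tree
  f : Vec (Fin _) _
  f = tabulate parent
  R : Rooted G root (lookup f)
  R = rooted-resp (λ v → sym (lookup∘tabulate parent v)) rooted

-- Counting the parent maps that meet a specification

module _ {n : ℕ} where
  open DecMem (_≟_ {n}) using (_∈?_)
  private
    V = Fin n

  member : List V → V → Bool
  member L v = does (v ∈? L)

  card-member : ∀ L → card (member L) ≡ length (filter (_∈? L) (allFin n))
  card-member L = sym (length-filter-∑ (_∈? L) (allFin n))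

  card-member-≤ : ∀ L → card (member L) ≤ length L
  card-member-≤ L = ≤-trans (≤-reflexive (card-member L))
    (unique-⊆⇒length≤ (Uniqueₚ.filter⁺ (_∈? L) (Uniqueₚ.allFin⁺ n)) (λ v∈ → proj₂ (∈-filter⁻ (_∈? L) {xs = allFin n} v∈)))

  card-member-unique : ∀ {L} → Unique L → card (member L) ≡ length L
  card-member-unique {L} u = ≤-antisym (card-member-≤ L)
    (≤-trans (unique-⊆⇒length≤ u (λ v∈ → ∈-filter⁺ (_∈? L) (∈-allFin _) v∈)) (≤-reflexive (sym (card-member L))))

  card-nonmember : ∀ {L} → Unique L → card (not ∘ member L) ≡ n ∸ length L
  card-nonmember {L} u = begin
    card (not ∘ member L)                                  ≡⟨ sym (m+n∸m≡n (card (member L)) _) ⟩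
    (card (member L) + card (not ∘ member L)) ∸ card (member L) ≡⟨ cong₂ _∸_ (card-not (member L)) (card-member-unique u) ⟩
    n ∸ length L ∎
    where open ≡-Reasoning

  module Classified (Γ : List (V × V)) (tops : List V) where
    keys : List V
    keys = map proj₁ Γ

    IsClass : V → Class n → Set
    IsClass w (forced b) = (w , b) ∈ Γ
    IsClass w exempt     = w ∉ keys × w ∈ tops
    IsClass w regular    = w ∉ keys × w ∉ tops

    classify : ∀ w → Σ (Class n) (IsClass w)
    classify w with w ∈? keys
    ... | yes w∈ = forced _ , proj₂ (∈-map-proj₁⁻ w∈)
    ... | no w∉ with w ∈? tops
    ...   | yes w∈ = exempt , w∉ , w∈
    ...   | no w∉′ = regular , w∉ , w∉′

    cls : V → Class n
    cls w = proj₁ (classify w)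

    irregular : ∀ {w} → w ∈ keys ⊎ w ∈ tops → isRegular (cls w) ≡ false
    irregular {w} h with classify w
    ... | forced b , _ = refl
    ... | exempt , _   = refl
    irregular (inj₁ k) | regular , w∉ , _ = ⊥-elim (w∉ k)
    irregular (inj₂ t) | regular , _ , w∉ = ⊥-elim (w∉ t)

    free : V → Bool
    free w = not (member keys w)

    den-free : ∀ D k w → den D k (cls w) ≡ (if free w then 25 else 1)
    den-free D k w with classify w
    ... | forced b , e rewrite dec-true (w ∈? keys) (∈-map⁺ proj₁ e) = refl
    ... | exempt , w∉ , _ rewrite dec-false (w ∈? keys) w∉ = refl
    ... | regular , w∉ , _ rewrite dec-false (w ∈? keys) w∉ = refl

    -- An exempt coordinate is charged like a regular one, up to a factor 2: 25(D + k) ≤ 2(16k +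
    -- 25D). The two tops therefore cost a factor of at most 4.
    num-free : ∀ D k w → num D k (cls w) ≤ (if free w then 16 * k + 25 * D else 1) * (if member tops w then 2 else 1)
    num-free D k w with classify w
    ... | forced b , e rewrite dec-true (w ∈? keys) (∈-map⁺ proj₁ e) = 1≤1or2 (member tops w)
      where
      1≤1or2 : ∀ b → 1 ≤ 1 * (if b then 2 else 1)
      1≤1or2 true  = s≤s z≤n
      1≤1or2 false = ≤-refl
    ... | exempt , w∉ , w∈ rewrite dec-false (w ∈? keys) w∉ | dec-true (w ∈? tops) w∈ =
          subst (25 * (D + k) ≤_) (lem D k) (m≤m+n _ (7 * k + 25 * D))
      where
      lem : ∀ D k → 25 * (D + k) + (7 * k + 25 * D) ≡ (16 * k + 25 * D) * 2
      lem = solve-∀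
    ... | regular , w∉ , w∉′ rewrite dec-false (w ∈? keys) w∉ | dec-false (w ∈? tops) w∉′ = ≤-reflexive (sym (*-identityʳ _))

  count-meeting : ∀ {Γ tops X K} → ValidSpec Γ tops X K → ∀ d → length X + (length K + suc d) ≡ n →
    covered d n * 25 ≤ 16 * suc d ^ n →
    {P : Vec V n → Set} (P? : ∀ f → Dec (P f)) → (∀ f → P f → Meets Γ tops X K f) →
    ∑ (allVec (allFin n) n) (λ f → 𝟙 (P? f)) * 25 ^ (n ∸ length Γ)
      ≤ (16 * length K + 25 * suc d) ^ (n ∸ length Γ) * 2 ^ length tops
  count-meeting {Γ} {tops} {X} {K} (keys! , X! , K! , K∉X , K-on , values-on) d size ratio {P} P? meets = begin
    N * 25 ^ (n ∸ length Γ)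
      ≡⟨ cong (N *_) (trans (cong (25 ^_) (sym free-count)) (trans (^card 25 free) (∏-cong (λ w → sym (den-free (suc d) k w))))) ⟩
    N * ∏ (λ w → den (suc d) k (cls w))
      ≤⟨ count-bound P? admissible ⟩
    ∏ (λ w → num (suc d) k (cls w))
      ≤⟨ ∏-mono (num-free (suc d) k) ⟩
    ∏ (λ w → (if free w then M k else 1) * (if member tops w then 2 else 1))
      ≡⟨ trans (∏-* (λ w → if free w then M k else 1) (λ w → if member tops w then 2 else 1))
               (cong₂ _*_ (sym (^card (M k) free)) (sym (^card 2 (member tops)))) ⟩
    M k ^ card free * 2 ^ card (member tops)
      ≡⟨ cong₂ (λ x y → M x ^ y * 2 ^ card (member tops)) (card-member-unique K!) free-count ⟩
    M (length K) ^ (n ∸ length Γ) * 2 ^ card (member tops)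
      ≤⟨ *-monoʳ-≤ (M (length K) ^ (n ∸ length Γ)) (^-monoʳ-≤ 2 (card-member-≤ tops)) ⟩
    M (length K) ^ (n ∸ length Γ) * 2 ^ length tops ∎
    where
    open ≤-Reasoning
    open Classified Γ tops
    N = ∑ (allVec (allFin n) n) (λ f → 𝟙 (P? f))
    k = card (member K)
    M : ℕ → ℕ
    M x = 16 * x + 25 * suc d
    free-count : card free ≡ n ∸ length Γ
    free-count = trans (card-nonmember keys!) (cong (n ∸_) (length-map proj₁ Γ))
    member⁻ : ∀ {L v} → member L v ≡ true → v ∈ L
    member⁻ {L} {v} = does-true (v ∈? L)
    values-irregular : ∀ w v → cls w ≡ forced v → isRegular (cls v) ≡ false
    values-irregular w v eq with classify w
    values-irregular w v refl | forced .v , e = irregular (All.lookup values-on e)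
    open Count d cls (member K) (member X)
      (λ v vK vX → All.lookup K∉X (member⁻ {K} vK) (member⁻ {X} vX))
      (λ v vK → irregular (All.lookup K-on (member⁻ {K} vK)))
      values-irregular
      (trans (cong₂ (λ x y → x + (y + suc d)) (card-member-unique X!) (card-member-unique K!)) size)
      ratio
    admissible : ∀ f → P f → Admissible cls (member K) (member X) f
    admissible f p = record { obeys = obeys ; avoids = λ w → dec-false (lookup f w ∈? X) (avoids w) ; closed = closed′ }
      where
      obeysΓ = proj₁ (meets f p)
      avoids = proj₁ (proj₂ (meets f p))
      closed = proj₂ (proj₂ (meets f p))
      obeys : ∀ w v → cls w ≡ forced v → lookup f w ≡ v
      obeys w v eq with classify w
      obeys w v refl | forced .v , e = All.lookup obeysΓ e
      closed′ : ∀ w → cls w ≡ regular → member K (lookup f w) ≡ true → ∃[ y ] lookup f y ≡ w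
      closed′ w eq inK with classify w
      closed′ w refl inK | regular , w∉ , w∉′ = closed w w∉ w∉′ (member⁻ {K} inK)

-- Summing over certificates and pairs of paths

∸-submult : ∀ A x y → (A ∸ (x + y)) * A ≤ (A ∸ x) * (A ∸ y)
∸-submult A x y with x + y ≤? A
... | no ≰ rewrite m≤n⇒m∸n≡0 (<⇒≤ (≰⇒> ≰)) = z≤n
... | yes le = subst (λ B → (B ∸ (x + y)) * B ≤ (B ∸ x) * (B ∸ y)) (m+[n∸m]≡n le) (go (A ∸ (x + y)))
  where
  open ≤-Reasoning
  go : ∀ c → (x + y + c ∸ (x + y)) * (x + y + c) ≤ (x + y + c ∸ x) * (x + y + c ∸ y)
  go c = begin
    (x + y + c ∸ (x + y)) * (x + y + c)          ≡⟨ cong (_* (x + y + c)) (m+n∸m≡n (x + y) c) ⟩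
    c * (x + y + c)                              ≤⟨ m≤m+n _ (x * y) ⟩
    c * (x + y + c) + x * y                      ≡⟨ lem x y c ⟩
    (y + c) * (x + c)                            ≡⟨ cong₂ _*_ (sym (trans (cong (_∸ x) (+-assoc x y c)) (m+n∸m≡n x (y + c))))
                                                              (sym (trans (cong (_∸ y) (lem₂ x y c)) (m+n∸m≡n y (x + c)))) ⟩
    (x + y + c ∸ x) * (x + y + c ∸ y)            ∎
    where
    lem : ∀ x y c → c * (x + y + c) + x * y ≡ (y + c) * (x + c)
    lem = solve-∀
    lem₂ : ∀ x y c → x + y + c ≡ y + (x + c)
    lem₂ = solve-∀

-- Scaled by A, this is 1 - (ky + x)/A ≤ (1 - x/A)(1 - y/A)^k. It trades a linear loss for one
-- factor per lost unit, so that every leaf and every vertex of K can be bounded separately.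
bernoulli-∸ : ∀ A x y k → (A ∸ (k * y + x)) * A ^ k ≤ (A ∸ x) * (A ∸ y) ^ k
bernoulli-∸ A x y zero    = ≤-refl
bernoulli-∸ A x y (suc k) = begin
  (A ∸ (y + k * y + x)) * (A * A ^ k)          ≡⟨ cong (λ z → (A ∸ z) * (A * A ^ k)) (+-assoc y (k * y) x) ⟩
  (A ∸ (y + (k * y + x))) * (A * A ^ k)        ≡⟨ sym (*-assoc (A ∸ (y + (k * y + x))) A (A ^ k)) ⟩
  (A ∸ (y + (k * y + x))) * A * A ^ k          ≤⟨ *-monoˡ-≤ (A ^ k) (∸-submult A y (k * y + x)) ⟩
  (A ∸ y) * (A ∸ (k * y + x)) * A ^ k          ≡⟨ *-assoc (A ∸ y) _ _ ⟩
  (A ∸ y) * ((A ∸ (k * y + x)) * A ^ k)        ≤⟨ *-monoʳ-≤ (A ∸ y) (bernoulli-∸ A x y k) ⟩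
  (A ∸ y) * ((A ∸ x) * (A ∸ y) ^ k)            ≡⟨ lem (A ∸ y) (A ∸ x) ((A ∸ y) ^ k) ⟩
  (A ∸ x) * ((A ∸ y) * (A ∸ y) ^ k)            ∎
  where
  open ≤-Reasoning
  lem : ∀ a b c → a * (b * c) ≡ b * (a * c)
  lem = solve-∀

^-square-swap : ∀ a k e → (a ^ (k + k)) ^ e ≡ ((a * a) ^ e) ^ k
^-square-swap a k e = begin
  (a ^ (k + k)) ^ e        ≡⟨ cong (_^ e) (trans (^-distribˡ-+-* a k k) (sym (^-distribʳ-* k a a))) ⟩
  ((a * a) ^ k) ^ e        ≡⟨ ^-*-assoc (a * a) k e ⟩
  (a * a) ^ (k * e)        ≡⟨ cong ((a * a) ^_) (*-comm k e) ⟩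
  (a * a) ^ (e * k)        ≡⟨ sym (^-*-assoc (a * a) e k) ⟩
  ((a * a) ^ e) ^ k        ∎
  where open ≡-Reasoning

1≤^ : ∀ {a} k → 1 ≤ a → 1 ≤ a ^ k
1≤^ {a} k h = ≤-trans (≤-reflexive (sym (^-zeroˡ k))) (^-monoˡ-≤ k h)

-- miss and nochild say (1 - 1/n)^2e ≤ 15/100 and (1 - 9/25n)^2e ≤ 50/100 for e close to n
-- (limits e^-2 and e^-0.72); hit says 1 - (1 - 1/D)^n ≤ 16/25 for D close to n (limit 1 - 1/e).
record Regime (n m : ℕ) : Set where
  field
    room    : 4 * m + 5 ≤ n
    hit     : ∀ d → n ≤ suc d + (m + m + 2) → covered d n * 25 ≤ 16 * suc d ^ n
    miss    : ∀ e → n ≤ e + (4 * m + 3) → ((25 * n ∸ 25) * (25 * n ∸ 25)) ^ e * 100 ≤ 15 * (25 * n * (25 * n)) ^ e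
    nochild : ∀ e → n ≤ e + (4 * m + 3) → ((25 * n ∸ 9) * (25 * n ∸ 9)) ^ e * 100 ≤ 50 * (25 * n * (25 * n)) ^ e

module Bound {n m : ℕ} (regime : Regime n m) where
  open Regime regime
  open ≤-Reasoning
  private
    A = 25 * n
    1≤n : 1 ≤ n
    1≤n = ≤-trans (≤-trans (s≤s z≤n) (m≤n+m 5 (4 * m))) room

  -- ζ and κ count the indices with recorded leaves and the used indices without any; each index
  -- stands for two vertices, hence the doubling and the squares in `miss` and `nochild`. A leaf
  -- takes 25/25 of a value from every free coordinate, a vertex of K takes 9/25. The final `+ 0`
  -- lets `bernoulli-∸` be applied first to the leaves and then, with x = 0, to K.
  weight-bound : ∀ ζ κ e M → n ≤ e + (4 * m + 3) →
    M ≤ A ∸ ((ζ + ζ) * 25 + ((κ + κ) * 9 + 0)) → M ^ e * 100 ^ (ζ + κ) ≤ A ^ e * (15 ^ ζ * 50 ^ κ)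
  weight-bound ζ κ e M near M≤ = *-cancelʳ-≤ _ _ (B ^ (ζ + κ)) {{>-nonZero (1≤^ (ζ + κ) (1≤^ e (*-mono-≤ 1≤A 1≤A)))}} (begin
    M ^ e * 100 ^ (ζ + κ) * B ^ (ζ + κ)
      ≡⟨ trans (cong₂ (λ x y → M ^ e * x * y) (^-distribˡ-+-* 100 ζ κ) (^-distribˡ-+-* B ζ κ)) (lem₁ (M ^ e) (100 ^ ζ) (100 ^ κ) (B ^ ζ) (B ^ κ)) ⟩
    (M ^ e * B ^ ζ * B ^ κ) * (100 ^ ζ * 100 ^ κ)
      ≤⟨ *-monoˡ-≤ (100 ^ ζ * 100 ^ κ) powered ⟩
    (A ^ e * a ^ ζ * b ^ κ) * (100 ^ ζ * 100 ^ κ)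
      ≡⟨ trans (lem₂ (A ^ e) (a ^ ζ) (b ^ κ) (100 ^ ζ) (100 ^ κ)) (cong₂ (λ x y → A ^ e * x * y) (sym (^-distribʳ-* ζ a 100)) (sym (^-distribʳ-* κ b 100))) ⟩
    A ^ e * (a * 100) ^ ζ * (b * 100) ^ κ
      ≤⟨ *-mono-≤ (*-monoʳ-≤ (A ^ e) (^-monoˡ-≤ ζ (miss e near))) (^-monoˡ-≤ κ (nochild e near)) ⟩
    A ^ e * (15 * B) ^ ζ * (50 * B) ^ κ
      ≡⟨ trans (cong₂ (λ x y → A ^ e * x * y) (^-distribʳ-* ζ 15 B) (^-distribʳ-* κ 50 B)) (lem₃ (A ^ e) (15 ^ ζ) (50 ^ κ) (B ^ ζ) (B ^ κ)) ⟩
    A ^ e * (15 ^ ζ * 50 ^ κ) * (B ^ ζ * B ^ κ)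
      ≡⟨ cong (A ^ e * (15 ^ ζ * 50 ^ κ) *_) (sym (^-distribˡ-+-* B ζ κ)) ⟩
    A ^ e * (15 ^ ζ * 50 ^ κ) * B ^ (ζ + κ) ∎)
    where
    1≤A : 1 ≤ A
    1≤A = *-mono-≤ {1} {25} (s≤s z≤n) 1≤n
    a = ((A ∸ 25) * (A ∸ 25)) ^ e
    b = ((A ∸ 9) * (A ∸ 9)) ^ e
    B = (A * A) ^ e
    lem₁ : ∀ x a b c d → x * (a * b) * (c * d) ≡ (x * c * d) * (a * b)
    lem₁ = solve-∀
    lem₂ : ∀ x a b c d → (x * a * b) * (c * d) ≡ x * (a * c) * (b * d)
    lem₂ = solve-∀
    lem₃ : ∀ x a b c d → x * (a * c) * (b * d) ≡ x * (a * b) * (c * d)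
    lem₃ = solve-∀
    base : M * A ^ (ζ + ζ) * A ^ (κ + κ) ≤ A * (A ∸ 25) ^ (ζ + ζ) * (A ∸ 9) ^ (κ + κ)
    base = begin
      M * A ^ (ζ + ζ) * A ^ (κ + κ)
        ≤⟨ *-monoˡ-≤ (A ^ (κ + κ)) (*-monoˡ-≤ (A ^ (ζ + ζ)) M≤) ⟩
      (A ∸ ((ζ + ζ) * 25 + ((κ + κ) * 9 + 0))) * A ^ (ζ + ζ) * A ^ (κ + κ)
        ≤⟨ *-monoˡ-≤ (A ^ (κ + κ)) (bernoulli-∸ A ((κ + κ) * 9 + 0) 25 (ζ + ζ)) ⟩
      (A ∸ ((κ + κ) * 9 + 0)) * (A ∸ 25) ^ (ζ + ζ) * A ^ (κ + κ)
        ≡⟨ lem₄ (A ∸ ((κ + κ) * 9 + 0)) _ _ ⟩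
      (A ∸ ((κ + κ) * 9 + 0)) * A ^ (κ + κ) * (A ∸ 25) ^ (ζ + ζ)
        ≤⟨ *-monoˡ-≤ ((A ∸ 25) ^ (ζ + ζ)) (bernoulli-∸ A 0 9 (κ + κ)) ⟩
      A * (A ∸ 9) ^ (κ + κ) * (A ∸ 25) ^ (ζ + ζ)
        ≡⟨ lem₄ A _ _ ⟩
      A * (A ∸ 25) ^ (ζ + ζ) * (A ∸ 9) ^ (κ + κ) ∎
      where
      lem₄ : ∀ a b c → a * b * c ≡ a * c * b
      lem₄ = solve-∀
    ^e : ∀ x a k b l → (x * a ^ (k + k) * b ^ (l + l)) ^ e ≡ x ^ e * ((a * a) ^ e) ^ k * ((b * b) ^ e) ^ l
    ^e x a k b l = trans (^-distribʳ-* e (x * a ^ (k + k)) _)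
      (cong₂ _*_ (trans (^-distribʳ-* e x _) (cong (x ^ e *_) (^-square-swap a k e))) (^-square-swap b l e))
    powered : M ^ e * B ^ ζ * B ^ κ ≤ A ^ e * a ^ ζ * b ^ κ
    powered = subst₂ _≤_ (^e M A ζ A κ) (^e A (A ∸ 25) ζ (A ∸ 9) κ) (^-monoˡ-≤ e base)

  private
    V = Fin n
  open DecMem (_≟_ {n}) using (_∈?_)

  justs : ∀ {k} → Vec (Maybe (V × V)) k → ℕ
  justs []            = 0
  justs (just _ ∷ C)  = suc (justs C)
  justs (nothing ∷ C) = justs C

  nothings : ∀ {k} → List V → Vec V k → Vec V k → Vec (Maybe (V × V)) k → ℕ
  nothings E []       []       []            = 0
  nothings E (p ∷ ps) (q ∷ qs) (just _ ∷ C)  = nothings E ps qs C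
  nothings E (p ∷ ps) (q ∷ qs) (nothing ∷ C) = (if does (used? E p q) then 1 else 0) + nothings E ps qs C

  -- The factor of one index multiplied by 100 n²: 15/100 divided by n² for a given pair of leaves,
  -- whose two values are prescribed, 50/100 for a used index without leaves, and 1 for an excluded
  -- index.
  entryWeight : List V → V → V → Maybe (V × V) → ℕ
  entryWeight E p q (just _) = 15
  entryWeight E p q nothing  = n * n * (if does (used? E p q) then 50 else 100)

  certWeight : ∀ {k} → List V → Vec V k → Vec V k → Vec (Maybe (V × V)) k → ℕ
  certWeight E P Q C = ∏ (λ i → entryWeight E (lookup P i) (lookup Q i) (lookup C i))

  length-leaves : ∀ {k} (ps qs : Vec V k) C → length (leaves ps qs C) ≡ justs C + justs C
  length-leaves []       []       []            = refl
  length-leaves (p ∷ ps) (q ∷ qs) (nothing ∷ C) = length-leaves ps qs C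
  length-leaves (p ∷ ps) (q ∷ qs) (just _ ∷ C)  = cong suc (trans (cong suc (length-leaves ps qs C)) (sym (+-suc (justs C) (justs C))))

  length-leafless : ∀ {k} E (ps qs : Vec V k) C → length (leafless E ps qs C) ≡ nothings E ps qs C + nothings E ps qs C
  length-leafless E []       []       []            = refl
  length-leafless E (p ∷ ps) (q ∷ qs) (just _ ∷ C)  = length-leafless E ps qs C
  length-leafless E (p ∷ ps) (q ∷ qs) (nothing ∷ C) with does (used? E p q)
  ... | true  = cong suc (trans (cong suc (length-leafless E ps qs C)) (sym (+-suc (nothings E ps qs C) _)))
  ... | false = length-leafless E ps qs C

  justs+nothings≤ : ∀ {k} E (ps qs : Vec V k) C → justs C + nothings E ps qs C ≤ k
  justs+nothings≤ E []       []       []            = z≤n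
  justs+nothings≤ E (p ∷ ps) (q ∷ qs) (just _ ∷ C)  = s≤s (justs+nothings≤ E ps qs C)
  justs+nothings≤ E (p ∷ ps) (q ∷ qs) (nothing ∷ C) with does (used? E p q)
  ... | true  = ≤-trans (≤-reflexive (+-suc (justs C) _)) (s≤s (justs+nothings≤ E ps qs C))
  ... | false = ≤-trans (justs+nothings≤ E ps qs C) (n≤1+n _)

  certWeight-power : ∀ {k} E (ps qs : Vec V k) C →
    15 ^ justs C * 50 ^ nothings E ps qs C * (n * n * 100) ^ k
      ≡ 100 ^ (justs C + nothings E ps qs C) * (n * n) ^ justs C * certWeight E ps qs C
  certWeight-power E []       []       []            = refl
  certWeight-power E (p ∷ ps) (q ∷ qs) (just _ ∷ C)  =
    trans (lem₁ (15 ^ justs C) _ (n * n) _) (trans (cong (n * n * 1500 *_) (certWeight-power E ps qs C)) (lem₂ (n * n) (100 ^ (justs C + nothings E ps qs C)) _ _))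
    where
    lem₁ : ∀ a b s c → 15 * a * b * (s * 100 * c) ≡ s * 1500 * (a * b * c)
    lem₁ = solve-∀
    lem₂ : ∀ s a b c → s * 1500 * (a * b * c) ≡ 100 * a * (s * b) * (15 * c)
    lem₂ = solve-∀
  certWeight-power E (p ∷ ps) (q ∷ qs) (nothing ∷ C) with does (used? E p q)
  ... | true  = trans (lem₁ (15 ^ justs C) (50 ^ nothings E ps qs C) (n * n) _)
      (trans (cong (n * n * 5000 *_) (certWeight-power E ps qs C))
      (trans (lem₂ (n * n) (100 ^ (justs C + nothings E ps qs C)) ((n * n) ^ justs C) _)
      (cong (λ x → 100 ^ x * (n * n) ^ justs C * (n * n * 50 * certWeight E ps qs C)) (sym (+-suc (justs C) _)))))
    where
    lem₁ : ∀ a b s c → a * (50 * b) * (s * 100 * c) ≡ s * 5000 * (a * b * c)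
    lem₁ = solve-∀
    lem₂ : ∀ s a b c → s * 5000 * (a * b * c) ≡ 100 * a * b * (s * 50 * c)
    lem₂ = solve-∀
  ... | false = trans (lem₁ (15 ^ justs C) _ (n * n) _) (trans (cong (n * n * 100 *_) (certWeight-power E ps qs C)) (lem₂ (n * n) (100 ^ (justs C + nothings E ps qs C)) _ _))
    where
    lem₁ : ∀ a b s c → a * b * (s * 100 * c) ≡ s * 100 * (a * b * c)
    lem₁ = solve-∀
    lem₂ : ∀ s a b c → s * 100 * (a * b * c) ≡ a * b * (s * 100 * c)
    lem₂ = solve-∀

  module _ (root : V) (s t : ℕ) (P Q : Vec V (suc m)) where

    private
      E = excluded s t P Q

    encodings : Vec (Maybe (V × V)) (suc m) → ℕ
    encodings C = ∑ (allVec (allFin n) n) (λ f → 𝟙 (Code.encodes? root s t P Q C f))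

    -- The power of n on the left accounts for the values prescribed at the root and on the two
    -- paths; those prescribed at the leaves are already in `certWeight`. The 4 comes from the two
    -- exempt tops.
    encodings-bound : ∀ C → encodings C * n ^ (1 + (m + m)) * (n * n * 100) ^ suc m ≤ 4 * n ^ n * certWeight E P Q C
    encodings-bound C with Code.valid? root s t P Q C
    ... | no invalid = subst (λ z → z * n ^ (1 + (m + m)) * (n * n * 100) ^ suc m ≤ 4 * n ^ n * certWeight E P Q C)
            (sym (trans (∑-cong (allVec (allFin n) n) (λ f → 𝟙-no (Code.encodes? root s t P Q C f) (invalid ∘ proj₁))) (∑-zero (allVec (allFin n) n)))) z≤n
    ... | yes (_ , _ , valid) = *-cancelʳ-≤ _ _ Z {{>-nonZero (*-mono-≤ (1≤^ (ζ + κ) (s≤s z≤n)) (1≤^ ζ (*-mono-≤ 1≤n 1≤n)))}} (begin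
        N * n ^ (1 + (m + m)) * (n * n * 100) ^ suc m * Z
          ≡⟨ lem₁ N (n ^ (1 + (m + m))) ((n * n * 100) ^ suc m) (100 ^ (ζ + κ)) ((n * n) ^ ζ) ⟩
        N * 100 ^ (ζ + κ) * (n ^ (1 + (m + m)) * (n * n) ^ ζ) * (n * n * 100) ^ suc m
          ≤⟨ *-monoˡ-≤ ((n * n * 100) ^ suc m) (*-mono-≤ main (≤-reflexive (sym n^Γ))) ⟩
        4 * n ^ e * (15 ^ ζ * 50 ^ κ) * n ^ length Γ * (n * n * 100) ^ suc m
          ≡⟨ lem₂ (n ^ e) (15 ^ ζ) (50 ^ κ) (n ^ length Γ) ((n * n * 100) ^ suc m) ⟩
        4 * (n ^ e * n ^ length Γ) * (15 ^ ζ * 50 ^ κ * (n * n * 100) ^ suc m)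
          ≡⟨ cong₂ (λ x y → 4 * x * y) (trans (sym (^-distribˡ-+-* n e (length Γ))) (cong (n ^_) (m∸n+n≡m Γ≤n))) (certWeight-power E P Q C) ⟩
        4 * n ^ n * (100 ^ (ζ + κ) * (n * n) ^ ζ * W)
          ≡⟨ lem₃ (4 * n ^ n) Z W ⟩
        4 * n ^ n * W * Z ∎)
      where
      open Code root s t P Q C using (Γ; tops; X; K; Encodes; encodes?)
      N = encodings C
      ζ = justs C
      κ = nothings E P Q C
      W = certWeight E P Q C
      Z = 100 ^ (ζ + κ) * (n * n) ^ ζ
      e = n ∸ length Γ
      ζ+κ≤ : ζ + κ ≤ suc m
      ζ+κ≤ = justs+nothings≤ E P Q C
      lengthΓ : length Γ ≡ 1 + (m + m) + (ζ + ζ)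
      lengthΓ = cong suc (trans (length-++ (forcedPath s P)) (trans (cong₂ _+_ (length-forcedPath s P)
        (trans (length-++ (forcedPath t Q)) (cong₂ _+_ (length-forcedPath t Q) (length-leaves P Q C)))) (sym (+-assoc m m (ζ + ζ)))))
      Γ≤ : length Γ ≤ 4 * m + 3
      Γ≤ = begin
        length Γ                          ≡⟨ lengthΓ ⟩
        1 + (m + m) + (ζ + ζ)             ≤⟨ +-monoʳ-≤ (1 + (m + m)) (+-mono-≤ (≤-trans (m≤m+n ζ κ) ζ+κ≤) (≤-trans (m≤m+n ζ κ) ζ+κ≤)) ⟩
        1 + (m + m) + (suc m + suc m)     ≡⟨ lem m ⟩
        4 * m + 3                         ∎
        where
        lem : ∀ m → 1 + (m + m) + ((1 + m) + (1 + m)) ≡ 4 * m + 3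
        lem = solve-∀
      Γ≤n : length Γ ≤ n
      Γ≤n = ≤-trans Γ≤ (≤-trans (+-monoʳ-≤ (4 * m) (s≤s (s≤s (s≤s z≤n)))) room)
      near : n ≤ e + (4 * m + 3)
      near = ≤-trans (≤-reflexive (sym (m∸n+n≡m Γ≤n))) (+-monoʳ-≤ e Γ≤)
      lengthX : length X ≡ ζ + ζ
      lengthX = trans (length-map proj₁ (leaves P Q C)) (length-leaves P Q C)
      lengthK : length K ≡ κ + κ
      lengthK = length-leafless E P Q C
      2ζ+2κ≤ : (ζ + ζ) + (κ + κ) ≤ m + m + 2
      2ζ+2κ≤ = begin
        (ζ + ζ) + (κ + κ)   ≡⟨ +-interchange ζ ζ κ κ ⟩
        (ζ + κ) + (ζ + κ)   ≤⟨ +-mono-≤ ζ+κ≤ ζ+κ≤ ⟩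
        suc m + suc m       ≡⟨ lem m ⟩
        m + m + 2           ∎
        where
        lem : ∀ m → (1 + m) + (1 + m) ≡ m + m + 2
        lem = solve-∀
      d = n ∸ suc ((ζ + ζ) + (κ + κ))
      size₀ : (ζ + ζ) + (κ + κ) + suc d ≡ n
      size₀ = trans (+-suc _ d) (m+[n∸m]≡n (≤-trans (s≤s 2ζ+2κ≤) (begin
        suc (m + m + 2)                       ≤⟨ m≤m+n _ (m + m + 2) ⟩
        suc (m + m + 2) + (m + m + 2)         ≡⟨ lem m ⟩
        4 * m + 5                             ≤⟨ room ⟩
        n                                     ∎)))
        where
        lem : ∀ m → (1 + (m + m + 2)) + (m + m + 2) ≡ 4 * m + 5
        lem = solve-∀
      size : length X + (length K + suc d) ≡ n
      size = trans (cong₂ (λ x y → x + (y + suc d)) lengthX lengthK) (trans (sym (+-assoc (ζ + ζ) (κ + κ) (suc d))) size₀)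
      M = 16 * (κ + κ) + 25 * suc d
      M≤ : M ≤ A ∸ ((ζ + ζ) * 25 + ((κ + κ) * 9 + 0))
      M≤ = m+n≤o⇒m≤o∸n M (≤-reflexive (trans (lem ζ κ (suc d)) (cong (25 *_) size₀)))
        where
        lem : ∀ z k D → 16 * (k + k) + 25 * D + ((z + z) * 25 + ((k + k) * 9 + 0)) ≡ 25 * ((z + z) + (k + k) + D)
        lem = solve-∀
      counted : N * 25 ^ e ≤ M ^ e * 4
      counted = subst (λ k → N * 25 ^ e ≤ (16 * k + 25 * suc d) ^ e * 4) lengthK
        (count-meeting valid d size (hit d (≤-trans (≤-reflexive (sym size₀)) (≤-trans (≤-reflexive (+-comm _ (suc d))) (+-monoʳ-≤ (suc d) 2ζ+2κ≤))))
          encodes? (λ f → proj₂))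
      main : N * 100 ^ (ζ + κ) ≤ 4 * n ^ e * (15 ^ ζ * 50 ^ κ)
      main = *-cancelʳ-≤ _ _ (25 ^ e) {{m^n≢0 25 e}} (begin
        N * 100 ^ (ζ + κ) * 25 ^ e            ≡⟨ lem N (100 ^ (ζ + κ)) (25 ^ e) ⟩
        N * 25 ^ e * 100 ^ (ζ + κ)            ≤⟨ *-monoˡ-≤ (100 ^ (ζ + κ)) counted ⟩
        M ^ e * 4 * 100 ^ (ζ + κ)             ≡⟨ lem (M ^ e) 4 (100 ^ (ζ + κ)) ⟩
        M ^ e * 100 ^ (ζ + κ) * 4             ≤⟨ *-monoˡ-≤ 4 (weight-bound ζ κ e M near M≤) ⟩
        A ^ e * (15 ^ ζ * 50 ^ κ) * 4         ≡⟨ cong (λ x → x * (15 ^ ζ * 50 ^ κ) * 4) (^-distribʳ-* e 25 n) ⟩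
        25 ^ e * n ^ e * (15 ^ ζ * 50 ^ κ) * 4 ≡⟨ lem′ (25 ^ e) (n ^ e) (15 ^ ζ * 50 ^ κ) ⟩
        4 * n ^ e * (15 ^ ζ * 50 ^ κ) * 25 ^ e ∎)
        where
        lem : ∀ a b c → a * b * c ≡ a * c * b
        lem = solve-∀
        lem′ : ∀ a b c → a * b * c * 4 ≡ 4 * b * c * a
        lem′ = solve-∀
      n^Γ : n ^ length Γ ≡ n ^ (1 + (m + m)) * (n * n) ^ ζ
      n^Γ = trans (cong (n ^_) lengthΓ) (trans (^-distribˡ-+-* n (1 + (m + m)) (ζ + ζ))
              (cong (n ^ (1 + (m + m)) *_) (trans (^-distribˡ-+-* n ζ ζ) (sym (^-distribʳ-* ζ n n)))))
      lem₁ : ∀ N a b c d → N * a * b * (c * d) ≡ N * c * (a * d) * b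
      lem₁ = solve-∀
      lem₂ : ∀ a b c d f → 4 * a * (b * c) * d * f ≡ 4 * (a * d) * (b * c * f)
      lem₂ = solve-∀
      lem₃ : ∀ a z w → a * (z * w) ≡ a * w * z
      lem₃ = solve-∀

module Total {n m : ℕ} (regime : Regime n m) where
  open Regime regime
  open Bound regime
  open ≤-Reasoning
  private
    V = Fin n
    1≤n : 1 ≤ n
    1≤n = ≤-trans (≤-trans (s≤s z≤n) (m≤n+m 5 (4 * m))) room
  open DecMem (_≟_ {n}) using (_∈?_)
  open DecUnique (_≟_ {n}) using (unique?)

  pairs : List (V × V)
  pairs = cartesianProduct (allFin n) (allFin n)

  length-pairs : length pairs ≡ n * n
  length-pairs = trans (length-∑ pairs) (trans (∑-cartesianProductWith _,_ (allFin n) (allFin n) (λ _ → 1))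
    (trans (∑-cong (allFin n) (λ _ → trans (sym (length-∑ (allFin n))) (length-allFin n)))
    (trans (∑-const (allFin n) n) (cong (_* n) (length-allFin n)))))

  bits : List (Maybe (V × V))
  bits = nothing ∷ map just pairs

  ∈-bits : ∀ b → b ∈ bits
  ∈-bits nothing        = here refl
  ∈-bits (just (x , y)) = there (∈-map⁺ just (∈-cartesianProduct⁺ (∈-allFin x) (∈-allFin y)))

  penalty : List V → V → V → ℕ
  penalty E p q = if does (used? E p q) then 1 else 2

  -- All n² pairs of leaves together contribute 15, so a used index has 15 + 50 = 65 and any other
  -- has 15 + 100 ≤ 2 · 65.
  ∑-entryWeight : ∀ E p q → ∑ bits (entryWeight E p q) ≤ n * n * 65 * penalty E p q
  ∑-entryWeight E p q = ≤-trans (≤-reflexive (cong (entryWeight E p q nothing +_) justs-total)) (merge (does (used? E p q)))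
    where
    justs-total : ∑ (map just pairs) (entryWeight E p q) ≡ n * n * 15
    justs-total = trans (∑-map just pairs _) (trans (∑-const pairs 15) (cong (_* 15) length-pairs))
    merge : ∀ b → n * n * (if b then 50 else 100) + n * n * 15 ≤ n * n * 65 * (if b then 1 else 2)
    merge true  = ≤-reflexive (lem (n * n))
      where
      lem : ∀ x → x * 50 + x * 15 ≡ x * 65 * 1
      lem = solve-∀
    merge false = ≤-trans (m≤m+n _ (n * n * 15)) (≤-reflexive (lem (n * n)))
      where
      lem : ∀ x → x * 100 + x * 15 + x * 15 ≡ x * 65 * 2
      lem = solve-∀

  in-excluded : ∀ {k} → List V → Vec V k → ℕ
  in-excluded E P = length (filter (_∈? E) (toList P))

  ∏-penalty : ∀ {k} E (P Q : Vec V k) → ∏ (λ i → penalty E (lookup P i) (lookup Q i)) ≤ 2 ^ in-excluded E P * 2 ^ in-excluded E Q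
  ∏-penalty E []       []       = ≤-refl
  ∏-penalty E (p ∷ ps) (q ∷ qs) with p ∈? E | q ∈? E
  ... | no _  | no _  = ≤-trans (≤-reflexive (*-identityˡ _)) (∏-penalty E ps qs)
  ... | yes _ | no _  = ≤-trans (*-monoʳ-≤ 2 (∏-penalty E ps qs)) (≤-reflexive (sym (*-assoc 2 (2 ^ in-excluded E ps) _)))
  ... | no _  | yes _ = ≤-trans (*-monoʳ-≤ 2 (∏-penalty E ps qs)) (≤-reflexive (lem (2 ^ in-excluded E ps) _))
    where
    lem : ∀ a b → 2 * (a * b) ≡ a * (2 * b)
    lem = solve-∀
  ... | yes _ | yes _ = ≤-trans (*-monoʳ-≤ 2 (∏-penalty E ps qs)) (≤-trans (m≤m+n _ _) (≤-reflexive (lem (2 ^ in-excluded E ps) (2 ^ in-excluded E qs))))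
    where
    lem : ∀ a b → 2 * (a * b) + 2 * (a * b) ≡ 2 * a * (2 * b)
    lem = solve-∀

  in-excluded-≤ : ∀ {k} E (P : Vec V k) → Unique (toList P) → in-excluded E P ≤ length E
  in-excluded-≤ E P u = unique-⊆⇒length≤ (Uniqueₚ.filter⁺ (_∈? E) u) (λ v∈ → proj₂ (∈-filter⁻ (_∈? E) {xs = toList P} v∈))

  module _ (root : V) where

    certificates : List (Vec (Maybe (V × V)) (suc m))
    certificates = allVec bits (suc m)

    no-encodings : ∀ s t P Q → (∀ C f → ¬ Code.Encodes root s t P Q C f) → ∑ certificates (encodings root s t P Q) ≡ 0
    no-encodings s t P Q none = trans (∑-cong certificates (λ C →
      trans (∑-cong (allVec (allFin n) n) (λ f → 𝟙-no (Code.encodes? root s t P Q C f) (none C f))) (∑-zero (allVec (allFin n) n))))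
      (∑-zero certificates)

    -- A sequence of distinct vertices meets the six excluded ones at most six times. The penalties
    -- of P and Q thus multiply to at most 2^12 = 4096, and 4 · 4096 = 16384.
    pathPair-bound-unique : ∀ s t P Q → Unique (toList P) → Unique (toList Q) →
      ∑ certificates (encodings root s t P Q) * n ^ (1 + (m + m)) * 100 ^ suc m ≤ 16384 * n ^ n * 65 ^ suc m
    pathPair-bound-unique s t P Q uP uQ = *-cancelʳ-≤ _ _ Z {{>-nonZero (1≤^ (suc m) (*-mono-≤ 1≤n 1≤n))}} (begin
      S * n ^ (1 + (m + m)) * 100 ^ suc m * Z
        ≡⟨ trans (lem₁ S (n ^ (1 + (m + m))) (100 ^ suc m) Z) (cong (S * n ^ (1 + (m + m)) *_) (sym (^-distribʳ-* (suc m) (n * n) 100))) ⟩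
      S * n ^ (1 + (m + m)) * (n * n * 100) ^ suc m
        ≡⟨ trans (*-assoc S _ _) (sym (∑-*ʳ certificates c (encodings root s t P Q))) ⟩
      ∑ certificates (λ C → encodings root s t P Q C * c)
        ≤⟨ ∑-mono certificates (λ C → ≤-trans (≤-reflexive (sym (*-assoc (encodings root s t P Q C) (n ^ (1 + (m + m))) _))) (encodings-bound root s t P Q C)) ⟩
      ∑ certificates (λ C → 4 * n ^ n * certWeight E P Q C)
        ≡⟨ trans (∑-*ˡ certificates (4 * n ^ n) (certWeight E P Q)) (cong (4 * n ^ n *_) (∏-∑ bits (suc m) (λ i → entryWeight E (lookup P i) (lookup Q i)))) ⟩
      4 * n ^ n * ∏ {suc m} (λ i → ∑ bits (entryWeight E (lookup P i) (lookup Q i)))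
        ≤⟨ *-monoʳ-≤ (4 * n ^ n) (∏-mono (λ i → ∑-entryWeight E (lookup P i) (lookup Q i))) ⟩
      4 * n ^ n * ∏ {suc m} (λ i → n * n * 65 * penalty E (lookup P i) (lookup Q i))
        ≡⟨ cong (4 * n ^ n *_) (trans (∏-* {suc m} (λ _ → n * n * 65) (λ i → penalty E (lookup P i) (lookup Q i)))
              (cong (_* ∏ {suc m} (λ i → penalty E (lookup P i) (lookup Q i))) (∏-const (suc m) (n * n * 65)))) ⟩
      4 * n ^ n * ((n * n * 65) ^ suc m * ∏ {suc m} (λ i → penalty E (lookup P i) (lookup Q i)))
        ≤⟨ *-monoʳ-≤ (4 * n ^ n) (*-monoʳ-≤ ((n * n * 65) ^ suc m) (≤-trans (∏-penalty E P Q)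
             (*-mono-≤ (^-monoʳ-≤ 2 (in-excluded-≤ E P uP)) (^-monoʳ-≤ 2 (in-excluded-≤ E Q uQ))))) ⟩
      4 * n ^ n * ((n * n * 65) ^ suc m * 4096)
        ≡⟨ trans (cong (λ x → 4 * n ^ n * (x * 4096)) (^-distribʳ-* (suc m) (n * n) 65)) (lem₂ (n ^ n) Z (65 ^ suc m)) ⟩
      16384 * n ^ n * 65 ^ suc m * Z ∎)
      where
      E = excluded s t P Q
      S = ∑ certificates (encodings root s t P Q)
      Z = (n * n) ^ suc m
      c = n ^ (1 + (m + m)) * (n * n * 100) ^ suc m
      lem₁ : ∀ s a b z → s * a * b * z ≡ s * a * (z * b)
      lem₁ = solve-∀
      lem₂ : ∀ a z b → 4 * a * (z * b * 4096) ≡ 16384 * a * b * z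
      lem₂ = solve-∀

    -- Codes include the distinctness of the vertices of P and of Q, so any other pair of sequences
    -- contributes 0.
    pathPair-bound : ∀ s t P Q → ∑ certificates (encodings root s t P Q) * n ^ (1 + (m + m)) * 100 ^ suc m ≤ 16384 * n ^ n * 65 ^ suc m
    pathPair-bound s t P Q = go (unique? (toList P)) (unique? (toList Q))
      where
      Goal : ℕ → Set
      Goal z = z * n ^ (1 + (m + m)) * 100 ^ suc m ≤ 16384 * n ^ n * 65 ^ suc m
      go : Dec (Unique (toList P)) → Dec (Unique (toList Q)) → Goal (∑ certificates (encodings root s t P Q))
      go (no ¬u) _ = subst Goal (sym (no-encodings s t P Q (λ C f e → ¬u (proj₁ (proj₁ e))))) z≤n
      go _ (no ¬u) = subst Goal (sym (no-encodings s t P Q (λ C f e → ¬u (proj₁ (proj₂ (proj₁ e)))))) z≤n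
      go (yes uP) (yes uQ) = pathPair-bound-unique s t P Q uP uQ

    CodeType : Set
    CodeType = ℕ × ℕ × Vec V (suc m) × Vec V (suc m) × Vec (Maybe (V × V)) (suc m) × Vec V n

    paths : List (Vec V (suc m))
    paths = allVec (allFin n) (suc m)

    length-paths : length paths ≡ n ^ suc m
    length-paths = trans (length-allVec (allFin n) (suc m)) (cong (_^ suc m) (length-allFin n))

    parentMaps : List (Vec V n)
    parentMaps = allVec (allFin n) n

    indices : List ℕ
    indices = upTo (suc m)

    tails₁ = cartesianProduct certificates parentMaps
    tails₂ = cartesianProduct paths tails₁
    tails₃ = cartesianProduct paths tails₂
    tails₄ = cartesianProduct indices tails₃

    codes : List CodeType
    codes = cartesianProduct indices tails₄

    IsCode : CodeType → Set
    IsCode (s , t , P , Q , C , f) = Code.Encodes root s t P Q C f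

    isCode? : ∀ c → Dec (IsCode c)
    isCode? (s , t , P , Q , C , f) = Code.encodes? root s t P Q C f

    total₁ : ℕ → ℕ → Vec V (suc m) → Vec V (suc m) → ℕ
    total₁ s t P Q = ∑ certificates (encodings root s t P Q)
    total₂ : ℕ → ℕ → Vec V (suc m) → ℕ
    total₂ s t P = ∑ paths (total₁ s t P)
    total₃ : ℕ → ℕ → ℕ
    total₃ s t = ∑ paths (total₂ s t)
    total₄ : ℕ → ℕ
    total₄ s = ∑ indices (total₃ s)

    ∑-codes : ∑ codes (λ c → 𝟙 (isCode? c)) ≡ ∑ indices total₄
    ∑-codes =
      trans (∑-cartesianProductWith _,_ indices tails₄ (λ c → 𝟙 (isCode? c))) (∑-cong indices λ s →
      trans (∑-cartesianProductWith _,_ indices tails₃ (λ c → 𝟙 (isCode? (s , c)))) (∑-cong indices λ t →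
      trans (∑-cartesianProductWith _,_ paths tails₂ (λ c → 𝟙 (isCode? (s , t , c)))) (∑-cong paths λ P →
      trans (∑-cartesianProductWith _,_ paths tails₁ (λ c → 𝟙 (isCode? (s , t , P , c)))) (∑-cong paths λ Q →
      ∑-cartesianProductWith _,_ certificates parentMaps (λ c → 𝟙 (isCode? (s , t , P , Q , c)))))))

    ∑-*ʳ-bound : ∀ {A : Set} (xs : List A) (f : A → ℕ) c b → (∀ x → f x * c ≤ b) → ∑ xs f * c ≤ length xs * b
    ∑-*ʳ-bound xs f c b h = ≤-trans (≤-reflexive (sym (∑-*ʳ xs c f))) (∑-bound xs h)

    codes-bound : ∑ codes (λ c → 𝟙 (isCode? c)) * (n ^ (1 + (m + m)) * 100 ^ suc m)
                  ≤ suc m * (suc m * (n ^ suc m * (n ^ suc m * (16384 * n ^ n * 65 ^ suc m))))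
    codes-bound = ≤-trans (≤-reflexive (cong (_* c) ∑-codes))
      (subst₂ (λ a b → ∑ indices total₄ * c ≤ a * (a * (b * (b * B)))) (length-upTo (suc m)) length-paths
        (∑-*ʳ-bound indices total₄ c _ λ s → ∑-*ʳ-bound indices (total₃ s) c _ λ t →
         ∑-*ʳ-bound paths (total₂ s t) c _ λ P → ∑-*ʳ-bound paths (total₁ s t P) c _ λ Q →
          ≤-trans (≤-reflexive (sym (*-assoc (total₁ s t P Q) (n ^ (1 + (m + m))) (100 ^ suc m)))) (pathPair-bound s t P Q)))
      where
      c = n ^ (1 + (m + m)) * 100 ^ suc m
      B = 16384 * n ^ n * 65 ^ suc m

-- With r the length of the paths, n^(2r+2) pairs of sequences and 2r + 1 prescribed values give
-- n^(n+1). The square counts the positions of the two tops, and the exponent r + 1 is the number of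
-- indices of a check.
bad-bound : ∀ {n m} → Regime (suc n) (suc m) → ∀ {bad : List (Graph (suc n))} →
  Enumerates bad (λ T → IsTree T × BadTree (suc m) T) →
  length bad * 100 ^ suc (suc m) ≤ suc (suc m) * suc (suc m) * 16384 * (suc n * suc n ^ suc n) * 65 ^ suc (suc m)
bad-bound {n′} {m′} regime {bad} (bad! , spec) =
  *-cancelʳ-≤ _ _ Z {{m^n≢0 n (1 + (m + m))}} (begin
    length bad * 100 ^ suc m * Z
      ≡⟨ lem₁ (length bad) (100 ^ suc m) Z ⟩
    length bad * (Z * 100 ^ suc m)
      ≤⟨ *-monoˡ-≤ (Z * 100 ^ suc m) (cover (isCode? root) decode (codes root) bad! covered′) ⟩
    ∑ (codes root) (λ c → 𝟙 (isCode? root c)) * (Z * 100 ^ suc m)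
      ≤⟨ codes-bound root ⟩
    suc m * (suc m * (n ^ suc m * (n ^ suc m * (16384 * n ^ n * 65 ^ suc m))))
      ≡⟨ lem₂ (suc m) (n ^ suc m) (n ^ n) (65 ^ suc m) ⟩
    suc m * suc m * 16384 * (n ^ suc m * n ^ suc m * n ^ n) * 65 ^ suc m
      ≡⟨ cong (λ x → suc m * suc m * 16384 * x * 65 ^ suc m) powers ⟩
    suc m * suc m * 16384 * (n * n ^ n * Z) * 65 ^ suc m
      ≡⟨ lem₃ (suc m * suc m * 16384) (n * n ^ n) Z (65 ^ suc m) ⟩
    suc m * suc m * 16384 * (n * n ^ n) * 65 ^ suc m * Z ∎)
  where
  open ≤-Reasoning
  open Total regime
  n = suc n′
  m = suc m′
  root : Fin n
  root = zero
  Z = n ^ (1 + (m + m))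
  decode : CodeType root → Graph n
  decode (_ , _ , _ , _ , _ , f) = parentGraph f
  covered′ : ∀ {G} → G ∈ bad → ∃[ c ] (c ∈ codes root × IsCode root c × decode c ≡ G)
  covered′ {G} G∈ =
    let tree , isBad = Equivalence.to (spec G) G∈
        s , t , P , Q , C , f , s≤ , t≤ , enc , eq = badTree-encoding root tree isBad
    in (s , t , P , Q , C , f) ,
       ∈-cartesianProduct⁺ (∈-upTo⁺ (s≤s s≤)) (∈-cartesianProduct⁺ (∈-upTo⁺ (s≤s t≤))
         (∈-cartesianProduct⁺ (∈-allVec ∈-allFin P) (∈-cartesianProduct⁺ (∈-allVec ∈-allFin Q)
           (∈-cartesianProduct⁺ (∈-allVec ∈-bits C) (∈-allVec ∈-allFin f))))) ,
       enc , eq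
  powers : n ^ suc m * n ^ suc m * n ^ n ≡ n * n ^ n * Z
  powers = trans (lem n (n ^ m) (n ^ n)) (cong (λ x → n * n ^ n * (n * x)) (sym (^-distribˡ-+-* n m m)))
    where
    lem : ∀ n a b → n * a * (n * a) * b ≡ n * b * (n * (a * a))
    lem = solve-∀
  lem₁ : ∀ a b c → a * b * c ≡ a * (c * b)
  lem₁ = solve-∀
  lem₂ : ∀ a b c d → a * (a * (b * (b * (16384 * c * d)))) ≡ a * a * 16384 * (b * b * c) * d
  lem₂ = solve-∀
  lem₃ : ∀ a b c d → a * (b * c) * d ≡ a * b * d * c
  lem₃ = solve-∀

open ≤-Reasoning

-- Numerical estimates

^-cancelˡ-≤ : ∀ k .{{_ : NonZero k}} a b → a ^ k ≤ b ^ k → a ≤ b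
^-cancelˡ-≤ k a b le with a ≤? b
... | yes p = p
... | no ≰  = ⊥-elim (<⇒≱ (^-monoˡ-< k (≰⇒> ≰)) le)

extend-exponent : ∀ {x A a b} L e → x ≤ A → L ≤ e → x ^ L * a ≤ b * A ^ L → x ^ e * a ≤ b * A ^ e
extend-exponent {x} {A} {a} {b} L e x≤A L≤e h = begin
  x ^ e * a                       ≡⟨ cong (λ z → x ^ z * a) (sym (m+[n∸m]≡n L≤e)) ⟩
  x ^ (L + (e ∸ L)) * a           ≡⟨ cong (_* a) (^-distribˡ-+-* x L (e ∸ L)) ⟩
  x ^ L * x ^ (e ∸ L) * a         ≡⟨ lem (x ^ L) (x ^ (e ∸ L)) a ⟩
  x ^ L * a * x ^ (e ∸ L)         ≤⟨ *-mono-≤ h (^-monoˡ-≤ (e ∸ L) x≤A) ⟩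
  b * A ^ L * A ^ (e ∸ L)         ≡⟨ *-assoc b _ _ ⟩
  b * (A ^ L * A ^ (e ∸ L))       ≡⟨ cong (b *_) (sym (^-distribˡ-+-* A L (e ∸ L))) ⟩
  b * A ^ (L + (e ∸ L))           ≡⟨ cong (λ z → b * A ^ z) (m+[n∸m]≡n L≤e) ⟩
  b * A ^ e                       ∎
  where
  lem : ∀ a b c → a * b * c ≡ a * c * b
  lem = solve-∀

-- One block of k + 1 factors: (1 - y/A)^(k+1) ≤ 1/(1 + u/c) as soon as (k+1)y/A ≥ u/c, with A = x +
-- y. This is Bernoulli's inequality read from x up to A.
block : ∀ x y k c u → 1 ≤ x + y → (x + y) * u ≤ suc k * y * c → x ^ suc k * (c + u) ≤ c * (x + y) ^ suc k
block x y k c u pos h = *-cancelˡ-≤ A {{>-nonZero pos}} (begin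
  A * (x ^ suc k * (c + u))                       ≡⟨ lem₁ A (x ^ suc k) c u ⟩
  A * x ^ suc k * c + x ^ suc k * (A * u)         ≤⟨ +-monoʳ-≤ (A * x ^ suc k * c) (*-monoʳ-≤ (x ^ suc k) h) ⟩
  A * x ^ suc k * c + x ^ suc k * (suc k * y * c) ≡⟨ lem₂ A x (x ^ k) c (suc k) y ⟩
  c * (A * x ^ suc k + x * (suc k * (x ^ k * y))) ≤⟨ *-monoʳ-≤ c (+-monoʳ-≤ (A * x ^ suc k) (*-monoˡ-≤ (suc k * (x ^ k * y)) (m≤m+n x y))) ⟩
  c * (A * x ^ suc k + A * (suc k * (x ^ k * y))) ≡⟨ lem₃ c A (x ^ suc k) (suc k * (x ^ k * y)) ⟩
  A * (c * (x ^ suc k + suc k * (x ^ k * y)))     ≤⟨ *-monoʳ-≤ A (*-monoʳ-≤ c (bernoulli-+ x y k)) ⟩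
  A * (c * A ^ suc k)                             ∎)
  where
  A = x + y
  lem₁ : ∀ A p c u → A * (p * (c + u)) ≡ A * p * c + p * (A * u)
  lem₁ = solve-∀
  lem₂ : ∀ A x p c s y → A * (x * p) * c + x * p * (s * y * c) ≡ c * (A * (x * p) + x * (s * (p * y)))
  lem₂ = solve-∀
  lem₃ : ∀ c A p r → c * (A * p + A * r) ≡ A * (c * (p + r))
  lem₃ = solve-∀

power-bound : ∀ x A q L c a → x ^ q * a ≤ c * A ^ q → x ^ (q * L) * a ^ L ≤ c ^ L * A ^ (q * L)
power-bound x A q L c a h = begin
  x ^ (q * L) * a ^ L     ≡⟨ cong (_* a ^ L) (sym (^-*-assoc x q L)) ⟩
  (x ^ q) ^ L * a ^ L     ≡⟨ sym (^-distribʳ-* L (x ^ q) a) ⟩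
  (x ^ q * a) ^ L         ≤⟨ ^-monoˡ-≤ L h ⟩
  (c * A ^ q) ^ L         ≡⟨ ^-distribʳ-* L c (A ^ q) ⟩
  c ^ L * (A ^ q) ^ L     ≡⟨ cong (c ^ L *_) (^-*-assoc A q L) ⟩
  c ^ L * A ^ (q * L)     ∎

square-decay : ∀ x y k c u L e α β → 1 ≤ x + y → (x + y) * u ≤ suc k * y * c → suc k * L ≤ e →
  1 ≤ c + u → c ^ (L + L) * α ≤ β * (c + u) ^ (L + L) →
  (x * x) ^ e * α ≤ β * ((x + y) * (x + y)) ^ e
square-decay x y k c u L e α β pos h Lq≤e 1≤cu const = *-cancelʳ-≤ _ _ K {{>-nonZero (1≤^ (L + L) 1≤cu)}} (begin
  (x * x) ^ e * α * K                ≡⟨ trans (cong (λ z → z * α * K) (sq x)) (lem (x ^ (e + e)) α K) ⟩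
  x ^ (e + e) * K * α                ≤⟨ *-monoˡ-≤ α ext ⟩
  c ^ (L + L) * A ^ (e + e) * α      ≡⟨ lem (c ^ (L + L)) (A ^ (e + e)) α ⟩
  c ^ (L + L) * α * A ^ (e + e)      ≤⟨ *-monoˡ-≤ (A ^ (e + e)) const ⟩
  β * K * A ^ (e + e)                ≡⟨ trans (lem β K (A ^ (e + e))) (cong (λ z → β * z * K) (sym (sq A))) ⟩
  β * (A * A) ^ e * K                ∎)
  where
  A = x + y
  K = (c + u) ^ (L + L)
  sq : ∀ x → (x * x) ^ e ≡ x ^ (e + e)
  sq x = trans (^-distribʳ-* e x x) (sym (^-distribˡ-+-* x e e))
  lem : ∀ a b c → a * b * c ≡ a * c * b
  lem = solve-∀
  ext : x ^ (e + e) * K ≤ c ^ (L + L) * A ^ (e + e)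
  ext = extend-exponent {x} {A} {K} {c ^ (L + L)} (suc k * (L + L)) (e + e) (m≤m+n x y)
    (≤-trans (≤-reflexive (*-distribˡ-+ (suc k) L L)) (+-mono-≤ Lq≤e Lq≤e))
    (power-bound x A (suc k) (L + L) c (c + u) (block x y k c u pos h))

-- 101 blocks, each at least 99/100: (100/99)^101 is about 2.760, while 25/9 is about 2.778.
hit-const : 100 ^ 101 * 9 ≤ 25 * 99 ^ 101
hit-const = ≤ᵇ⇒≤ _ _ tt

-- Twice 97 blocks, each at most 100/101: the product is about 0.145. For `nochild-const` a block is
-- at most 2500/2509, and the product is about 0.498.
miss-const : 100 ^ (97 + 97) * 100 ≤ 15 * (100 + 1) ^ (97 + 97)
miss-const = ≤ᵇ⇒≤ _ _ tt

nochild-const : 2500 ^ (97 + 97) * 100 ≤ 50 * (2500 + 9) ^ (97 + 97)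
nochild-const = ≤ᵇ⇒≤ _ _ tt

-- Here the power of 1 - 1/D is needed from below. The exponent n is therefore rounded up to q L,
-- and a block of q factors is at least 1 - q/D ≥ a/c.
hit-decay : ∀ d n q L c a α β → 1 ≤ c → a * suc d ≤ c * (suc d ∸ q) → n ≤ q * L →
            c ^ L * α ≤ β * a ^ L → suc d ^ n * α ≤ β * d ^ n
hit-decay d n q L c a α β 1≤c aD≤ n≤ const = *-cancelʳ-≤ _ _ (D ^ x * c ^ L) {{>-nonZero (*-mono-≤ (1≤^ x (s≤s z≤n)) (1≤^ L 1≤c))}} (begin
  D ^ n * α * (D ^ x * c ^ L)           ≡⟨ lem₁ (D ^ n) α (D ^ x) (c ^ L) ⟩
  D ^ n * D ^ x * (c ^ L * α)           ≤⟨ *-mono-≤ (≤-reflexive (split D)) const ⟩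
  D ^ (q * L) * (β * a ^ L)             ≡⟨ lem₂ (D ^ (q * L)) (a ^ L) β ⟩
  β * (D ^ (q * L) * a ^ L)             ≤⟨ *-monoʳ-≤ β (power-bound D d q L c a one) ⟩
  β * (c ^ L * d ^ (q * L))             ≡⟨ cong (λ z → β * (c ^ L * z)) (sym (split d)) ⟩
  β * (c ^ L * (d ^ n * d ^ x))         ≤⟨ *-monoʳ-≤ β (*-monoʳ-≤ (c ^ L) (*-monoʳ-≤ (d ^ n) (^-monoˡ-≤ x (n≤1+n d)))) ⟩
  β * (c ^ L * (d ^ n * D ^ x))         ≡⟨ lem₃ (c ^ L) (d ^ n) (D ^ x) β ⟩
  β * d ^ n * (D ^ x * c ^ L)           ∎)
  where
  D = suc d
  x = q * L ∸ n
  split : ∀ y → y ^ n * y ^ x ≡ y ^ (q * L)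
  split y = trans (sym (^-distribˡ-+-* y n x)) (cong (y ^_) (m+[n∸m]≡n n≤))
  lem₁ : ∀ a b c d → a * b * (c * d) ≡ a * c * (d * b)
  lem₁ = solve-∀
  lem₂ : ∀ a b c → a * (c * b) ≡ c * (a * b)
  lem₂ = solve-∀
  lem₃ : ∀ a b c d → d * (a * (b * c)) ≡ d * b * (c * a)
  lem₃ = solve-∀
  one : D ^ q * a ≤ c * d ^ q
  one = *-cancelˡ-≤ D (begin
    D * (D ^ q * a)                         ≡⟨ lem₄ D (D ^ q) a ⟩
    a * D * D ^ q                           ≤⟨ *-monoˡ-≤ (D ^ q) aD≤ ⟩
    c * (D ∸ q) * D ^ q                     ≡⟨ cong (λ z → c * (D ∸ z) * D ^ q) (sym (trans (+-identityʳ (q * 1)) (*-identityʳ q))) ⟩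
    c * (D ∸ (q * 1 + 0)) * D ^ q           ≡⟨ *-assoc c (D ∸ (q * 1 + 0)) (D ^ q) ⟩
    c * ((D ∸ (q * 1 + 0)) * D ^ q)         ≤⟨ *-monoʳ-≤ c (bernoulli-∸ D 0 1 q) ⟩
    c * (D * d ^ q)                         ≡⟨ lem₅ D (d ^ q) c ⟩
    D * (c * d ^ q)                         ∎)
    where
    lem₄ : ∀ D p a → D * (p * a) ≡ a * D * p
    lem₄ = solve-∀
    lem₅ : ∀ D p c → c * (D * p) ≡ D * (c * p)
    lem₅ = solve-∀

covered-ratio : ∀ d n → suc d ^ n * 9 ≤ 25 * d ^ n → covered d n * 25 ≤ 16 * suc d ^ n
covered-ratio d n h = +-cancelʳ-≤ (25 * d ^ n) _ _ (begin
  covered d n * 25 + 25 * d ^ n             ≡⟨ lem₁ (covered d n) (d ^ n) ⟩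
  25 * (covered d n + missed d n)           ≡⟨ cong (25 *_) (covered+missed d n) ⟩
  25 * suc d ^ n                            ≡⟨ lem₂ (suc d ^ n) ⟩
  16 * suc d ^ n + suc d ^ n * 9            ≤⟨ +-monoʳ-≤ (16 * suc d ^ n) h ⟩
  16 * suc d ^ n + 25 * d ^ n               ∎)
  where
  lem₁ : ∀ a b → a * 25 + 25 * b ≡ 25 * (a + b)
  lem₁ = solve-∀
  lem₂ : ∀ a → 25 * a ≡ 16 * a + a * 9
  lem₂ = solve-∀

scaled-bound : ∀ {n m} → 1000 * m ≤ n + 1000 → 1000000000 ≤ n → ∀ a b → 2 * a ≤ 1000 → b ≤ 100000 → a * m + b ≤ n
scaled-bound {n} {m} hm hn a b 2a≤ b≤ = *-cancelˡ-≤ 2000 (begin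
  2000 * (a * m + b)                       ≡⟨ lem₁ a m b ⟩
  2 * a * (1000 * m) + 2000 * b            ≤⟨ +-mono-≤ (*-mono-≤ 2a≤ hm) (*-monoʳ-≤ 2000 b≤) ⟩
  1000 * (n + 1000) + 2000 * 100000        ≡⟨ lem₂ n ⟩
  1000 * n + 201000000                     ≤⟨ +-monoʳ-≤ (1000 * n) (≤-trans (≤-trans (≤ᵇ⇒≤ 201000000 1000000000 tt) hn) (m≤n*m n 1000)) ⟩
  1000 * n + 1000 * n                      ≡⟨ lem₃ n ⟩
  2000 * n                                 ∎)
  where
  lem₁ : ∀ a m b → 2000 * (a * m + b) ≡ 2 * a * (1000 * m) + 2000 * b
  lem₁ = solve-∀
  lem₂ : ∀ n → 1000 * (n + 1000) + 200000000 ≡ 1000 * n + 201000000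
  lem₂ = solve-∀
  lem₃ : ∀ n → 1000 * n + 1000 * n ≡ 2000 * n
  lem₃ = solve-∀

regime : ∀ n m → 1000 * m ≤ suc n + 1000 → 1000000000 ≤ suc n → Regime (suc n) m
regime n′ m hm hn = record { room = room ; hit = hit ; miss = miss ; nochild = nochild }
  where
  n = suc n′
  linear : ∀ a b → 2 * a ≤ 1000 → b ≤ 100000 → a * m + b ≤ n
  linear = scaled-bound hm hn
  room : 4 * m + 5 ≤ n
  room = linear 4 5 (≤ᵇ⇒≤ _ _ tt) (≤ᵇ⇒≤ _ _ tt)
  hit : ∀ d → n ≤ suc d + (m + m + 2) → covered d n * 25 ≤ 16 * suc d ^ n
  hit d near = covered-ratio d n (hit-decay d n q 101 100 99 9 25 (s≤s z≤n) 99D≤ n≤ hit-const)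
    where
    D = suc d
    -- Blocks of about D/100 factors; 101 of them reach n because n - D ≤ 2m + 2 is below n/100.
    q = D / 100
    D≤ : D ≤ 99 + q * 100
    D≤ = ≤-trans (≤-reflexive (m≡m%n+[m/n]*n D 100)) (+-monoˡ-≤ (q * 100) (≤-pred (m%n<n D 100)))
    99D≤ : 99 * D ≤ 100 * (D ∸ q)
    99D≤ = begin
      99 * D                        ≤⟨ m+n≤o⇒m≤o∸n (99 * D) (≤-trans (+-monoʳ-≤ (99 * D) (≤-trans (≤-reflexive (*-comm 100 q)) (m/n*n≤m D 100))) (≤-reflexive (lem₃ D))) ⟩
      100 * D ∸ 100 * q             ≡⟨ sym (*-distribˡ-∸ 100 D q) ⟩
      100 * (D ∸ q)                 ∎
      where
      lem₃ : ∀ D → 99 * D + D ≡ 100 * D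
      lem₃ = solve-∀
    n≤ : n ≤ q * 101
    n≤ = *-cancelˡ-≤ 100 (+-cancelʳ-≤ (202 * m + 10201) _ _ (begin
      100 * n + (202 * m + 10201)                        ≤⟨ +-monoʳ-≤ (100 * n) (linear 202 10201 (≤ᵇ⇒≤ _ _ tt) (≤ᵇ⇒≤ _ _ tt)) ⟩
      100 * n + n                                        ≡⟨ lem₁ n ⟩
      101 * n                                            ≤⟨ *-monoʳ-≤ 101 (≤-trans near (+-monoˡ-≤ (m + m + 2) D≤)) ⟩
      101 * (99 + q * 100 + (m + m + 2))                 ≡⟨ lem₂ q m ⟩
      100 * (q * 101) + (202 * m + 10201)                ∎))
      where
      lem₁ : ∀ n → 100 * n + n ≡ 101 * n
      lem₁ = solve-∀
      lem₂ : ∀ q m → 101 * (99 + q * 100 + (m + m + 2)) ≡ 100 * (q * 101) + (202 * m + 10201)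
      lem₂ = solve-∀
  -- Blocks of k + 1 factors, just over n/100. Taking 97 of them instead of 100 leaves room for the
  -- at most 4m + 3 prescribed coordinates and for rounding.
  k = n / 100
  n≤100q : n ≤ suc k * 100
  n≤100q = ≤-trans (≤-reflexive (m≡m%n+[m/n]*n n 100)) (+-monoˡ-≤ (k * 100) (<⇒≤ (m%n<n n 100)))
  97q≤ : ∀ e → n ≤ e + (4 * m + 3) → suc k * 97 ≤ e
  97q≤ e near = *-cancelˡ-≤ 100 (+-cancelʳ-≤ (400 * m + 10000) _ _ (begin
    100 * (suc k * 97) + (400 * m + 10000)       ≡⟨ lem₁ k m ⟩
    97 * (k * 100) + (400 * m + 19700)           ≤⟨ +-mono-≤ (*-monoʳ-≤ 97 (m/n*n≤m n 100)) (linear 400 19700 (≤ᵇ⇒≤ _ _ tt) (≤ᵇ⇒≤ _ _ tt)) ⟩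
    97 * n + n                                   ≤⟨ m≤m+n _ (2 * n) ⟩
    97 * n + n + 2 * n                           ≡⟨ lem₂ n ⟩
    100 * n                                      ≤⟨ *-monoʳ-≤ 100 near ⟩
    100 * (e + (4 * m + 3))                      ≤⟨ m≤m+n _ 9700 ⟩
    100 * (e + (4 * m + 3)) + 9700               ≡⟨ lem₃ e m ⟩
    100 * e + (400 * m + 10000)                  ∎))
    where
    lem₁ : ∀ k m → 100 * ((1 + k) * 97) + (400 * m + 10000) ≡ 97 * (k * 100) + (400 * m + 19700)
    lem₁ = solve-∀
    lem₂ : ∀ n → 97 * n + n + 2 * n ≡ 100 * n
    lem₂ = solve-∀
    lem₃ : ∀ e m → 100 * (e + (4 * m + 3)) + 9700 ≡ 100 * e + (400 * m + 10000)
    lem₃ = solve-∀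
  1≤25n : 1 ≤ 25 * n
  1≤25n = *-mono-≤ {1} {25} (s≤s z≤n) (s≤s z≤n)
  decay : ∀ y c u α β e → y ≤ 25 * n → 25 * u * 100 ≤ y * c → 1 ≤ c → n ≤ e + (4 * m + 3) →
    c ^ (97 + 97) * α ≤ β * (c + u) ^ (97 + 97) → ((25 * n ∸ y) * (25 * n ∸ y)) ^ e * α ≤ β * (25 * n * (25 * n)) ^ e
  decay y c u α β e y≤ ratio 1≤c near const = subst (λ z → ((25 * n ∸ y) * (25 * n ∸ y)) ^ e * α ≤ β * (z * z) ^ e) (m∸n+n≡m y≤)
    (square-decay (25 * n ∸ y) y k c u 97 e α β
      (subst (1 ≤_) (sym (m∸n+n≡m y≤)) 1≤25n) (subst (λ z → z * u ≤ suc k * y * c) (sym (m∸n+n≡m y≤)) scaled)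
      (97q≤ e near) (≤-trans 1≤c (m≤m+n c u)) const)
    where
    scaled : 25 * n * u ≤ suc k * y * c
    scaled = begin
      25 * n * u                  ≤⟨ *-monoˡ-≤ u (*-monoʳ-≤ 25 n≤100q) ⟩
      25 * (suc k * 100) * u      ≡⟨ lem₁ (suc k) u ⟩
      suc k * (25 * u * 100)      ≤⟨ *-monoʳ-≤ (suc k) ratio ⟩
      suc k * (y * c)             ≡⟨ sym (*-assoc (suc k) y c) ⟩
      suc k * y * c               ∎
      where
      lem₁ : ∀ s u → 25 * (s * 100) * u ≡ s * (25 * u * 100)
      lem₁ = solve-∀
  25≤25n : 25 ≤ 25 * n
  25≤25n = *-monoʳ-≤ 25 {1} {n} (s≤s z≤n)
  miss : ∀ e → n ≤ e + (4 * m + 3) → ((25 * n ∸ 25) * (25 * n ∸ 25)) ^ e * 100 ≤ 15 * (25 * n * (25 * n)) ^ e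
  miss e near = decay 25 100 1 100 15 e 25≤25n (≤ᵇ⇒≤ _ _ tt) (s≤s z≤n) near miss-const
  nochild : ∀ e → n ≤ e + (4 * m + 3) → ((25 * n ∸ 9) * (25 * n ∸ 9)) ^ e * 100 ≤ 50 * (25 * n * (25 * n)) ^ e
  nochild e near = decay 9 2500 9 100 50 e (≤-trans (≤ᵇ⇒≤ 9 25 tt) 25≤25n) (≤ᵇ⇒≤ _ _ tt) (s≤s z≤n) near nochild-const

-- gridExp M N k = M^k k! Σ_{j≤k} (N/M)^j / j!, the exponential sum on the grid of width 1/M.
gridExp : ℕ → ℕ → ℕ → ℕ
gridExp M N zero    = 1
gridExp M N (suc k) = suc k * M * gridExp M N k + N ^ suc k

-- The mean value estimate for one power, that is, for a single term of the exponential sum.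
suc-^-≤ : ∀ N k → suc N ^ suc k ≤ N ^ suc k + suc k * suc N ^ k
suc-^-≤ N zero    = ≤-reflexive (lem N)
  where
  lem : ∀ N → (1 + N) * 1 ≡ N * 1 + 1 * 1
  lem = solve-∀
suc-^-≤ N (suc k) = begin
  suc N * suc N ^ suc k                                          ≡⟨ lem₁ N (suc N ^ suc k) ⟩
  N * suc N ^ suc k + suc N ^ suc k                              ≤⟨ +-monoˡ-≤ (suc N ^ suc k) (*-monoʳ-≤ N (suc-^-≤ N k)) ⟩
  N * (N ^ suc k + suc k * suc N ^ k) + suc N ^ suc k            ≤⟨ m≤m+n _ (suc k * suc N ^ k) ⟩
  N * (N ^ suc k + suc k * suc N ^ k) + suc N ^ suc k + suc k * suc N ^ k ≡⟨ lem₂ N (N ^ suc k) (suc k) (suc N ^ k) ⟩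
  N * N ^ suc k + (1 + suc k) * (suc N * suc N ^ k)              ∎
  where
  lem₁ : ∀ N p → (1 + N) * p ≡ N * p + p
  lem₁ = solve-∀
  lem₂ : ∀ N p s q → N * (p + s * q) + (1 + N) * q + s * q ≡ N * p + (1 + s) * ((1 + N) * q)
  lem₂ = solve-∀

-- The discrete form of exp(x + h) - exp(x) ≤ h exp(x + h).
gridExp-increment : ∀ M N k → gridExp M (suc N) (suc k) ≤ gridExp M N (suc k) + suc k * gridExp M (suc N) k
gridExp-increment M N zero    = ≤-reflexive (lem M N)
  where
  lem : ∀ M N → 1 * M * 1 + (1 + N) * 1 ≡ 1 * M * 1 + N * 1 + 1 * 1
  lem = solve-∀
gridExp-increment M N (suc k) = begin
  (1 + s) * M * gridExp M (suc N) s + suc N ^ suc s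
    ≤⟨ +-mono-≤ (*-monoʳ-≤ ((1 + s) * M) (gridExp-increment M N k)) (suc-^-≤ N s) ⟩
  (1 + s) * M * (gridExp M N s + s * gridExp M (suc N) k) + (N ^ suc s + (1 + s) * suc N ^ s)
    ≡⟨ lem s M (gridExp M N s) (gridExp M (suc N) k) (N ^ suc s) (suc N ^ s) ⟩
  (1 + s) * M * gridExp M N s + N ^ suc s + (1 + s) * (s * M * gridExp M (suc N) k + suc N ^ s) ∎
  where
  s = suc k
  lem : ∀ s M a b p q → (1 + s) * M * (a + s * b) + (p + (1 + s) * q) ≡ (1 + s) * M * a + p + (1 + s) * (s * M * b + q)
  lem = solve-∀

-- With h = 1/(M+1) the increment is at most h times the sum at the right end point, so one step
-- multiplies the sum by at most 1/(1 - h) = (M+1)/M.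
gridExp-step : ∀ M N k → M * gridExp (suc M) (suc N) k ≤ suc M * gridExp (suc M) N k
gridExp-step M N zero    = *-monoˡ-≤ 1 (n≤1+n M)
gridExp-step M N (suc k) = +-cancelˡ-≤ G _ _ (begin
  G + M * G                                              ≤⟨ *-monoʳ-≤ (suc M) (gridExp-increment (suc M) N k) ⟩
  suc M * (gridExp (suc M) N (suc k) + suc k * g)        ≡⟨ lem (suc M) (gridExp (suc M) N (suc k)) (suc k) g ⟩
  suc k * suc M * g + suc M * gridExp (suc M) N (suc k)  ≤⟨ +-monoˡ-≤ (suc M * gridExp (suc M) N (suc k)) (m≤m+n (suc k * suc M * g) (suc N ^ suc k)) ⟩
  G + suc M * gridExp (suc M) N (suc k)                  ∎)
  where
  g = gridExp (suc M) (suc N) k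
  G = gridExp (suc M) (suc N) (suc k)
  lem : ∀ M a s g → M * (a + s * g) ≡ s * M * g + M * a
  lem = solve-∀

gridExp-zero : ∀ M k → gridExp M 0 k ≡ M ^ k * k !
gridExp-zero M zero    = refl
gridExp-zero M (suc k) = trans (+-identityʳ _) (trans (cong (suc k * M *_) (gridExp-zero M k)) (lem (suc k) M (M ^ k) (k !)))
  where
  lem : ∀ s M p f → s * M * (p * f) ≡ M * p * (s * f)
  lem = solve-∀

gridExp-integer : ∀ M r k → gridExp M (M * r) k ≡ M ^ k * expNum r k
gridExp-integer M r zero    = refl
gridExp-integer M r (suc k) = trans (cong₂ (λ x y → suc k * M * x + y) (gridExp-integer M r k) (^-distribʳ-* (suc k) M r))
  (lem (suc k) M (M ^ k) (expNum r k) (r ^ suc k))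
  where
  lem : ∀ s M p x y → s * M * (p * x) + M * p * y ≡ M * p * (s * x + y)
  lem = solve-∀

gridExp-bound : ∀ M N k → M ^ N * gridExp (suc M) N k ≤ suc M ^ N * (suc M ^ k * k !)
gridExp-bound M zero    k = ≤-reflexive (cong (1 *_) (gridExp-zero (suc M) k))
gridExp-bound M (suc N) k = begin
  M * M ^ N * gridExp (suc M) (suc N) k      ≡⟨ lem₁ M (M ^ N) _ ⟩
  M ^ N * (M * gridExp (suc M) (suc N) k)    ≤⟨ *-monoʳ-≤ (M ^ N) (gridExp-step M N k) ⟩
  M ^ N * (suc M * gridExp (suc M) N k)      ≡⟨ lem₂ (M ^ N) (suc M) _ ⟩
  suc M * (M ^ N * gridExp (suc M) N k)      ≤⟨ *-monoʳ-≤ (suc M) (gridExp-bound M N k) ⟩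
  suc M * (suc M ^ N * (suc M ^ k * k !))    ≡⟨ sym (*-assoc (suc M) (suc M ^ N) _) ⟩
  suc M * suc M ^ N * (suc M ^ k * k !)      ∎
  where
  lem₁ : ∀ a b c → a * b * c ≡ b * (a * c)
  lem₁ = solve-∀
  lem₂ : ∀ a b c → a * (b * c) ≡ b * (a * c)
  lem₂ = solve-∀

-- e ≤ a/b follows from (1 + 1/M)^(M+1) ≤ a/b.
expGe⇒≤ : ∀ M a b r x → 1 ≤ M → suc M ^ suc M * b ≤ a * M ^ suc M → ExpGe r x → x * b ^ r ≤ a ^ r
expGe⇒≤ M a b r x 1≤M const (k , h) = *-cancelʳ-≤ _ _ (M ^ N) {{>-nonZero (1≤^ N 1≤M)}} (begin
  x * b ^ r * M ^ N               ≡⟨ lem₁ x (b ^ r) (M ^ N) ⟩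
  M ^ N * x * b ^ r               ≤⟨ *-monoˡ-≤ (b ^ r) below ⟩
  suc M ^ N * b ^ r               ≡⟨ cong (_* b ^ r) (sym (^-*-assoc (suc M) (suc M) r)) ⟩
  (suc M ^ suc M) ^ r * b ^ r     ≡⟨ sym (^-distribʳ-* r (suc M ^ suc M) b) ⟩
  (suc M ^ suc M * b) ^ r         ≤⟨ ^-monoˡ-≤ r const ⟩
  (a * M ^ suc M) ^ r             ≡⟨ trans (^-distribʳ-* r a (M ^ suc M)) (cong (a ^ r *_) (^-*-assoc M (suc M) r)) ⟩
  a ^ r * M ^ N                   ∎)
  where
  N = suc M * r
  lem₁ : ∀ a b c → a * b * c ≡ c * a * b
  lem₁ = solve-∀
  below : M ^ N * x ≤ suc M ^ N
  below = *-cancelʳ-≤ _ _ (suc M ^ k * k !) {{>-nonZero (*-mono-≤ (1≤^ k (s≤s z≤n)) (1≤n! k))}} (begin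
    M ^ N * x * (suc M ^ k * k !)             ≡⟨ lem (M ^ N) x (suc M ^ k) (k !) ⟩
    M ^ N * (suc M ^ k * (x * k !))           ≤⟨ *-monoʳ-≤ (M ^ N) (*-monoʳ-≤ (suc M ^ k) h) ⟩
    M ^ N * (suc M ^ k * expNum r k)          ≡⟨ cong (M ^ N *_) (sym (gridExp-integer (suc M) r k)) ⟩
    M ^ N * gridExp (suc M) N k               ≤⟨ gridExp-bound M N k ⟩
    suc M ^ N * (suc M ^ k * k !)             ∎)
    where
    lem : ∀ a x p f → a * x * (p * f) ≡ a * (p * (x * f))
    lem = solve-∀

-- (1 + 1/999)^1000 is about 2.7196, just below 68/25 = 2.72.
e-const : 1000 ^ 1000 * 25 ≤ 68 * 999 ^ 1000
e-const = ≤ᵇ⇒≤ _ _ tt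

-- The radius compared with n, and the final comparison

ceil⇒lower : ∀ n r → IsCeil7Ln n r → n ^ 7 * 25 ^ r ≤ 68 ^ r
ceil⇒lower n r (ge , _) = expGe⇒≤ 999 68 25 r (n ^ 7) (s≤s z≤n) e-const ge

-- The single term s^8/8! of the exponential series already exceeds n^7 when s ≥ n/M and n ≥ 8! M^8.
-- This crude linear bound is enough to make the paths short compared with n.
ceil⇒upper : ∀ n r c M → 1 ≤ M → c ≡ 8 ! → c * M ^ 8 ≤ n → IsCeil7Ln n r → ∀ s → n ≤ M * s → r ≤ s
ceil⇒upper n r c M 1≤M c≡ big (_ , least) s n≤ = least s (8 , ≤-trans enough (m≤n+m (s ^ 8) (8 * expNum s 7)))
  where
  enough : n ^ 7 * 8 ! ≤ s ^ 8
  enough = subst (λ f → n ^ 7 * f ≤ s ^ 8) c≡ (*-cancelˡ-≤ (M ^ 8) {{>-nonZero (1≤^ 8 1≤M)}} (begin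
    M ^ 8 * (n ^ 7 * c)     ≡⟨ lem (M ^ 8) (n ^ 7) c ⟩
    c * M ^ 8 * n ^ 7       ≤⟨ *-monoˡ-≤ (n ^ 7) big ⟩
    n ^ 8                   ≤⟨ ^-monoˡ-≤ 8 n≤ ⟩
    (M * s) ^ 8             ≡⟨ ^-distribʳ-* 8 M s ⟩
    M ^ 8 * s ^ 8           ∎))
    where
    lem : ∀ a b c → a * (b * c) ≡ c * a * b
    lem = solve-∀

-- Write R = rem + q(h+1) and Q = a + q. Bernoulli gives (1 + 1/a)^q ≥ Q/a, and its (h+1)-st power
-- supplies Q^(h+1). Since R ≤ (h+1)Q, all but one of these factors absorb R^h, and the last absorbs
-- the constants once Q ≥ B.
exp-beats-power : ∀ a C h → 1 ≤ a → ∃[ R₀ ] (∀ R → R₀ ≤ R → C * R ^ h * a ^ R ≤ suc a ^ R)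
exp-beats-power a C h 1≤a = suc h * B , bound
  where
  B = C * suc h ^ h * a ^ suc h
  bound : ∀ R → suc h * B ≤ R → C * R ^ h * a ^ R ≤ suc a ^ R
  bound R le = begin
    C * R ^ h * a ^ R                       ≡⟨ cong (λ z → C * R ^ h * a ^ z) R≡ ⟩
    C * R ^ h * a ^ (rem + q * suc h)       ≡⟨ trans (cong (C * R ^ h *_) (^-distribˡ-+-* a rem (q * suc h))) (lem₁ (C * R ^ h) (a ^ rem) (a ^ (q * suc h))) ⟩
    a ^ rem * (C * R ^ h * a ^ (q * suc h)) ≤⟨ *-mono-≤ (^-monoˡ-≤ rem (n≤1+n a)) main ⟩
    suc a ^ rem * suc a ^ (q * suc h)             ≡⟨ sym (^-distribˡ-+-* (suc a) rem (q * suc h)) ⟩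
    suc a ^ (rem + q * suc h)                   ≡⟨ cong (suc a ^_) (sym R≡) ⟩
    suc a ^ R                                   ∎
    where
    q = R / suc h
    rem = R % suc h
    Q = a + q
    R≡ : R ≡ rem + q * suc h
    R≡ = m≡m%n+[m/n]*n R (suc h)
    rem< : rem < suc h
    rem< = m%n<n R (suc h)
    lem₁ : ∀ x b c → x * (b * c) ≡ b * (x * c)
    lem₁ = solve-∀
    R≤ : R ≤ suc h * Q
    R≤ = begin
      R                       ≡⟨ R≡ ⟩
      rem + q * suc h         ≤⟨ +-monoˡ-≤ (q * suc h) (<⇒≤ rem<) ⟩
      suc h + q * suc h       ≡⟨ cong (suc h +_) (*-comm q (suc h)) ⟩
      suc h + suc h * q       ≡⟨ sym (*-suc (suc h) q) ⟩
      suc h * suc q           ≤⟨ *-monoʳ-≤ (suc h) (+-monoˡ-≤ q 1≤a) ⟩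
      suc h * Q               ∎
    B≤Q : B ≤ Q
    B≤Q = *-cancelˡ-≤ (suc h) (≤-trans le R≤)
    one : Q * a ^ q ≤ suc a ^ q * a
    one = begin
      (a + q) * a ^ q               ≡⟨ *-comm Q (a ^ q) ⟩
      a ^ q * Q                       ≤⟨ bern q ⟩
      a * suc a ^ q                     ≡⟨ *-comm a (suc a ^ q) ⟩
      suc a ^ q * a                     ∎
      where
      bern : ∀ q → a ^ q * (a + q) ≤ a * suc a ^ q
      bern zero    = ≤-reflexive (trans (*-identityˡ (a + 0)) (trans (+-identityʳ a) (sym (*-identityʳ a))))
      bern (suc k) = begin
        a * a ^ k * (a + suc k)             ≤⟨ m≤m+n _ (a ^ k * k) ⟩
        a * a ^ k * (a + suc k) + a ^ k * k ≡⟨ lem a (a ^ k) k ⟩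
        suc a * (a ^ k * (a + k))               ≤⟨ *-monoʳ-≤ (suc a) (bern k) ⟩
        suc a * (a * suc a ^ k)                     ≡⟨ lem′ a (suc a) (suc a ^ k) ⟩
        a * (suc a * suc a ^ k)                     ∎
        where
        lem : ∀ a p k → a * p * (a + (1 + k)) + p * k ≡ (1 + a) * (p * (a + k))
        lem = solve-∀
        lem′ : ∀ a s p → s * (a * p) ≡ a * (s * p)
        lem′ = solve-∀
    main : C * R ^ h * a ^ (q * suc h) ≤ suc a ^ (q * suc h)
    main = *-cancelʳ-≤ _ _ (a ^ suc h) {{>-nonZero (1≤^ (suc h) 1≤a)}} (begin
      C * R ^ h * a ^ (q * suc h) * a ^ suc h        ≤⟨ *-monoˡ-≤ (a ^ suc h) (*-monoˡ-≤ (a ^ (q * suc h)) (*-monoʳ-≤ C (^-monoˡ-≤ h R≤))) ⟩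
      C * (suc h * Q) ^ h * a ^ (q * suc h) * a ^ suc h ≡⟨ cong (λ z → C * z * a ^ (q * suc h) * a ^ suc h) (^-distribʳ-* h (suc h) Q) ⟩
      C * (suc h ^ h * Q ^ h) * a ^ (q * suc h) * a ^ suc h ≡⟨ lem C (suc h ^ h) (Q ^ h) (a ^ (q * suc h)) (a ^ suc h) ⟩
      B * Q ^ h * a ^ (q * suc h)                      ≤⟨ *-monoˡ-≤ (a ^ (q * suc h)) (*-monoˡ-≤ (Q ^ h) B≤Q) ⟩
      Q ^ suc h * a ^ (q * suc h)                      ≡⟨ cong (Q ^ suc h *_) (sym (^-*-assoc a q (suc h))) ⟩
      Q ^ suc h * (a ^ q) ^ suc h                      ≡⟨ sym (^-distribʳ-* (suc h) Q (a ^ q)) ⟩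
      (Q * a ^ q) ^ suc h                              ≤⟨ ^-monoˡ-≤ (suc h) one ⟩
      (suc a ^ q * a) ^ suc h                            ≡⟨ trans (^-distribʳ-* (suc h) (suc a ^ q) a) (cong (_* a ^ suc h) (^-*-assoc (suc a) q (suc h))) ⟩
      suc a ^ (q * suc h) * a ^ suc h                    ∎)
      where
      lem : ∀ C a b c d → C * (a * b) * c * d ≡ C * a * d * b * c
      lem = solve-∀

^-^-swap : ∀ x i j → (x ^ i) ^ j ≡ (x ^ j) ^ i
^-^-swap x i j = trans (^-*-assoc x i j) (trans (cong (x ^_) (*-comm i j)) (sym (^-*-assoc x j i)))

-- Seventh powers turn the comparison of n³ p^R with q^R into one between 21st powers of n,
-- which n^7 ≤ (a/b)^R controls.
seventh-power : ∀ a b p q u v c n R → 1 ≤ b → 1 ≤ u → a ^ 3 * p ^ 7 * u ≤ b ^ 3 * q ^ 7 * v →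
  n ^ 7 * b ^ R ≤ a ^ R → c ^ 7 * R ^ 14 * v ^ R ≤ u ^ R → c * (R * R) * n ^ 3 * p ^ R ≤ q ^ R
seventh-power a b p q u v c n R 1≤b 1≤u const lower growth = ^-cancelˡ-≤ 7 _ _
  (*-cancelʳ-≤ _ _ ((b ^ R) ^ 3 * u ^ R) {{>-nonZero (*-mono-≤ (1≤^ 3 (1≤^ R 1≤b)) (1≤^ R 1≤u))}} (begin
  (c * (R * R) * n ^ 3 * p ^ R) ^ 7 * ((b ^ R) ^ 3 * u ^ R)
    ≡⟨ cong (_* ((b ^ R) ^ 3 * u ^ R)) spread ⟩
  c ^ 7 * R ^ 14 * (n ^ 7) ^ 3 * (p ^ 7) ^ R * ((b ^ R) ^ 3 * u ^ R)
    ≡⟨ lem₁ (c ^ 7 * R ^ 14) ((n ^ 7) ^ 3) ((p ^ 7) ^ R) ((b ^ R) ^ 3) (u ^ R) ⟩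
  c ^ 7 * R ^ 14 * ((n ^ 7) ^ 3 * (b ^ R) ^ 3 * (p ^ 7) ^ R * u ^ R)
    ≡⟨ cong (λ z → c ^ 7 * R ^ 14 * (z * (p ^ 7) ^ R * u ^ R)) (sym (^-distribʳ-* 3 (n ^ 7) (b ^ R))) ⟩
  c ^ 7 * R ^ 14 * ((n ^ 7 * b ^ R) ^ 3 * (p ^ 7) ^ R * u ^ R)
    ≤⟨ *-monoʳ-≤ (c ^ 7 * R ^ 14) (*-monoˡ-≤ (u ^ R) (*-monoˡ-≤ ((p ^ 7) ^ R) (^-monoˡ-≤ 3 lower))) ⟩
  c ^ 7 * R ^ 14 * ((a ^ R) ^ 3 * (p ^ 7) ^ R * u ^ R)
    ≡⟨ cong (c ^ 7 * R ^ 14 *_) (sym (trans (^-distribʳ-* R (a ^ 3 * p ^ 7) u)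
         (cong (_* u ^ R) (trans (^-distribʳ-* R (a ^ 3) (p ^ 7)) (cong (_* (p ^ 7) ^ R) (^-^-swap a 3 R)))))) ⟩
  c ^ 7 * R ^ 14 * (a ^ 3 * p ^ 7 * u) ^ R
    ≤⟨ *-monoʳ-≤ (c ^ 7 * R ^ 14) (^-monoˡ-≤ R const) ⟩
  c ^ 7 * R ^ 14 * (b ^ 3 * q ^ 7 * v) ^ R
    ≡⟨ cong (c ^ 7 * R ^ 14 *_) (trans (^-distribʳ-* R (b ^ 3 * q ^ 7) v)
         (cong (_* v ^ R) (trans (^-distribʳ-* R (b ^ 3) (q ^ 7)) (cong₂ _*_ (^-^-swap b 3 R) (^-^-swap q 7 R))))) ⟩
  c ^ 7 * R ^ 14 * ((b ^ R) ^ 3 * (q ^ R) ^ 7 * v ^ R)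
    ≡⟨ lem₂ (c ^ 7 * R ^ 14) ((b ^ R) ^ 3) ((q ^ R) ^ 7) (v ^ R) ⟩
  c ^ 7 * R ^ 14 * v ^ R * ((b ^ R) ^ 3 * (q ^ R) ^ 7)
    ≤⟨ *-monoˡ-≤ ((b ^ R) ^ 3 * (q ^ R) ^ 7) growth ⟩
  u ^ R * ((b ^ R) ^ 3 * (q ^ R) ^ 7)
    ≡⟨ lem₃ (u ^ R) ((b ^ R) ^ 3) ((q ^ R) ^ 7) ⟩
  (q ^ R) ^ 7 * ((b ^ R) ^ 3 * u ^ R) ∎))
  where
  open ≤-Reasoning
  lem₁ : ∀ c x y z w → c * x * y * (z * w) ≡ c * (x * z * y * w)
  lem₁ = solve-∀
  lem₂ : ∀ c x y z → c * (x * y * z) ≡ c * z * (x * y)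
  lem₂ = solve-∀
  lem₃ : ∀ x y z → x * (y * z) ≡ z * (y * x)
  lem₃ = solve-∀
  spread : (c * (R * R) * n ^ 3 * p ^ R) ^ 7 ≡ c ^ 7 * R ^ 14 * (n ^ 7) ^ 3 * (p ^ 7) ^ R
  spread = trans (^-distribʳ-* 7 (c * (R * R) * n ^ 3) (p ^ R)) (cong₂ _*_
    (trans (^-distribʳ-* 7 (c * (R * R)) (n ^ 3)) (cong₂ _*_
      (trans (^-distribʳ-* 7 c (R * R)) (cong (c ^ 7 *_) (trans (^-distribʳ-* 7 R R) (sym (^-distribˡ-+-* R 7 7)))))
      (^-^-swap n 3 7)))
    (^-^-swap p R 7))

-- e³ · 0.65⁷ < 1, with e ≤ 2.72 and a margin of 1% to absorb powers of R.
power-const : 68 ^ 3 * 65 ^ 7 * 101 ≤ 25 ^ 3 * 100 ^ 7 * 100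
power-const = ≤ᵇ⇒≤ _ _ tt

-- From 68/25 < 75/25 = 3 follows n ≤ n^7 ≤ 3^r, so the radius tends to infinity with n.
large-radius : ∀ n r R₀ → 3 ^ R₀ < n → n ^ 7 * 25 ^ r ≤ 68 ^ r → R₀ ≤ r
large-radius n r R₀ n> h with R₀ ≤? r
... | yes le = le
... | no ≰ = ⊥-elim (<⇒≱ n> (begin
  n              ≤⟨ subst (_≤ n ^ 7) (*-identityʳ n) (^-monoʳ-≤ n {{>-nonZero (≤-trans (s≤s z≤n) n>)}} {1} {7} (s≤s z≤n)) ⟩
  n ^ 7          ≤⟨ *-cancelʳ-≤ _ _ (25 ^ r) {{m^n≢0 25 r}} (≤-trans h (≤-trans (^-monoˡ-≤ r (≤ᵇ⇒≤ 68 75 tt)) (≤-reflexive (^-distribʳ-* r 3 25)))) ⟩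
  3 ^ r          ≤⟨ ^-monoʳ-≤ 3 (<⇒≤ (≰⇒> ≰)) ⟩
  3 ^ R₀         ∎))
  where open ≤-Reasoning

-- Trading n^n for n² times n^(n-2), the number of trees, leaves the factor n³ that the decay has to
-- beat.
combine : ∀ k R c n np nn b p q → nn ≡ n * (n * np) → 1 ≤ q → b * q ≤ R * R * c * (n * nn) * p →
          k * c * (R * R) * n ^ 3 * p ≤ q → k * b ≤ np
combine k R c n np nn b p q nn≡ 1≤q bad≤ small = *-cancelʳ-≤ _ _ q {{>-nonZero 1≤q}} (begin
  k * b * q                                     ≡⟨ *-assoc k b q ⟩
  k * (b * q)                                   ≤⟨ *-monoʳ-≤ k bad≤ ⟩
  k * (R * R * c * (n * nn) * p)                ≡⟨ cong (λ z → k * (R * R * c * (n * z) * p)) nn≡ ⟩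
  k * (R * R * c * (n * (n * (n * np))) * p)    ≡⟨ regroup k R c n np p ⟩
  k * c * (R * R) * n ^ 3 * p * np              ≤⟨ *-monoˡ-≤ np small ⟩
  q * np                                        ≡⟨ *-comm q np ⟩
  np * q                                        ∎)
  where
  open ≤-Reasoning
  regroup : ∀ k R c n x y → k * (R * R * c * (n * (n * (n * x))) * y) ≡ k * c * (R * R) * (n * (n * (n * 1))) * y * x
  regroup = solve-∀

grid : ∀ M .{{_ : NonZero M}} n → ∃[ s ] (n ≤ M * s × M * s ≤ n + M)
grid M n = suc (n / M) , lower , upper
  where
  open ≤-Reasoning
  lower : n ≤ M * suc (n / M)
  lower = begin
    n                          ≡⟨ m≡m%n+[m/n]*n n M ⟩
    n % M + n / M * M          ≤⟨ +-monoˡ-≤ (n / M * M) (<⇒≤ (m%n<n n M)) ⟩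
    suc (n / M) * M            ≡⟨ *-comm (suc (n / M)) M ⟩
    M * suc (n / M)            ∎
  upper : M * suc (n / M) ≤ n + M
  upper = begin
    M * suc (n / M)            ≡⟨ *-comm M (suc (n / M)) ⟩
    M + n / M * M              ≤⟨ +-monoʳ-≤ M (m/n*n≤m n M) ⟩
    M + n                      ≡⟨ +-comm M n ⟩
    n + M                      ∎

-- Passes from the radius r to r + 1, the number of path vertices, which is the exponent in
-- `bad-bound`.
lower-suc : ∀ x a b r → b ≤ a → x * b ^ r ≤ a ^ r → x * b ^ suc r ≤ a ^ suc r
lower-suc x a b r b≤a h = ≤-trans (≤-reflexive (lem x b (b ^ r))) (*-mono-≤ b≤a h)
  where
  lem : ∀ x b c → x * (b * c) ≡ b * (x * c)
  lem = solve-∀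

ceil⇒small : ∀ n r → 40320 * 1000 ^ 8 ≤ n → IsCeil7Ln n r → 1000 * r ≤ n + 1000
ceil⇒small n r big ceil =
  let s , n≤ , s≤ = grid 1000 n in ≤-trans (*-monoʳ-≤ 1000 (ceil⇒upper n r 40320 1000 (s≤s z≤n) refl big ceil s n≤)) s≤

rare : ∀ k p m → 1000 * suc m ≤ suc (suc p) + 1000 → 1000000000 ≤ suc (suc p) → suc (suc p) ^ 7 * 25 ^ suc (suc m) ≤ 68 ^ suc (suc m) →
  (suc k * 16384) ^ 7 * suc (suc m) ^ 14 * 100 ^ suc (suc m) ≤ 101 ^ suc (suc m) →
  ∀ {bad : List (Graph (suc (suc p)))} → Enumerates bad (λ T → IsTree T × BadTree (suc m) T) → suc k * length bad ≤ suc (suc p) ^ p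
rare k p m small big lower growth {bad} enum =
  combine (suc k) (suc (suc m)) 16384 (suc (suc p)) (suc (suc p) ^ p) (suc (suc p) ^ suc (suc p)) (length bad)
    (65 ^ suc (suc m)) (100 ^ suc (suc m)) refl (1≤^ {100} (suc (suc m)) (s≤s z≤n))
    (bad-bound {suc p} {m} (regime (suc p) (suc m) small big) {bad} enum)
    (seventh-power 68 25 65 100 101 100 (suc k * 16384) (suc (suc p)) (suc (suc m)) (s≤s z≤n) (s≤s z≤n) power-const lower growth)

eventually : ∀ k R₀ B → 40320 * 1000 ^ 8 ≤ B → 1000000000 ≤ B → 2 ≤ B →
  (∀ R → R₀ ≤ R → (suc k * 16384) ^ 7 * R ^ 14 * 100 ^ R ≤ 101 ^ R) →
  ∀ n → 3 ^ R₀ < n → B ≤ n → ∀ r₀ → IsCeil7Ln n r₀ → ∀ {trees bad : List (Graph n)} → Enumerates trees IsTree →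
  Enumerates bad (λ T → IsTree T × BadTree r₀ T) → suc k * length bad ≤ length trees
eventually k R₀ B _ _ 2≤B growth zero _ B≤ _ _ _ _ = ⊥-elim (<⇒≱ (≤-trans (s≤s z≤n) (≤-trans 2≤B B≤)) z≤n)
eventually k R₀ B _ _ 2≤B growth (suc zero) _ B≤ _ _ _ _ = ⊥-elim (<⇒≱ {1} (≤-trans 2≤B B≤) ≤-refl)
-- Radius 0 would mean n^7 ≤ 1. From here on a path has an edge, as the encoding by second and
-- penultimate vertices supposes.
eventually k R₀ B _ _ 2≤B growth (suc (suc p)) _ _ zero ceil _ _ = ⊥-elim (<⇒≱ {1} {n ^ 7} 1<n⁷ (subst (_≤ 1) (*-identityʳ (n ^ 7)) (ceil⇒lower n 0 ceil)))
  where
  n = suc (suc p)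
  1<n⁷ : 1 < n ^ 7
  1<n⁷ = ≤-trans (s≤s (s≤s z≤n)) (subst (_≤ n ^ 7) (*-identityʳ n) (^-monoʳ-≤ n {1} {7} (s≤s z≤n)))
eventually k R₀ B B₁ B₂ _ growth (suc (suc p)) n> B≤ (suc m) ceil enumTrees enumBad =
  ≤-trans (rare k p m (ceil⇒small n (suc m) (≤-trans B₁ B≤) ceil) (≤-trans B₂ B≤) (lower-suc (n ^ 7) 68 25 (suc m) (≤ᵇ⇒≤ 25 68 tt) lower)
            (growth (suc (suc m)) (≤-trans (large-radius n (suc m) R₀ n> lower) (n≤1+n (suc m)))) enumBad)
          (cayley-≤ p enumTrees)
  where
  n = suc (suc p)
  lower : n ^ 7 * 25 ^ suc m ≤ 68 ^ suc m
  lower = ceil⇒lower n (suc m) ceil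

large : ∃[ B ] (40320 * 1000 ^ 8 ≤ B × 1000000000 ≤ B × 2 ≤ B)
large = 40320 * 1000 ^ 8 , ≤-refl , ≤ᵇ⇒≤ _ _ tt , ≤ᵇ⇒≤ _ _ tt

theorem6 : ∀ (k : ℕ) → ∃[ N ] (∀ (n : ℕ) → N ≤ n → ∀ (r₀ : ℕ) → IsCeil7Ln n r₀ →
    ∀ (trees bad : List (Graph n)) →
    Enumerates trees IsTree →
    Enumerates bad (λ T → IsTree T × BadTree r₀ T) →
    suc k * length bad ≤ length trees)
-- Taking seventh powers turns the factor 16384 (k+1) R² into its seventh power, of degree 14 in R;
-- the ratio 101/100 is the margin left in `power-const`.
theorem6 k = finish (exp-beats-power 100 ((suc k * 16384) ^ 7) 14 (s≤s z≤n)) large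
  where
  finish : ∃[ R₀ ] (∀ R → R₀ ≤ R → (suc k * 16384) ^ 7 * R ^ 14 * 100 ^ R ≤ 101 ^ R) →
           ∃[ B ] (40320 * 1000 ^ 8 ≤ B × 1000000000 ≤ B × 2 ≤ B) →
           ∃[ N ] (∀ (n : ℕ) → N ≤ n → ∀ (r₀ : ℕ) → IsCeil7Ln n r₀ → ∀ (trees bad : List (Graph n)) →
             Enumerates trees IsTree → Enumerates bad (λ T → IsTree T × BadTree r₀ T) → suc k * length bad ≤ length trees)
  finish (R₀ , growth) (B , B₁ , B₂ , 2≤B) = suc (3 ^ R₀) + B , λ n N≤n r₀ ceil trees bad →
    eventually k R₀ B B₁ B₂ 2≤B growth n (≤-trans (m≤m+n (suc (3 ^ R₀)) B) N≤n) (≤-trans (m≤n+m B (suc (3 ^ R₀))) N≤n) r₀ ceil
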